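{- For each positive integer $r$ there is a positive integer $k$ such that, with probability tending to $1$ as $n\to\infty$, the random hypergraph $\mathcal{H}=\mathcal{K}^{(r)}_{n\times r}(k\text{ -out})$ admits a perfect fractional matching, and every minimum weight fractional cover of $\mathcal{H}$ is constant on each block $V_i$ of the $r$-partition.
   Context: $\mathcal{K}^{(r)}_{n\times r}$ denotes the complete $r$-partite $r$-graph with vertex set $V=V_1\cup\cdots\cup V_r$ (disjoint, $|V_i|=n$ for each $i$), whose edges are all sets containing exactly one vertex from each $V_i$. The $k$-out model: for a host hypergraph $\mathcal{H}$ on $V$, the random subhypergraph $\mathcal{H}(k\text{ -out})$ is $\bigcup_{v\in V}E_v$, where, for each $v$, $E_v$ is chosen uniformly at random from the $k$-element subsets of $\mathcal{H}_v=\{A\in\mathcal{H}: v\in A\}$ (or $E_v=\mathcal{H}_v$ if $|\mathcal{H}_v|<k$), independently over $v$. A fractional cover is a map $w:V\to[0,1]$ with $\sum_{v\in e}w(v)\ge1$ for every edge $e$; its weight is $\sum_v w(v)$. A fractional matching is a map $\varphi$ from edges to $[0,1]$ with $\sum_{e\ni v}\varphi(e)\le1$ for every vertex $v$; it is perfect if $\sum_{e\ni v}\varphi(e)=1$ for every vertex $v$ (equivalently, its weight $\sum_e\varphi(e)$ equals $|V|/r=n$).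
   Formalization: Fractional covers and fractional matchings take rational rather than real values; minimum weight covers are those of least weight among rational-valued covers, and only these are shown to be constant on each block. -}

module Defs where

open import Data.Nat as ℕ using (ℕ; zero; suc; _<?_)
open import Data.Fin as Fin using (Fin)
open import Data.Fin.Properties using () renaming (_≟_ to _≟ᶠ_)
open import Data.Vec as Vec using (Vec; []; _∷_; lookup)
open import Data.Vec.Properties using (≡-dec)
open import Data.List as List using (List; []; _∷_; [_]; map; concatMap; concat; filter; allFin; length; _++_; foldr)
open import Data.List.Membership.Propositional using (_∈_)
open import Data.Product using (Σ; _×_; _,_; proj₁; proj₂)
open import Data.Rational using (ℚ; 0ℚ; 1ℚ; _+_; _≤_; _/_)
open import Data.Integer using (+_)
open import Relation.Binary.PropositionalEquality using (_≡_)
open import Relation.Binary.Definitions using (DecidableEquality)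
open import Relation.Nullary using (Dec; yes; no)

-- The host hypergraph K^{(r)}_{n×r}
-- Vertex (i , j) is the j-th vertex of block V_i.
-- An edge is a vector e of length r; its vertex set is {(i , e[i]) : i}.

Vertex : ℕ → ℕ → Set
Vertex r n = Fin r × Fin n

Edge : ℕ → ℕ → Set
Edge r n = Vec (Fin n) r

_∈ₑ_ : ∀ {r n} → Vertex r n → Edge r n → Set
(i , j) ∈ₑ e = lookup e i ≡ j

_∈ₑ?_ : ∀ {r n} (v : Vertex r n) (e : Edge r n) → Dec (v ∈ₑ e)
(i , j) ∈ₑ? e = lookup e i ≟ᶠ j

edge-≟ : ∀ {r n} → DecidableEquality (Edge r n)
edge-≟ = ≡-dec _≟ᶠ_

allEdges : ∀ r n → List (Edge r n)
allEdges zero    n = [ [] ]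
allEdges (suc r) n = concatMap (λ x → map (x ∷_) (allEdges r n)) (allFin n)

allVertices : ∀ r n → List (Vertex r n)
allVertices r n = concatMap (λ i → map (i ,_) (allFin n)) (allFin r)

hostStar : ∀ {r n} → Vertex r n → List (Edge r n)
hostStar {r} {n} v = filter (v ∈ₑ?_) (allEdges r n)

subsets : {A : Set} → ℕ → List A → List (List A)
subsets zero    xs       = [ [] ]
subsets (suc k) []       = []
subsets (suc k) (x ∷ xs) = map (x ∷_) (subsets k xs) ++ subsets (suc k) xs

-- the possible values of E_v (uniformly distributed)
choices : ∀ {r n} → ℕ → Vertex r n → List (List (Edge r n))
choices k v with length (hostStar v) <? k
... | yes _ = [ hostStar v ]
... | no  _ = subsets k (hostStar v)

cartesian : {A : Set} → List (List A) → List (List A)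
cartesian []         = [ [] ]
cartesian (xs ∷ xss) = concatMap (λ x → map (x ∷_) (cartesian xss)) xs

-- An outcome lists (E_v) in the order of allVertices r n.
-- The sample space is uniform over this duplicate-free list.
Outcome : ℕ → ℕ → Set
Outcome r n = List (List (Edge r n))

sampleSpace : ∀ r n k → List (Outcome r n)
sampleSpace r n k = cartesian (map (choices k) (allVertices r n))

-- the random hypergraph 𝓗(k-out) = ⋃_v E_v  (duplicate-free edge list)
edgesOf : ∀ {r n} → Outcome r n → List (Edge r n)
edgesOf {r} {n} ω = filter (λ e → Data.List.Membership.DecPropositional._∈?_ edge-≟ e (concat ω)) (allEdges r n)
  where import Data.List.Membership.DecPropositional

Σℚ : {A : Set} → (A → ℚ) → List A → ℚ
Σℚ f = foldr (λ a s → f a + s) 0ℚ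

ℕtoℚ : ℕ → ℚ
ℕtoℚ m = + m / 1

star : ∀ {r n} → Outcome r n → Vertex r n → List (Edge r n)
star ω v = filter (v ∈ₑ?_) (edgesOf ω)

IsFractionalMatching : ∀ {r n} → Outcome r n → (Edge r n → ℚ) → Set
IsFractionalMatching {r} {n} ω φ =
  (∀ e → e ∈ edgesOf ω → (0ℚ ≤ φ e) × (φ e ≤ 1ℚ)) ×
  (∀ (v : Vertex r n) → Σℚ φ (star ω v) ≤ 1ℚ)

IsPerfectFractionalMatching : ∀ {r n} → Outcome r n → (Edge r n → ℚ) → Set
IsPerfectFractionalMatching {r} {n} ω φ =
  IsFractionalMatching ω φ × (∀ (v : Vertex r n) → Σℚ φ (star ω v) ≡ 1ℚ)

edgeWeight : ∀ {r n} → (Vertex r n → ℚ) → Edge r n → ℚ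
edgeWeight {r} w e = Σℚ (λ i → w (i , lookup e i)) (allFin r)

IsFractionalCover : ∀ {r n} → Outcome r n → (Vertex r n → ℚ) → Set
IsFractionalCover {r} {n} ω w =
  (∀ (v : Vertex r n) → (0ℚ ≤ w v) × (w v ≤ 1ℚ)) ×
  (∀ e → e ∈ edgesOf ω → 1ℚ ≤ edgeWeight w e)

coverWeight : ∀ {r n} → (Vertex r n → ℚ) → ℚ
coverWeight {r} {n} w = Σℚ w (allVertices r n)

IsMinFractionalCover : ∀ {r n} → Outcome r n → (Vertex r n → ℚ) → Set
IsMinFractionalCover {r} {n} ω w =
  IsFractionalCover ω w ×
  (∀ (w′ : Vertex r n → ℚ) → IsFractionalCover ω w′ → coverWeight w ≤ coverWeight w′)

ConstantOnBlocks : ∀ {r n} → (Vertex r n → ℚ) → Set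
ConstantOnBlocks {r} {n} w = ∀ (i : Fin r) (j j′ : Fin n) → w (i , j) ≡ w (i , j′)

Good : ∀ {r n} → Outcome r n → Set
Good {r} {n} ω =
  Σ (Edge r n → ℚ) (IsPerfectFractionalMatching ω) ×
  (∀ (w : Vertex r n → ℚ) → IsMinFractionalCover ω w → ConstantOnBlocks w)

-- With high probability H is expansive: a vertex set X in one block is joined by an edge to the complement
-- of any sets Z_j in the other blocks, unless some Z_j is larger than c|X| (capped a little below n). This is a
-- union bound: a vertex misses the box of complements with all its choices with probability at most (z/n)^K,
-- where z = |Z_j| and K grows with k, and there are at most (O(n/x))^x (O(n/z))^(rz) pairs (X, Z), x = |X|.
--
-- In an expansive H every y : V → ℚ with nonnegative edge sums has a nonnegative total, and the total vanishes
-- only if y is constant on blocks: relative to suitable thresholds t_i with ∑ t_i = 0, the vertices where y lies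
-- far below the threshold are separated from the rest by those where it lies above, which are therefore many more.
-- Farkas' lemma turns this into a perfect fractional matching. For a minimum cover w, apply it to w minus the
-- indicator of V_1.
module Submission where

-- `c` has to exceed r² because two factors r are lost: surplus is compared at level θ/r, since up
-- to r vertices of an edge share it, and each of the r blocks is charged with the surplus of all
-- blocks. The number m = ⌊n/(c+1)⌋ reconciles opposite demands. At most m vertices of a block lie
-- below its threshold, so that c times their number still fits under the cap n - (m+1); more than m
-- lie at or below the threshold before it is lowered, so that c times their number reaches the cap.
-- The same cap keeps every Z_j below cn/(c+1), so that a box retains a proportion of the stars
-- through X that is bounded away from 0. Thresholds and layers need discrete weights: a rational y
-- is replaced by qy + B in ℕ, which turns the sign of an edge sum into a comparison with T = rB and
-- the sign of the total into a comparison with nT. Probabilities are counts in the list of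
-- outcomes, with all inequalities multiplied out. The bad proportion is at most rc/n: for |X| = x
-- the powers of z/n pay for the number of pairs (X, Z), for 1/n and for 2^-x, so that the sum over
-- x is geometric.

open import Defs

-- Sums, products and counts of natural numbers over lists.

module Sums where
  open import Data.Bool.Base using (Bool; true; false; not; _∧_)
  open import Data.Bool.ListAction using (any; all)
  open import Data.Fin.Base using (Fin; zero; suc; toℕ)
  open import Data.List.Base using (List; []; _∷_; _++_; map; concatMap; filter; filterᵇ; length; allFin)
  open import Data.List.Properties using (map-tabulate; length-tabulate)
  open import Data.List.Membership.Propositional using (_∈_)
  open import Data.List.Relation.Unary.Any using (here; there)
  open import Data.Nat.Base
  open import Data.Nat.Properties
  open import Data.Nat.Tactic.RingSolver using (solve-∀)
  open import Data.Product.Base using (Σ; _×_; _,_)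
  open import Function.Base using (id; _∘_; _∋_; const)
  open import Relation.Nullary using (does)
  open import Relation.Unary using (Decidable)
  open import Relation.Binary.PropositionalEquality

  ∑ : {A : Set} → (A → ℕ) → List A → ℕ
  ∑ f []       = 0
  ∑ f (x ∷ xs) = f x + ∑ f xs

  ∏ : {A : Set} → (A → ℕ) → List A → ℕ
  ∏ f []       = 1
  ∏ f (x ∷ xs) = f x * ∏ f xs

  𝟙 : Bool → ℕ
  𝟙 true  = 1
  𝟙 false = 0

  count : {A : Set} → (A → Bool) → List A → ℕ
  count p = ∑ (𝟙 ∘ p)

  private
    interchange : ∀ a b c d → (a + b) + (c + d) ≡ (a + c) + (b + d)
    interchange = solve-∀

    *-interchange : ∀ a b c d → (a * b) * (c * d) ≡ (a * c) * (b * d)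
    *-interchange = solve-∀

  module _ {A : Set} where
    ∑-cong : {f g : A → ℕ} → (∀ x → f x ≡ g x) → ∀ xs → ∑ f xs ≡ ∑ g xs
    ∑-cong f≗g []       = refl
    ∑-cong f≗g (x ∷ xs) = cong₂ _+_ (f≗g x) (∑-cong f≗g xs)

    ∑-mono-∈ : {f g : A → ℕ} → ∀ xs → (∀ x → x ∈ xs → f x ≤ g x) → ∑ f xs ≤ ∑ g xs
    ∑-mono-∈ []       f≤g = z≤n
    ∑-mono-∈ (x ∷ xs) f≤g = +-mono-≤ (f≤g x (here refl)) (∑-mono-∈ xs λ y y∈ → f≤g y (there y∈))

    ∑-mono : {f g : A → ℕ} → (∀ x → f x ≤ g x) → ∀ xs → ∑ f xs ≤ ∑ g xs
    ∑-mono f≤g xs = ∑-mono-∈ xs λ x _ → f≤g x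

    ∑-distrib-+ : (f g : A → ℕ) → ∀ xs → ∑ (λ x → f x + g x) xs ≡ ∑ f xs + ∑ g xs
    ∑-distrib-+ f g []       = refl
    ∑-distrib-+ f g (x ∷ xs) = trans (cong (f x + g x +_) (∑-distrib-+ f g xs)) (interchange (f x) (g x) _ _)

    *-distribˡ-∑ : ∀ c (f : A → ℕ) xs → c * ∑ f xs ≡ ∑ (λ x → c * f x) xs
    *-distribˡ-∑ c f []       = *-zeroʳ c
    *-distribˡ-∑ c f (x ∷ xs) = trans (*-distribˡ-+ c (f x) _) (cong (c * f x +_) (*-distribˡ-∑ c f xs))

    *-distribʳ-∑ : ∀ c (f : A → ℕ) xs → ∑ f xs * c ≡ ∑ (λ x → f x * c) xs
    *-distribʳ-∑ c f []       = refl
    *-distribʳ-∑ c f (x ∷ xs) = trans (*-distribʳ-+ c (f x) _) (cong (f x * c +_) (*-distribʳ-∑ c f xs))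

    ∑-const : ∀ c (xs : List A) → ∑ (const c) xs ≡ length xs * c
    ∑-const c []       = refl
    ∑-const c (x ∷ xs) = cong (c +_) (∑-const c xs)

    ∑-≥-∈ : (f : A → ℕ) → ∀ {x xs} → x ∈ xs → f x ≤ ∑ f xs
    ∑-≥-∈ f {xs = y ∷ xs} (here refl) = m≤m+n (f y) _
    ∑-≥-∈ f {xs = y ∷ xs} (there x∈)  = ≤-trans (∑-≥-∈ f x∈) (m≤n+m _ (f y))

    ∑-++ : (f : A → ℕ) → ∀ xs ys → ∑ f (xs ++ ys) ≡ ∑ f xs + ∑ f ys
    ∑-++ f []       ys = refl
    ∑-++ f (x ∷ xs) ys = trans (cong (f x +_) (∑-++ f xs ys)) (sym (+-assoc (f x) _ _))

    ∑-map : {B : Set} (f : A → ℕ) (h : B → A) → ∀ xs → ∑ f (map h xs) ≡ ∑ (f ∘ h) xs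
    ∑-map f h []       = refl
    ∑-map f h (x ∷ xs) = cong (f (h x) +_) (∑-map f h xs)

    ∑-concatMap : {B : Set} (f : A → ℕ) (h : B → List A) → ∀ xs → ∑ f (concatMap h xs) ≡ ∑ (λ x → ∑ f (h x)) xs
    ∑-concatMap f h []       = refl
    ∑-concatMap f h (x ∷ xs) = trans (∑-++ f (h x) _) (cong (∑ f (h x) +_) (∑-concatMap f h xs))

    ∏-cong : {f g : A → ℕ} → (∀ x → f x ≡ g x) → ∀ xs → ∏ f xs ≡ ∏ g xs
    ∏-cong f≗g []       = refl
    ∏-cong f≗g (x ∷ xs) = cong₂ _*_ (f≗g x) (∏-cong f≗g xs)

    ∏-mono : {f g : A → ℕ} → (∀ x → f x ≤ g x) → ∀ xs → ∏ f xs ≤ ∏ g xs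
    ∏-mono f≤g []       = ≤-refl
    ∏-mono f≤g (x ∷ xs) = *-mono-≤ (f≤g x) (∏-mono f≤g xs)

    ∏-distrib-* : (f g : A → ℕ) → ∀ xs → ∏ (λ x → f x * g x) xs ≡ ∏ f xs * ∏ g xs
    ∏-distrib-* f g []       = refl
    ∏-distrib-* f g (x ∷ xs) = trans (cong (f x * g x *_) (∏-distrib-* f g xs)) (*-interchange (f x) (g x) _ _)

    ∏-const : ∀ c (xs : List A) → ∏ (const c) xs ≡ c ^ length xs
    ∏-const c []       = refl
    ∏-const c (x ∷ xs) = cong (c *_) (∏-const c xs)

    -- Spreads a power over all elements of a list, so that it can be compared factor by factor with
    -- another product.
    ∏-^𝟙 : ∀ c (p : A → Bool) xs → ∏ (λ x → c ^ 𝟙 (p x)) xs ≡ c ^ count p xs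
    ∏-^𝟙 c p []       = refl
    ∏-^𝟙 c p (x ∷ xs) = trans (cong (c ^ 𝟙 (p x) *_) (∏-^𝟙 c p xs)) (sym (^-distribˡ-+-* c (𝟙 (p x)) _))

    ∏-map : {B : Set} (f : A → ℕ) (h : B → A) → ∀ xs → ∏ f (map h xs) ≡ ∏ (f ∘ h) xs
    ∏-map f h []       = refl
    ∏-map f h (x ∷ xs) = cong (f (h x) *_) (∏-map f h xs)

    count-cong : {p q : A → Bool} → (∀ x → p x ≡ q x) → ∀ xs → count p xs ≡ count q xs
    count-cong p≗q = ∑-cong λ x → cong 𝟙 (p≗q x)

    count-mono : {p q : A → Bool} → (∀ x → p x ≡ true → q x ≡ true) → ∀ xs → count p xs ≤ count q xs
    count-mono {p} {q} p⇒q = ∑-mono step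
      where
      step : ∀ x → 𝟙 (p x) ≤ 𝟙 (q x)
      step x with p x in px
      ... | false = z≤n
      ... | true  = ≤-reflexive (cong 𝟙 (sym (p⇒q x px)))

    count-true : (xs : List A) → count (const true) xs ≡ length xs
    count-true xs = trans (∑-const 1 xs) (*-identityʳ _)

    count-not : (p : A → Bool) → ∀ xs → count p xs + count (not ∘ p) xs ≡ length xs
    count-not p xs = trans (sym (∑-distrib-+ _ _ xs)) (trans (∑-cong (λ x → 𝟙+𝟙not (p x)) xs) (count-true xs))
      where
      𝟙+𝟙not : ∀ b → 𝟙 b + 𝟙 (not b) ≡ 1
      𝟙+𝟙not true  = refl
      𝟙+𝟙not false = refl

    count≤length : (p : A → Bool) → ∀ xs → count p xs ≤ length xs
    count≤length p xs = ≤-trans (m≤m+n _ _) (≤-reflexive (count-not p xs))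

    length-filterᵇ : (p : A → Bool) → ∀ xs → length (filterᵇ p xs) ≡ count p xs
    length-filterᵇ p []       = refl
    length-filterᵇ p (x ∷ xs) with p x
    ... | true  = cong suc (length-filterᵇ p xs)
    ... | false = length-filterᵇ p xs

    count-filter : (p : A → Bool) {P : A → Set} (P? : Decidable P) → ∀ xs →
                   count p (filter P? xs) ≡ count (λ x → does (P? x) ∧ p x) xs
    count-filter p P? []       = refl
    count-filter p P? (x ∷ xs) with does (P? x)
    ... | true  = cong (𝟙 (p x) +_) (count-filter p P? xs)
    ... | false = count-filter p P? xs

    count-∃ : (p : A → Bool) → ∀ xs → 1 ≤ count p xs → Σ A λ x → x ∈ xs × p x ≡ true
    count-∃ p (x ∷ xs) 1≤ with p x in px
    ... | true  = x , here refl , px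
    ... | false with count-∃ p xs 1≤
    ...   | y , y∈ , py = y , there y∈ , py

    any-false : {p : A → Bool} → ∀ {x} xs → any p xs ≡ false → x ∈ xs → p x ≡ false
    any-false {p} (x ∷ xs) eq (here refl) with p x
    ... | false = refl
    any-false {p} (x ∷ xs) eq (there y∈) with p x
    ... | false = any-false xs eq y∈

    all-false : (p : A → Bool) → ∀ xs → all p xs ≡ false → Σ A λ x → x ∈ xs × p x ≡ false
    all-false p (x ∷ xs) eq with p x in px
    ... | false = x , here refl , px
    ... | true with all-false p xs eq
    ...   | y , y∈ , py = y , there y∈ , py

    -- The union bound, with counts in place of probabilities.
    count-any : {B : Set} (p : B → A → Bool) → ∀ ts xs →
                count (λ x → any (λ t → p t x) ts) xs ≤ ∑ (λ t → count (p t) xs) ts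
    count-any p []       xs = ≤-reflexive (trans (∑-const 0 xs) (*-zeroʳ (length xs)))
    count-any p (t ∷ ts) xs = begin
      count (λ x → any (λ t → p t x) (t ∷ ts)) xs
        ≤⟨ ∑-mono (λ x → 𝟙-∨ (p t x) _) xs ⟩
      ∑ (λ x → 𝟙 (p t x) + 𝟙 (any (λ t → p t x) ts)) xs
        ≡⟨ ∑-distrib-+ _ _ xs ⟩
      count (p t) xs + count (λ x → any (λ t → p t x) ts) xs
        ≤⟨ +-monoʳ-≤ (count (p t) xs) (count-any p ts xs) ⟩
      count (p t) xs + ∑ (λ t → count (p t) xs) ts ∎
      where
      open ≤-Reasoning
      open import Data.Bool.Base using (_∨_)
      𝟙-∨ : ∀ a b → 𝟙 (a ∨ b) ≤ 𝟙 a + 𝟙 b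
      𝟙-∨ true  b = s≤s z≤n
      𝟙-∨ false b = ≤-refl

  ∑-allFin-suc : ∀ {n} (f : Fin (suc n) → ℕ) → ∑ f (allFin (suc n)) ≡ f zero + ∑ (f ∘ suc) (allFin n)
  ∑-allFin-suc {n} f = cong (f zero +_)
    (trans (cong (∑ f) (sym (map-tabulate {n = n} id suc))) (∑-map f suc (allFin n)))

  ∏-allFin-suc : ∀ {n} (f : Fin (suc n) → ℕ) → ∏ f (allFin (suc n)) ≡ f zero * ∏ (f ∘ suc) (allFin n)
  ∏-allFin-suc {n} f = cong (f zero *_)
    (trans (cong (∏ f) (sym (map-tabulate {n = n} id suc))) (∏-map f suc (allFin n)))

  ∑-allVertices : ∀ {r n} (f : Vertex r n → ℕ) →
                  ∑ f (allVertices r n) ≡ ∑ (λ i → ∑ (λ a → f (i , a)) (allFin n)) (allFin r)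
  ∑-allVertices {r} {n} f =
    trans (∑-concatMap f (λ i → map (i ,_) (allFin n)) (allFin r))
          (∑-cong (λ i → ∑-map f (i ,_) (allFin n)) (allFin r))

  length-allFin : ∀ n → length (allFin n) ≡ n
  length-allFin n = length-tabulate {n = n} id

  -- The terms are dominated by C/2, C/4, C/8 and so on. Doubling the shifted sequence restores the
  -- hypothesis with the same C, which drives the induction.
  ∑-geometric : ∀ C n (f : ℕ → ℕ) → (∀ x → x < n → f x * 2 ^ suc x ≤ C) → ∑ (f ∘ toℕ) (allFin n) ≤ C
  ∑-geometric C zero    f bound = z≤n
  ∑-geometric C (suc n) f bound = *-cancelʳ-≤ _ C 2 (begin
    ∑ (f ∘ toℕ) (allFin (suc n)) * 2       ≡⟨ cong (_* 2) (∑-allFin-suc {n} (f ∘ toℕ)) ⟩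
    (f 0 + ∑ (f ∘ suc ∘ toℕ) (allFin n)) * 2   ≡⟨ *-distribʳ-+ 2 (f 0) _ ⟩
    f 0 * 2 + ∑ (f ∘ suc ∘ toℕ) (allFin n) * 2 ≡⟨ cong (f 0 * 2 +_) (*-distribʳ-∑ 2 (f ∘ suc ∘ toℕ) (allFin n)) ⟩
    f 0 * 2 + ∑ (λ x → f (suc (toℕ x)) * 2) (allFin n)
      ≤⟨ +-mono-≤ (bound 0 (s≤s z≤n)) (∑-geometric C n (λ x → f (suc x) * 2) shifted) ⟩
    C + C                                  ≡⟨ ((∀ a → a + a ≡ a * 2) ∋ solve-∀) C ⟩
    C * 2 ∎)
    where
    open ≤-Reasoning
    shifted : ∀ x → x < n → f (suc x) * 2 * 2 ^ suc x ≤ C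
    shifted x x<n = ≤-trans (≤-reflexive (*-assoc (f (suc x)) 2 _)) (bound (suc x) (s≤s x<n))

-- Binomial estimates and the arithmetic of the union bound.

module Estimates where
  open import Data.Nat.Base
  open import Data.Nat.Properties
  open import Data.Nat.Combinatorics using (_C_; nCk+nC[k+1]≡[n+1]C[k+1])
  open import Data.Nat.Tactic.RingSolver using (solve-∀)
  open import Data.Product.Base using (Σ; _,_)
  open import Function.Base using (_∋_; _$_)
  open import Relation.Binary.PropositionalEquality
  open ≤-Reasoning

  *-^-distrib : ∀ a b n → (a * b) ^ n ≡ a ^ n * b ^ n
  *-^-distrib a b zero    = refl
  *-^-distrib a b (suc n) = trans (cong (a * b *_) (*-^-distrib a b n)) $
    ((∀ x y u v → x * y * (u * v) ≡ x * u * (y * v)) ∋ solve-∀) a b (a ^ n) (b ^ n)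

  -- Since (1 + 1/a)^m ≥ 1 + m/a, the exponent m = aS suffices for a > 0. It serves to absorb an
  -- arbitrary constant S into a power of a ratio below 1.
  exponential-gap : ∀ a S → Σ ℕ λ m → a ^ m * S ≤ suc a ^ m
  exponential-gap zero    S = 1 , z≤n
  exponential-gap a@(suc _) S = a * S , *-cancelˡ-≤ a (begin
    a * (a ^ m * S)              ≡⟨ ((∀ x y z → x * (y * z) ≡ x * z * y) ∋ solve-∀) a (a ^ m) S ⟩
    m * a ^ m                    ≤⟨ *-monoˡ-≤ (a ^ m) (m≤n+m m a) ⟩
    (a + m) * a ^ m              ≤⟨ linear m ⟩
    a * suc a ^ m                ∎)
    where
    m = a * S
    linear : ∀ m → (a + m) * a ^ m ≤ a * suc a ^ m
    linear zero    = ≤-reflexive (cong (_* 1) (+-identityʳ a))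
    linear (suc m) = begin
      (a + suc m) * (a * a ^ m)    ≤⟨ m≤m+n _ (m * a ^ m) ⟩
      (a + suc m) * (a * a ^ m) + m * a ^ m
        ≡⟨ ((∀ a m p → (a + (1 + m)) * (a * p) + m * p ≡ (1 + a) * ((a + m) * p)) ∋ solve-∀) a m (a ^ m) ⟩
      suc a * ((a + m) * a ^ m)    ≤⟨ *-monoʳ-≤ (suc a) (linear m) ⟩
      suc a * (a * suc a ^ m)      ≡⟨ ((∀ s a p → s * (a * p) ≡ a * (s * p)) ∋ solve-∀) (suc a) a (suc a ^ m) ⟩
      a * (suc a * suc a ^ m)      ∎

  -- Bernoulli's inequality (w/(w+z))^j ≥ 1 − jz/(w+z), with both sides moved so that no subtraction occurs.
  bernoulli : ∀ w z j → (w + z) ^ j * (w + z) ≤ w ^ j * (w + z) + j * z * (w + z) ^ j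
  bernoulli w z zero    = m≤m+n _ _
  bernoulli w z (suc j) = begin
    (w + z) * (w + z) ^ j * (w + z)              ≡⟨ *-assoc (w + z) _ _ ⟩
    (w + z) * ((w + z) ^ j * (w + z))            ≤⟨ *-monoʳ-≤ (w + z) (bernoulli w z j) ⟩
    (w + z) * (w ^ j * (w + z) + j * z * (w + z) ^ j)
      ≡⟨ ((∀ w z j p q → (w + z) * (p * (w + z) + j * z * q) ≡
           w * p * (w + z) + (p * ((w + z) * z) + j * z * ((w + z) * q))) ∋ solve-∀) w z j (w ^ j) ((w + z) ^ j) ⟩
    w * w ^ j * (w + z) + (w ^ j * ((w + z) * z) + j * z * ((w + z) * (w + z) ^ j))
      ≤⟨ +-monoʳ-≤ (w * w ^ j * (w + z)) (+-monoˡ-≤ _ (*-monoˡ-≤ _ (^-monoˡ-≤ j (m≤m+n w z)))) ⟩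
    w * w ^ j * (w + z) + ((w + z) ^ j * ((w + z) * z) + j * z * ((w + z) * (w + z) ^ j))
      ≡⟨ ((∀ w z j p q → w * p * (w + z) + (q * ((w + z) * z) + j * z * ((w + z) * q)) ≡
           w * p * (w + z) + (1 + j) * z * ((w + z) * q)) ∋ solve-∀) w z j (w ^ j) ((w + z) ^ j) ⟩
    w * w ^ j * (w + z) + suc j * z * ((w + z) * (w + z) ^ j) ∎

  private
    -- Bernoulli with z = 1 gives (m/(m+1))^j ≥ 1 - j/(m+1), which is at least 1/2 in this range of
    -- j.
    [m+1]^j≤2m^j : ∀ m j → 2 * j ≤ m + 1 → (m + 1) ^ j ≤ 2 * m ^ j
    [m+1]^j≤2m^j m j 2j≤ = *-cancelʳ-≤ _ _ (m + 1) {{>-nonZero (m≤n+m 1 m)}} (+-cancelʳ-≤ (q * (m + 1)) _ _ (begin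
      q * (m + 1) + q * (m + 1)       ≡⟨ ((∀ x → x + x ≡ 2 * x) ∋ solve-∀) (q * (m + 1)) ⟩
      2 * (q * (m + 1))               ≤⟨ *-monoʳ-≤ 2 (bernoulli m 1 j) ⟩
      2 * (p * (m + 1) + j * 1 * q)   ≡⟨ ((∀ s p q j → 2 * (p * s + j * 1 * q) ≡ 2 * p * s + q * (2 * j)) ∋ solve-∀) (m + 1) p q j ⟩
      2 * p * (m + 1) + q * (2 * j)   ≤⟨ +-monoʳ-≤ (2 * p * (m + 1)) (*-monoʳ-≤ q 2j≤) ⟩
      2 * p * (m + 1) + q * (m + 1)   ∎))
      where p = m ^ j ; q = (m + 1) ^ j

    2⌊m/2⌋≤m : ∀ m → 2 * ⌊ m /2⌋ ≤ m
    2⌊m/2⌋≤m m = begin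
      2 * ⌊ m /2⌋            ≡⟨ cong (⌊ m /2⌋ +_) (+-identityʳ _) ⟩
      ⌊ m /2⌋ + ⌊ m /2⌋      ≤⟨ +-monoʳ-≤ ⌊ m /2⌋ (⌊n/2⌋≤⌈n/2⌉ m) ⟩
      ⌊ m /2⌋ + ⌈ m /2⌉      ≡⟨ ⌊n/2⌋+⌈n/2⌉≡n m ⟩
      m                      ∎

    -- Bernoulli only controls (1 + 1/m)^j for j up to about m/2, whence two factors of 2.
    [m+1]^m≤4m^m : ∀ m → (m + 1) ^ m ≤ 4 * m ^ m
    [m+1]^m≤4m^m m = begin
      (m + 1) ^ m                     ≡⟨ cong ((m + 1) ^_) (sym (⌊n/2⌋+⌈n/2⌉≡n m)) ⟩
      (m + 1) ^ (h + k)               ≡⟨ ^-distribˡ-+-* (m + 1) h k ⟩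
      (m + 1) ^ h * (m + 1) ^ k
        ≤⟨ *-mono-≤ ([m+1]^j≤2m^j m h (≤-trans (2⌊m/2⌋≤m m) (m≤m+n m 1)))
                    ([m+1]^j≤2m^j m k (≤-trans (2⌊m/2⌋≤m (suc m)) (≤-reflexive (+-comm 1 m)))) ⟩
      2 * m ^ h * (2 * m ^ k)         ≡⟨ ((∀ a b → 2 * a * (2 * b) ≡ 4 * (a * b)) ∋ solve-∀) (m ^ h) (m ^ k) ⟩
      4 * (m ^ h * m ^ k)             ≡⟨ cong (4 *_) (sym (^-distribˡ-+-* m h k)) ⟩
      4 * m ^ (h + k)                 ≡⟨ cong (λ t → 4 * m ^ t) (⌊n/2⌋+⌈n/2⌉≡n m) ⟩
      4 * m ^ m                       ∎
      where h = ⌊ m /2⌋ ; k = ⌈ m /2⌉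

  -- A weak Stirling bound with 4 in place of e: passing from x to x + 1 costs the factor (1 +
  -- 1/x)^x, which is at most 4.
  x^x≤4^x*x! : ∀ x → x ^ x ≤ 4 ^ x * x !
  x^x≤4^x*x! zero    = ≤-refl
  x^x≤4^x*x! (suc x) = begin
    suc x * suc x ^ x             ≡⟨ cong (λ t → suc x * t ^ x) (+-comm 1 x) ⟩
    suc x * (x + 1) ^ x           ≤⟨ *-monoʳ-≤ (suc x) ([m+1]^m≤4m^m x) ⟩
    suc x * (4 * x ^ x)           ≤⟨ *-monoʳ-≤ (suc x) (*-monoʳ-≤ 4 (x^x≤4^x*x! x)) ⟩
    suc x * (4 * (4 ^ x * x !))   ≡⟨ ((∀ s p f → s * (4 * (p * f)) ≡ 4 * p * (s * f)) ∋ solve-∀) (suc x) (4 ^ x) (x !) ⟩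
    4 * 4 ^ x * (suc x * x !)     ∎

  private
    -- The left side consists of the two leading terms of the binomial expansion of the right side.
    n^[k+1]+[k+1]n^k≤[n+1]^[k+1] : ∀ n k → n * n ^ k + suc k * n ^ k ≤ suc n * suc n ^ k
    n^[k+1]+[k+1]n^k≤[n+1]^[k+1] n zero    = ≤-reflexive (((∀ n → n * 1 + 1 ≡ (1 + n) * 1) ∋ solve-∀) n)
    n^[k+1]+[k+1]n^k≤[n+1]^[k+1] n (suc k) = begin
      n * (n * p) + suc (suc k) * (n * p)  ≤⟨ m≤m+n _ (suc k * p) ⟩
      n * (n * p) + suc (suc k) * (n * p) + suc k * p
        ≡⟨ ((∀ n k p → n * (n * p) + (2 + k) * (n * p) + (1 + k) * p ≡ (1 + n) * (n * p + (1 + k) * p)) ∋ solve-∀) n k p ⟩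
      suc n * (n * p + suc k * p)          ≤⟨ *-monoʳ-≤ (suc n) (n^[k+1]+[k+1]n^k≤[n+1]^[k+1] n k) ⟩
      suc n * (suc n * suc n ^ k)          ∎
      where p = n ^ k

  nCk*k!≤n^k : ∀ n k → (n C k) * k ! ≤ n ^ k
  nCk*k!≤n^k n       zero    = ≤-refl
  nCk*k!≤n^k zero    (suc k) = z≤n
  nCk*k!≤n^k (suc n) (suc k) = begin
    (suc n C suc k) * (suc k * k !)             ≡⟨ cong (_* (suc k * k !)) (sym (nCk+nC[k+1]≡[n+1]C[k+1] n k)) ⟩
    ((n C k) + (n C suc k)) * (suc k * k !)
      ≡⟨ ((∀ a b s f → (a + b) * (s * f) ≡ s * (a * f) + b * (s * f)) ∋ solve-∀) (n C k) (n C suc k) (suc k) (k !) ⟩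
    suc k * ((n C k) * k !) + (n C suc k) * (suc k) !
      ≤⟨ +-mono-≤ (*-monoʳ-≤ (suc k) (nCk*k!≤n^k n k)) (nCk*k!≤n^k n (suc k)) ⟩
    suc k * n ^ k + n * n ^ k                 ≡⟨ +-comm (suc k * n ^ k) _ ⟩
    n * n ^ k + suc k * n ^ k                 ≤⟨ n^[k+1]+[k+1]n^k≤[n+1]^[k+1] n k ⟩
    suc n * suc n ^ k                         ∎

  -- The familiar estimate (en/k)^k for a binomial coefficient, with 4 for e and without division.
  nCk*k^k≤4^k*n^k : ∀ n k → (n C k) * k ^ k ≤ 4 ^ k * n ^ k
  nCk*k^k≤4^k*n^k n k = begin
    (n C k) * k ^ k            ≤⟨ *-monoʳ-≤ (n C k) (x^x≤4^x*x! k) ⟩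
    (n C k) * (4 ^ k * k !)    ≡⟨ ((∀ a b c → a * (b * c) ≡ b * (a * c)) ∋ solve-∀) (n C k) (4 ^ k) (k !) ⟩
    4 ^ k * ((n C k) * k !)    ≤⟨ *-monoʳ-≤ (4 ^ k) (nCk*k!≤n^k n k) ⟩
    4 ^ k * n ^ k            ∎

  private
    -- The identity (k+1) C(n,k+1) = (n-k) C(n,k) with the subtracted term moved to the left, where
    -- Pascal's rule can be applied by induction.
    absorption : ∀ n k → suc k * (n C suc k) + k * (n C k) ≡ n * (n C k)
    absorption zero    zero    = refl
    absorption zero    (suc k) = cong₂ _+_ (*-zeroʳ k) (*-zeroʳ k)
    absorption (suc n) zero    = begin-equality
      1 * (suc n C 1) + 0          ≡⟨ ((∀ a → 1 * a + 0 ≡ a) ∋ solve-∀) (suc n C 1) ⟩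
      suc n C 1                    ≡⟨ sym (nCk+nC[k+1]≡[n+1]C[k+1] n 0) ⟩
      1 + (n C 1)                  ≡⟨ ((∀ a → 1 + a ≡ 1 + (1 * a + 0)) ∋ solve-∀) (n C 1) ⟩
      1 + (1 * (n C 1) + 0)        ≡⟨ cong (1 +_) (absorption n 0) ⟩
      1 + n * 1                  ∎
    absorption (suc n) (suc k) = begin-equality
      (2 + k) * (suc n C (2 + k)) + (1 + k) * (suc n C (1 + k))
        ≡⟨ cong₂ (λ a b → (2 + k) * a + (1 + k) * b) (sym (nCk+nC[k+1]≡[n+1]C[k+1] n (suc k))) (sym (nCk+nC[k+1]≡[n+1]C[k+1] n k)) ⟩
      (2 + k) * (b + c) + (1 + k) * (a + b)
        ≡⟨ ((∀ k a b c → (2 + k) * (b + c) + (1 + k) * (a + b) ≡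
             ((2 + k) * c + (1 + k) * b) + ((1 + k) * b + k * a) + (a + b)) ∋ solve-∀) k a b c ⟩
      ((2 + k) * c + (1 + k) * b) + ((1 + k) * b + k * a) + (a + b)
        ≡⟨ cong₂ (λ s t → s + t + (a + b)) (absorption n (suc k)) (absorption n k) ⟩
      n * b + n * a + (a + b)
        ≡⟨ ((∀ n a b → n * b + n * a + (a + b) ≡ (1 + n) * (a + b)) ∋ solve-∀) n a b ⟩
      suc n * (a + b)
        ≡⟨ cong (suc n *_) (nCk+nC[k+1]≡[n+1]C[k+1] n k) ⟩
      suc n * (suc n C suc k) ∎
      where a = n C k ; b = n C suc k ; c = n C (2 + k)

    [k+1]nC[k+1]≡[n∸k]nCk : ∀ n k → suc k * (n C suc k) ≡ (n ∸ k) * (n C k)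
    [k+1]nC[k+1]≡[n∸k]nCk n k = begin-equality
      suc k * (n C suc k)                            ≡⟨ sym (m+n∸n≡m _ (k * (n C k))) ⟩
      suc k * (n C suc k) + k * (n C k) ∸ k * (n C k)    ≡⟨ cong (_∸ k * (n C k)) (absorption n k) ⟩
      n * (n C k) ∸ k * (n C k)                        ≡⟨ sym (*-distribʳ-∸ (n C k) n k) ⟩
      (n ∸ k) * (n C k)                              ∎

  -- Drawing k elements without replacement hits a given m-subset at most as often as drawing with replacement.
  mCk*N^k≤m^k*NCk : ∀ {m N} → m ≤ N → ∀ k → (m C k) * N ^ k ≤ m ^ k * (N C k)
  mCk*N^k≤m^k*NCk         m≤N zero    = ≤-refl
  mCk*N^k≤m^k*NCk {m} {N} m≤N (suc k) = *-cancelˡ-≤ (suc k) (begin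
    suc k * ((m C suc k) * (N * N ^ k))     ≡⟨ sym (*-assoc (suc k) (m C suc k) _) ⟩
    suc k * (m C suc k) * (N * N ^ k)       ≡⟨ cong (_* (N * N ^ k)) ([k+1]nC[k+1]≡[n∸k]nCk m k) ⟩
    (m ∸ k) * (m C k) * (N * N ^ k)         ≡⟨ ((∀ a b c d → a * b * (c * d) ≡ a * c * (b * d)) ∋ solve-∀) (m ∸ k) (m C k) N (N ^ k) ⟩
    (m ∸ k) * N * ((m C k) * N ^ k)         ≤⟨ *-mono-≤ ratio (mCk*N^k≤m^k*NCk m≤N k) ⟩
    m * (N ∸ k) * (m ^ k * (N C k))         ≡⟨ ((∀ a b c d → a * b * (c * d) ≡ (b * d) * (a * c)) ∋ solve-∀) m (N ∸ k) (m ^ k) (N C k) ⟩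
    (N ∸ k) * (N C k) * (m * m ^ k)         ≡⟨ cong (_* (m * m ^ k)) (sym ([k+1]nC[k+1]≡[n∸k]nCk N k)) ⟩
    suc k * (N C suc k) * (m * m ^ k)       ≡⟨ ((∀ a b c → a * b * c ≡ a * (c * b)) ∋ solve-∀) (suc k) (N C suc k) (m * m ^ k) ⟩
    suc k * (m * m ^ k * (N C suc k))       ∎)
    where
    -- After k successful draws the chance (m-k)/(N-k) of another success is at most m/N.
    ratio : (m ∸ k) * N ≤ m * (N ∸ k)
    ratio = begin
      (m ∸ k) * N       ≡⟨ *-distribʳ-∸ N m k ⟩
      m * N ∸ k * N     ≤⟨ ∸-monoʳ-≤ (m * N) (*-monoʳ-≤ k m≤N) ⟩
      m * N ∸ k * m     ≡⟨ cong (m * N ∸_) (*-comm k m) ⟩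
      m * N ∸ m * k     ≡⟨ sym (*-distribˡ-∸ m N k) ⟩
      m * (N ∸ k)       ∎

  -- The probability that an edge meets r random z-subsets is at most 1 − (1 − z/n)^r ≤ r z/n, and it is
  -- bounded away from 1 when z ≤ (c/(c+1)) n; hence a fixed power of it is below z/n.
  miss-probability : ∀ c r → Σ ℕ λ M → ∀ n z → z ≤ n → suc c * z ≤ c * n →
                     (n ^ r ∸ (n ∸ z) ^ r) ^ suc M * n ≤ z * (n ^ r) ^ suc M
  miss-probability c r with suc c ^ r in eq
  ... | zero  with () ← m^n≡0⇒m≡0 (suc c) r eq
  -- With D + 1 = (c+1)^r the probability is at most D/(D+1). M is chosen so that r times the M-th
  -- power of this is at most 1; the one remaining factor of the exponent M + 1 is bounded by r z/n.
  ... | suc D with exponential-gap D r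
  ...   | M , gap = M , λ n z z≤n′ [c+1]z≤cn → *-cancelˡ-≤ (suc D ^ M) {{m^n≢0 (suc D) M}} (bound n z z≤n′ [c+1]z≤cn)
    where
    bound : ∀ n z → z ≤ n → suc c * z ≤ c * n →
            suc D ^ M * ((n ^ r ∸ (n ∸ z) ^ r) ^ suc M * n) ≤ suc D ^ M * (z * (n ^ r) ^ suc M)
    bound n z z≤n′ [c+1]z≤cn = begin
      suc D ^ M * (U * U ^ M * n)       ≡⟨ ((∀ d u v n → d * (u * v * n) ≡ u * n * (d * v)) ∋ solve-∀) (suc D ^ M) U (U ^ M) n ⟩
      U * n * (suc D ^ M * U ^ M)       ≡⟨ cong (U * n *_) (sym (*-^-distrib (suc D) U M)) ⟩
      U * n * (suc D * U) ^ M           ≤⟨ *-mono-≤ linear (^-monoˡ-≤ M bounded-away) ⟩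
      r * z * n ^ r * (D * n ^ r) ^ M   ≡⟨ cong (r * z * n ^ r *_) (*-^-distrib D (n ^ r) M) ⟩
      r * z * n ^ r * (D ^ M * (n ^ r) ^ M)
        ≡⟨ ((∀ r z p d q → r * z * p * (d * q) ≡ d * r * (z * (p * q))) ∋ solve-∀) r z (n ^ r) (D ^ M) ((n ^ r) ^ M) ⟩
      D ^ M * r * (z * (n ^ r * (n ^ r) ^ M))   ≤⟨ *-monoˡ-≤ _ gap ⟩
      suc D ^ M * (z * (n ^ r * (n ^ r) ^ M))   ∎
      where
      w = n ∸ z
      U = n ^ r ∸ w ^ r
      w+z≡n : w + z ≡ n
      w+z≡n = m∸n+n≡m z≤n′
      linear : U * n ≤ r * z * n ^ r
      linear = begin
        U * n                                ≡⟨ *-distribʳ-∸ n (n ^ r) (w ^ r) ⟩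
        n ^ r * n ∸ w ^ r * n
          ≤⟨ ∸-monoˡ-≤ (w ^ r * n) (subst (λ t → t ^ r * t ≤ w ^ r * t + r * z * t ^ r) w+z≡n (bernoulli w z r)) ⟩
        w ^ r * n + r * z * n ^ r ∸ w ^ r * n   ≡⟨ m+n∸m≡n (w ^ r * n) _ ⟩
        r * z * n ^ r                        ∎
      n≤[c+1]w : n ≤ suc c * w
      n≤[c+1]w = begin
        n                          ≡⟨ sym (m+n∸n≡m n (c * n)) ⟩
        suc c * n ∸ c * n          ≤⟨ ∸-monoʳ-≤ (suc c * n) [c+1]z≤cn ⟩
        suc c * n ∸ suc c * z      ≡⟨ sym (*-distribˡ-∸ (suc c) n z) ⟩
        suc c * w                  ∎
      n^r≤[D+1]w^r : n ^ r ≤ suc D * w ^ r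
      n^r≤[D+1]w^r = begin
        n ^ r                ≤⟨ ^-monoˡ-≤ r n≤[c+1]w ⟩
        (suc c * w) ^ r      ≡⟨ *-^-distrib (suc c) w r ⟩
        suc c ^ r * w ^ r    ≡⟨ cong (_* w ^ r) eq ⟩
        suc D * w ^ r        ∎
      bounded-away : suc D * U ≤ D * n ^ r
      bounded-away = begin
        suc D * U                          ≡⟨ *-distribˡ-∸ (suc D) (n ^ r) (w ^ r) ⟩
        suc D * n ^ r ∸ suc D * w ^ r      ≤⟨ ∸-monoʳ-≤ (suc D * n ^ r) n^r≤[D+1]w^r ⟩
        suc D * n ^ r ∸ n ^ r              ≡⟨ m+n∸m≡n (n ^ r) _ ⟩
        D * n ^ r                          ∎

  private
    x≤2^x : ∀ x → x ≤ 2 ^ x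
    x≤2^x zero    = z≤n
    x≤2^x (suc x) = begin
      1 + x                ≤⟨ +-mono-≤ (m^n>0 2 x) (x≤2^x x) ⟩
      2 ^ x + 2 ^ x        ≡⟨ cong (2 ^ x +_) (sym (+-identityʳ _)) ⟩
      2 * 2 ^ x            ∎

    nCx*z^x : ∀ c n x z → z ≤ c * x → (n C x) * z ^ x ≤ (4 ^ x * c ^ x) * n ^ x
    nCx*z^x c n x z z≤cx = begin
      (n C x) * z ^ x              ≤⟨ *-monoʳ-≤ (n C x) (^-monoˡ-≤ x z≤cx) ⟩
      (n C x) * (c * x) ^ x        ≡⟨ cong ((n C x) *_) (*-^-distrib c x x) ⟩
      (n C x) * (c ^ x * x ^ x)    ≡⟨ ((∀ a b d → a * (b * d) ≡ b * (a * d)) ∋ solve-∀) (n C x) (c ^ x) (x ^ x) ⟩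
      c ^ x * ((n C x) * x ^ x)    ≤⟨ *-monoʳ-≤ (c ^ x) (nCk*k^k≤4^k*n^k n x) ⟩
      c ^ x * (4 ^ x * n ^ x)      ≡⟨ ((∀ a b d → a * (b * d) ≡ b * a * d) ∋ solve-∀) (c ^ x) (4 ^ x) (n ^ x) ⟩
      4 ^ x * c ^ x * n ^ x        ∎

    -- Only z of the y factors are needed to pay for the choice of a z-set; the other y - z are
    -- bounded by n.
    nCz*z^y : ∀ n y z → z ≤ y → z ≤ n → (n C z) * z ^ y ≤ 4 ^ y * n ^ y
    nCz*z^y n y z z≤y z≤n′ = begin
      (n C z) * z ^ y                    ≡⟨ cong (λ t → (n C z) * z ^ t) (sym (m+[n∸m]≡n z≤y)) ⟩
      (n C z) * z ^ (z + e)              ≡⟨ cong ((n C z) *_) (^-distribˡ-+-* z z e) ⟩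
      (n C z) * (z ^ z * z ^ e)          ≡⟨ sym (*-assoc (n C z) _ _) ⟩
      (n C z) * z ^ z * z ^ e            ≤⟨ *-mono-≤ (nCk*k^k≤4^k*n^k n z) (^-monoˡ-≤ e z≤n′) ⟩
      4 ^ z * n ^ z * n ^ e              ≡⟨ *-assoc (4 ^ z) _ _ ⟩
      4 ^ z * (n ^ z * n ^ e)            ≡⟨ cong (4 ^ z *_) (sym (^-distribˡ-+-* n z e)) ⟩
      4 ^ z * n ^ (z + e)                ≡⟨ cong (λ t → 4 ^ z * n ^ t) (m+[n∸m]≡n z≤y) ⟩
      4 ^ z * n ^ y                      ≤⟨ *-monoˡ-≤ (n ^ y) (^-monoʳ-≤ 4 z≤y) ⟩
      4 ^ y * n ^ y                      ∎
      where e = y ∸ z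

    -- One factor z is bounded by cx instead of n, which makes room for the extra n; then x is
    -- absorbed by 2^x.
    z^x*n : ∀ c n x z → 1 ≤ x → z ≤ c * x → z ≤ n → z ^ x * n ≤ c * 2 ^ x * n ^ x
    z^x*n c n (suc x) z _ z≤cx z≤n′ = begin
      z * z ^ x * n                      ≤⟨ *-monoˡ-≤ n (*-mono-≤ z≤cx (^-monoˡ-≤ x z≤n′)) ⟩
      c * suc x * n ^ x * n              ≤⟨ *-monoˡ-≤ n (*-monoˡ-≤ (n ^ x) (*-monoʳ-≤ c (x≤2^x (suc x)))) ⟩
      c * 2 ^ suc x * n ^ x * n          ≡⟨ ((∀ a b d → a * b * d ≡ a * (d * b)) ∋ solve-∀) (c * 2 ^ suc x) (n ^ x) n ⟩
      c * 2 ^ suc x * (n * n ^ x)        ∎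

  -- The union bound over an x-set and r many z-sets: each such family fails with probability at most (z/n)^(Kx).
  union-bound : ∀ c r → Σ ℕ λ K → ∀ n x z → 1 ≤ x → z ≤ c * x → z ≤ n → suc c * z ≤ c * n →
                (n C x) * (n C z) ^ r * z ^ (suc K * x) * n * 2 ^ x ≤ c * n ^ (suc K * x)
  union-bound c r = K , bound
    where
    A = 4 * c * 4 ^ (c * r)
    gap = exponential-gap c (A * 4)
    m = Σ.proj₁ gap
    -- The exponent (K+1)x splits into x for the choice of X, crx for the r choices of z-sets, x for
    -- the factor n, and mx for the constants: as z/n ≤ c/(c+1), the m-th power of z/n absorbs 4A.
    -- The 4 collects the required 2^x and the one that comes from `z^x*n`.
    K = c * r + (1 + m)
    bound : ∀ n x z → 1 ≤ x → z ≤ c * x → z ≤ n → suc c * z ≤ c * n →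
            (n C x) * (n C z) ^ r * z ^ (suc K * x) * n * 2 ^ x ≤ c * n ^ (suc K * x)
    bound n x z 1≤x z≤cx z≤n′ [c+1]z≤cn = begin
      (n C x) * (n C z) ^ r * z ^ (suc K * x) * n * 2 ^ x
        ≡⟨ cong (λ t → (n C x) * (n C z) ^ r * t * n * 2 ^ x) (split z) ⟩
      (n C x) * (n C z) ^ r * (z ^ x * ((z ^ (c * x)) ^ r * (z ^ x * (z ^ m) ^ x))) * n * 2 ^ x
        ≡⟨ ((∀ a b p q s n t → a * b * (p * (q * (p * s))) * n * t ≡ (a * p) * (b * q) * (p * n) * (s * t)) ∋ solve-∀)
             (n C x) ((n C z) ^ r) (z ^ x) ((z ^ (c * x)) ^ r) ((z ^ m) ^ x) n (2 ^ x) ⟩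
      ((n C x) * z ^ x) * ((n C z) ^ r * (z ^ (c * x)) ^ r) * (z ^ x * n) * ((z ^ m) ^ x * 2 ^ x)
        ≤⟨ *-monoˡ-≤ _ (*-mono-≤ (*-mono-≤ (nCx*z^x c n x z z≤cx) Z-sets) (z^x*n c n x z 1≤x z≤cx z≤n′)) ⟩
      (4 ^ x * c ^ x * n ^ x) * ((4 ^ (c * r)) ^ x * (n ^ (c * x)) ^ r) * (c * 2 ^ x * n ^ x) * ((z ^ m) ^ x * 2 ^ x)
        ≡⟨ ((∀ f c n g p d t s → (f * c * n) * (g * p) * (d * t * n) * (s * t) ≡ d * (n * (p * (n * (s * ((f * c * g) * (t * t)))))))
             ∋ solve-∀) (4 ^ x) (c ^ x) (n ^ x) ((4 ^ (c * r)) ^ x) ((n ^ (c * x)) ^ r) c (2 ^ x) ((z ^ m) ^ x) ⟩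
      c * (n ^ x * ((n ^ (c * x)) ^ r * (n ^ x * ((z ^ m) ^ x * ((4 ^ x * c ^ x * (4 ^ (c * r)) ^ x) * (2 ^ x * 2 ^ x))))))
        ≡⟨ cong (λ t → c * (n ^ x * ((n ^ (c * x)) ^ r * (n ^ x * t)))) collect ⟩
      c * (n ^ x * ((n ^ (c * x)) ^ r * (n ^ x * (z ^ m * (A * 4)) ^ x)))
        ≤⟨ *-monoʳ-≤ c (*-monoʳ-≤ (n ^ x) (*-monoʳ-≤ ((n ^ (c * x)) ^ r) (*-monoʳ-≤ (n ^ x) (^-monoˡ-≤ x absorbed)))) ⟩
      c * (n ^ x * ((n ^ (c * x)) ^ r * (n ^ x * (n ^ m) ^ x)))
        ≡⟨ cong (c *_) (sym (split n)) ⟩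
      c * n ^ (suc K * x) ∎
      where
      split : ∀ b → b ^ (suc K * x) ≡ b ^ x * ((b ^ (c * x)) ^ r * (b ^ x * (b ^ m) ^ x))
      split b = begin-equality
        b ^ (x + (c * r + (1 + m)) * x)
          ≡⟨ cong (b ^_) (((∀ x c r m → x + (c * r + (1 + m)) * x ≡ x + (c * x * r + (x + m * x))) ∋ solve-∀) x c r m) ⟩
        b ^ (x + (c * x * r + (x + m * x)))
          ≡⟨ ^-distribˡ-+-* b x _ ⟩
        b ^ x * b ^ (c * x * r + (x + m * x))
          ≡⟨ cong (b ^ x *_) (^-distribˡ-+-* b (c * x * r) _) ⟩
        b ^ x * (b ^ (c * x * r) * b ^ (x + m * x))
          ≡⟨ cong (λ t → b ^ x * (b ^ (c * x * r) * t)) (^-distribˡ-+-* b x _) ⟩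
        b ^ x * (b ^ (c * x * r) * (b ^ x * b ^ (m * x)))
          ≡⟨ cong₂ (λ s t → b ^ x * (s * (b ^ x * t))) (sym (^-*-assoc b (c * x) r)) (sym (^-*-assoc b m x)) ⟩
        b ^ x * ((b ^ (c * x)) ^ r * (b ^ x * (b ^ m) ^ x)) ∎
      Z-sets : (n C z) ^ r * (z ^ (c * x)) ^ r ≤ (4 ^ (c * r)) ^ x * (n ^ (c * x)) ^ r
      Z-sets = begin
        (n C z) ^ r * (z ^ (c * x)) ^ r          ≡⟨ sym (*-^-distrib (n C z) _ r) ⟩
        ((n C z) * z ^ (c * x)) ^ r              ≤⟨ ^-monoˡ-≤ r (nCz*z^y n (c * x) z z≤cx z≤n′) ⟩
        (4 ^ (c * x) * n ^ (c * x)) ^ r          ≡⟨ *-^-distrib (4 ^ (c * x)) _ r ⟩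
        (4 ^ (c * x)) ^ r * (n ^ (c * x)) ^ r    ≡⟨ cong (_* (n ^ (c * x)) ^ r) swap ⟩
        (4 ^ (c * r)) ^ x * (n ^ (c * x)) ^ r    ∎
        where
        swap : (4 ^ (c * x)) ^ r ≡ (4 ^ (c * r)) ^ x
        swap = begin-equality
          (4 ^ (c * x)) ^ r     ≡⟨ ^-*-assoc 4 (c * x) r ⟩
          4 ^ (c * x * r)       ≡⟨ cong (4 ^_) (((∀ a b d → a * b * d ≡ a * d * b) ∋ solve-∀) c x r) ⟩
          4 ^ (c * r * x)       ≡⟨ sym (^-*-assoc 4 (c * r) x) ⟩
          (4 ^ (c * r)) ^ x     ∎
      collect : (z ^ m) ^ x * ((4 ^ x * c ^ x * (4 ^ (c * r)) ^ x) * (2 ^ x * 2 ^ x)) ≡ (z ^ m * (A * 4)) ^ x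
      collect = begin-equality
        (z ^ m) ^ x * ((4 ^ x * c ^ x * (4 ^ (c * r)) ^ x) * (2 ^ x * 2 ^ x))
          ≡⟨ cong₂ (λ s t → (z ^ m) ^ x * (s * (4 ^ (c * r)) ^ x * t)) (sym (*-^-distrib 4 c x)) (sym (*-^-distrib 2 2 x)) ⟩
        (z ^ m) ^ x * ((4 * c) ^ x * (4 ^ (c * r)) ^ x * 4 ^ x)
          ≡⟨ cong (λ t → (z ^ m) ^ x * (t * 4 ^ x)) (sym (*-^-distrib (4 * c) _ x)) ⟩
        (z ^ m) ^ x * (A ^ x * 4 ^ x)
          ≡⟨ cong ((z ^ m) ^ x *_) (sym (*-^-distrib A 4 x)) ⟩
        (z ^ m) ^ x * (A * 4) ^ x
          ≡⟨ sym (*-^-distrib (z ^ m) (A * 4) x) ⟩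
        (z ^ m * (A * 4)) ^ x ∎
      absorbed : z ^ m * (A * 4) ≤ n ^ m
      absorbed = *-cancelˡ-≤ (suc c ^ m) {{m^n≢0 (suc c) m}} (begin
        suc c ^ m * (z ^ m * (A * 4))    ≡⟨ sym (*-assoc (suc c ^ m) _ _) ⟩
        suc c ^ m * z ^ m * (A * 4)      ≡⟨ cong (_* (A * 4)) (sym (*-^-distrib (suc c) z m)) ⟩
        (suc c * z) ^ m * (A * 4)        ≤⟨ *-monoˡ-≤ (A * 4) (^-monoˡ-≤ m [c+1]z≤cn) ⟩
        (c * n) ^ m * (A * 4)            ≡⟨ cong (_* (A * 4)) (*-^-distrib c n m) ⟩
        c ^ m * n ^ m * (A * 4)          ≡⟨ ((∀ a b d → a * b * d ≡ a * d * b) ∋ solve-∀) (c ^ m) (n ^ m) (A * 4) ⟩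
        c ^ m * (A * 4) * n ^ m          ≤⟨ *-monoˡ-≤ (n ^ m) (Σ.proj₂ gap) ⟩
        suc c ^ m * n ^ m                ∎)

-- Finite sums of rationals.

module RationalSums where
  open import Data.Fin.Base using (Fin; zero; suc)
  open import Data.List.Base using (List; []; _∷_; _++_; map; concatMap; filter; allFin)
  open import Data.List.Properties using (map-tabulate)
  open import Data.List.Membership.Propositional using (_∈_)
  open import Data.List.Relation.Unary.Any using (here; there)
  open import Data.Nat.Base using (suc)
  open import Data.Product.Base using (_,_)
  open import Data.Rational.Base
  open import Data.Rational.Properties
  open import Function.Base using (_∘_; id)
  open import Relation.Nullary using (does)
  open import Relation.Unary using (Decidable)
  open import Relation.Binary.PropositionalEquality
  open import Data.Bool.Base using (true; false; if_then_else_)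
  open import Relation.Nullary.Decidable using (dec⇒maybe)
  open import Tactic.RingSolver using (solve-∀)
  open import Tactic.RingSolver.Core.AlmostCommutativeRing using (AlmostCommutativeRing; fromCommutativeRing)

  ring : AlmostCommutativeRing _ _
  ring = fromCommutativeRing +-*-commutativeRing λ x → dec⇒maybe (0ℚ ≟ x)

  private
    interchange : ∀ a b c d → (a + b) + (c + d) ≡ (a + c) + (b + d)
    interchange = solve-∀ ring

  module _ {A : Set} where
    Σℚ-cong-∈ : {f g : A → ℚ} → ∀ xs → (∀ x → x ∈ xs → f x ≡ g x) → Σℚ f xs ≡ Σℚ g xs
    Σℚ-cong-∈ []       f≗g = refl
    Σℚ-cong-∈ (x ∷ xs) f≗g = cong₂ _+_ (f≗g x (here refl)) (Σℚ-cong-∈ xs λ y y∈ → f≗g y (there y∈))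

    Σℚ-cong : {f g : A → ℚ} → (∀ x → f x ≡ g x) → ∀ xs → Σℚ f xs ≡ Σℚ g xs
    Σℚ-cong f≗g xs = Σℚ-cong-∈ xs λ x _ → f≗g x

    Σℚ-distrib-+ : (f g : A → ℚ) → ∀ xs → Σℚ (λ x → f x + g x) xs ≡ Σℚ f xs + Σℚ g xs
    Σℚ-distrib-+ f g []       = refl
    Σℚ-distrib-+ f g (x ∷ xs) = trans (cong (f x + g x +_) (Σℚ-distrib-+ f g xs)) (interchange (f x) (g x) _ _)

    *-distribˡ-Σℚ : ∀ c (f : A → ℚ) xs → c * Σℚ f xs ≡ Σℚ (λ x → c * f x) xs
    *-distribˡ-Σℚ c f []       = *-zeroʳ c
    *-distribˡ-Σℚ c f (x ∷ xs) = trans (*-distribˡ-+ c (f x) _) (cong (c * f x +_) (*-distribˡ-Σℚ c f xs))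

    Σℚ-0 : (xs : List A) → Σℚ (λ _ → 0ℚ) xs ≡ 0ℚ
    Σℚ-0 []       = refl
    Σℚ-0 (x ∷ xs) = trans (+-identityˡ _) (Σℚ-0 xs)

    Σℚ-nonneg : {f : A → ℚ} → ∀ xs → (∀ x → x ∈ xs → 0ℚ ≤ f x) → 0ℚ ≤ Σℚ f xs
    Σℚ-nonneg []       0≤f = ≤-refl
    Σℚ-nonneg (x ∷ xs) 0≤f = +-mono-≤ (0≤f x (here refl)) (Σℚ-nonneg xs λ y y∈ → 0≤f y (there y∈))

    Σℚ-≥-∈ : {f : A → ℚ} → (∀ x → 0ℚ ≤ f x) → ∀ {x xs} → x ∈ xs → f x ≤ Σℚ f xs
    Σℚ-≥-∈ {f} 0≤f {x} {y ∷ xs} (here refl) =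
      subst (_≤ f y + Σℚ f xs) (+-identityʳ (f y)) (+-monoʳ-≤ (f y) (Σℚ-nonneg xs λ z _ → 0≤f z))
    Σℚ-≥-∈ {f} 0≤f {x} {y ∷ xs} (there x∈) =
      subst (_≤ f y + Σℚ f xs) (+-identityˡ (f x)) (+-mono-≤ (0≤f y) (Σℚ-≥-∈ 0≤f x∈))

    Σℚ-++ : (f : A → ℚ) → ∀ xs ys → Σℚ f (xs ++ ys) ≡ Σℚ f xs + Σℚ f ys
    Σℚ-++ f []       ys = sym (+-identityˡ _)
    Σℚ-++ f (x ∷ xs) ys = trans (cong (f x +_) (Σℚ-++ f xs ys)) (sym (+-assoc (f x) _ _))

    Σℚ-map : {B : Set} (f : A → ℚ) (h : B → A) → ∀ xs → Σℚ f (map h xs) ≡ Σℚ (f ∘ h) xs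
    Σℚ-map f h []       = refl
    Σℚ-map f h (x ∷ xs) = cong (f (h x) +_) (Σℚ-map f h xs)

    Σℚ-concatMap : {B : Set} (f : A → ℚ) (h : B → List A) → ∀ xs → Σℚ f (concatMap h xs) ≡ Σℚ (λ x → Σℚ f (h x)) xs
    Σℚ-concatMap f h []       = refl
    Σℚ-concatMap f h (x ∷ xs) = trans (Σℚ-++ f (h x) _) (cong (Σℚ f (h x) +_) (Σℚ-concatMap f h xs))

    -- Converts the sum over the star of a vertex into a coordinate of a combination of incidence
    -- vectors.
    Σℚ-filter : (f : A → ℚ) {P : A → Set} (P? : Decidable P) → ∀ xs →
                Σℚ f (filter P? xs) ≡ Σℚ (λ x → f x * (if does (P? x) then 1ℚ else 0ℚ)) xs
    Σℚ-filter f P? []       = refl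
    Σℚ-filter f P? (x ∷ xs) with does (P? x)
    ... | true  = cong₂ _+_ (sym (*-identityʳ (f x))) (Σℚ-filter f P? xs)
    ... | false = trans (Σℚ-filter f P? xs) (trans (sym (+-identityˡ _)) (cong (_+ _) (sym (*-zeroʳ (f x)))))

  Σℚ-allFin-suc : ∀ {n} (f : Fin (suc n) → ℚ) → Σℚ f (allFin (suc n)) ≡ f zero + Σℚ (f ∘ suc) (allFin n)
  Σℚ-allFin-suc {n} f = cong (f zero +_)
    (trans (cong (Σℚ f) (sym (map-tabulate {n = n} id suc))) (Σℚ-map f suc (allFin n)))

  Σℚ-allVertices : ∀ {r n} (f : Vertex r n → ℚ) →
                   Σℚ f (allVertices r n) ≡ Σℚ (λ i → Σℚ (λ a → f (i , a)) (allFin n)) (allFin r)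
  Σℚ-allVertices {r} {n} f =
    trans (Σℚ-concatMap f (λ i → map (i ,_) (allFin n)) (allFin r))
          (Σℚ-cong (λ i → Σℚ-map f (i ,_) (allFin n)) (allFin r))

-- Farkas' lemma over the rationals.

module Farkas where
  open RationalSums
  open import Data.Empty using (⊥-elim)
  open import Data.List.Base using (List; []; _∷_)
  open import Data.List.Membership.Propositional using (_∈_)
  open import Data.List.Relation.Unary.All as All using (All)
  open import Data.List.Relation.Unary.AllPairs using ([]; _∷_)
  open import Data.List.Relation.Unary.Any using (here; there)
  open import Data.List.Relation.Unary.Unique.Propositional using (Unique)
  open import Data.Product.Base using (Σ; _×_; _,_)
  open import Data.Rational.Base
  open import Data.Rational.Properties
  open import Data.Sum.Base using (_⊎_; inj₁; inj₂)
  open import Function.Base using (_∘_; _∋_)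
  open import Relation.Binary.Definitions using (DecidableEquality; tri<; tri≈; tri>)
  open import Relation.Binary.PropositionalEquality
  open import Relation.Nullary using (yes; no)
  open import Tactic.RingSolver using (solve-∀)

  dot : {V : Set} → List V → (V → ℚ) → (V → ℚ) → ℚ
  dot vs y x = Σℚ (λ v → y v * x v) vs

  module _ {V : Set} (vs : List V) where
    dot-linearˡ : ∀ y k z x → dot vs (λ v → y v + k * z v) x ≡ dot vs y x + k * dot vs z x
    dot-linearˡ y k z x = begin
      Σℚ (λ v → (y v + k * z v) * x v) vs
        ≡⟨ Σℚ-cong (λ v → ((∀ a k b c → (a + k * b) * c ≡ a * c + k * (b * c)) ∋ solve-∀ ring) (y v) k (z v) (x v)) vs ⟩
      Σℚ (λ v → y v * x v + k * (z v * x v)) vs         ≡⟨ Σℚ-distrib-+ (λ v → y v * x v) (λ v → k * (z v * x v)) vs ⟩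
      dot vs y x + Σℚ (λ v → k * (z v * x v)) vs        ≡⟨ cong (dot vs y x +_) (sym (*-distribˡ-Σℚ k _ vs)) ⟩
      dot vs y x + k * dot vs z x                       ∎
      where open ≡-Reasoning

    dot-comm : ∀ y x → dot vs y x ≡ dot vs x y
    dot-comm y x = Σℚ-cong (λ v → *-comm (y v) (x v)) vs

    dot-linearʳ : ∀ y x k z → dot vs y (λ v → x v + k * z v) ≡ dot vs y x + k * dot vs y z
    dot-linearʳ y x k z = trans (dot-comm y _) (trans (dot-linearˡ x k z y)
      (cong₂ (λ s t → s + k * t) (dot-comm x y) (dot-comm z y)))

    dot-scaleˡ : ∀ k z x → dot vs (λ v → k * z v) x ≡ k * dot vs z x
    dot-scaleˡ k z x = trans (Σℚ-cong (λ v → *-assoc k (z v) (x v)) vs) (sym (*-distribˡ-Σℚ k _ vs))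

    Conic : {E : Set} → List E → (E → V → ℚ) → (V → ℚ) → Set
    Conic {E} es a b = Σ (E → ℚ) λ φ → (∀ e → 0ℚ ≤ φ e) × (∀ v → v ∈ vs → Σℚ (λ e → φ e * a e v) es ≡ b v)

    Separated : {E : Set} → List E → (E → V → ℚ) → (V → ℚ) → Set
    Separated es a b = Σ (V → ℚ) λ y → (∀ e → e ∈ es → 0ℚ ≤ dot vs y (a e)) × dot vs y b < 0ℚ

    private
      square-nonneg : ∀ p → 0ℚ ≤ p * p
      square-nonneg p with ≤-total 0ℚ p
      ... | inj₁ 0≤p = subst (_≤ p * p) (*-zeroʳ p) (*-monoˡ-≤-nonNeg p {{nonNegative 0≤p}} 0≤p)
      ... | inj₂ p≤0 = subst (_≤ p * p) (*-zeroʳ p) (*-monoˡ-≤-nonPos p {{nonPositive p≤0}} p≤0)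

      square-pos : ∀ p → p ≢ 0ℚ → 0ℚ < p * p
      square-pos p p≢0 with <-cmp p 0ℚ
      ... | tri< p<0 _ _ = subst (_< p * p) (*-zeroʳ p) (*-monoʳ-<-neg p {{negative p<0}} p<0)
      ... | tri≈ _ p≡0 _ = ⊥-elim (p≢0 p≡0)
      ... | tri> _ _ 0<p = subst (_< p * p) (*-zeroʳ p) (*-monoʳ-<-pos p {{positive 0<p}} 0<p)

      sum-squares≡0 : ∀ (b : V → ℚ) xs → Σℚ (λ v → b v * b v) xs ≤ 0ℚ → ∀ v → v ∈ xs → b v ≡ 0ℚ
      sum-squares≡0 b xs ≤0 v v∈ with b v ≟ 0ℚ
      ... | yes bv≡0 = bv≡0
      ... | no  bv≢0 = ⊥-elim (<-irrefl refl (<-≤-trans (square-pos (b v) bv≢0) (≤-trans (Σℚ-≥-∈ (square-nonneg ∘ b) v∈) ≤0)))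

    -- The multipliers form one function on E, so the coefficient of `e₀` is set by overriding `φ`
    -- there; as `e₀` does not recur in `es`, the rest of the combination is undisturbed.
    extend-conic : {E : Set} → DecidableEquality E → ∀ {e₀ : E} {es} → All (e₀ ≢_) es → {a : E → V → ℚ} {b : V → ℚ} →
                   ∀ μ (φ : E → ℚ) → 0ℚ ≤ μ → (∀ e → 0ℚ ≤ φ e) →
                   (∀ v → v ∈ vs → μ * a e₀ v + Σℚ (λ e → φ e * a e v) es ≡ b v) → Conic (e₀ ∷ es) a b
    extend-conic {E} _≟ₑ_ {e₀} {es} e₀∉es {a} μ φ 0≤μ 0≤φ comb = φ′ , 0≤φ′ , λ v v∈ →
      trans (cong₂ _+_ (cong (_* a e₀ v) φ′-new) (Σℚ-cong-∈ es λ e e∈ → cong (_* a e v) (φ′-old e e∈))) (comb v v∈)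
      where
      φ′ : E → ℚ
      φ′ e with e ≟ₑ e₀
      ... | yes _ = μ
      ... | no  _ = φ e
      φ′-new : φ′ e₀ ≡ μ
      φ′-new with e₀ ≟ₑ e₀
      ... | yes _ = refl
      ... | no  ≢ = ⊥-elim (≢ refl)
      φ′-old : ∀ e → e ∈ es → φ′ e ≡ φ e
      φ′-old e e∈ with e ≟ₑ e₀
      ... | yes refl = ⊥-elim (All.lookup e₀∉es e∈ refl)
      ... | no  _    = refl
      0≤φ′ : ∀ e → 0ℚ ≤ φ′ e
      0≤φ′ e with e ≟ₑ e₀
      ... | yes _ = 0≤μ
      ... | no  _ = 0≤φ e

    -- Bartl's proof: a y separating b from all vectors but a₀ is scaled to y·a₀ = −1; then everything
    -- is projected along a₀ onto the hyperplane y = 0, where induction applies again.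
    farkas : {E : Set} → DecidableEquality E → ∀ {es} → Unique es → (a : E → V → ℚ) (b : V → ℚ) →
             Conic es a b ⊎ Separated es a b
    -- The empty family spans only the origin: either b vanishes on `vs`, or -b separates it because
    -- -b·b < 0.
    farkas _≟ₑ_ {[]} _ a b with Σℚ (λ v → b v * b v) vs ≤? 0ℚ
    ... | yes ≤0 = inj₁ ((λ _ → 0ℚ) , (λ _ → ≤-refl) , λ v v∈ → sym (sum-squares≡0 b vs ≤0 v v∈))
    ... | no  ≰0 = inj₂ ((λ v → - 1ℚ * b v) , (λ _ ()) , subst (_< 0ℚ) (sym (dot-scaleˡ (- 1ℚ) b b))
                          (*-monoʳ-<-neg (- 1ℚ) (≰⇒> ≰0)))
    farkas {E} _≟ₑ_ {e₀ ∷ es} (e₀∉es ∷ unique) a b with farkas _≟ₑ_ unique a b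
    ... | inj₁ (φ , 0≤φ , φa≡b) = inj₁ (extend-conic _≟ₑ_ e₀∉es 0ℚ φ ≤-refl 0≤φ λ v v∈ →
            trans (cong (_+ _) (*-zeroˡ (a e₀ v))) (trans (+-identityˡ _) (φa≡b v v∈)))
    ... | inj₂ (y , 0≤y·a , y·b<0) with 0ℚ ≤? dot vs y (a e₀)
    ...   | yes 0≤y·a₀ = inj₂ (y , (λ { e (here refl) → 0≤y·a₀ ; e (there e∈) → 0≤y·a e e∈ }) , y·b<0)
    ...   | no  0≰y·a₀ = projected (farkas _≟ₑ_ unique a′ b′)
      where
      s = - dot vs y (a e₀)
      instance
        pos-s : Positive s
        pos-s = positive (neg-antimono-< (≰⇒> 0≰y·a₀))
        s≢0 : NonZero s
        s≢0 = pos⇒nonZero s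
        pos-t : Positive (1/ s)
        pos-t = 1/pos⇒pos s
        nonNeg-t : NonNegative (1/ s)
        nonNeg-t = pos⇒nonNeg (1/ s)
      t = 1/ s
      ŷ : V → ℚ
      ŷ v = t * y v
      p : E → ℚ
      p e = dot vs ŷ (a e)
      q = dot vs ŷ b
      a′ : E → V → ℚ
      a′ e v = a e v + p e * a e₀ v
      b′ : V → ℚ
      b′ v = b v + q * a e₀ v
      p₀≡-1 : p e₀ ≡ - 1ℚ
      p₀≡-1 = begin
        p e₀                       ≡⟨ dot-scaleˡ t y (a e₀) ⟩
        t * dot vs y (a e₀)        ≡⟨ ((∀ t d → t * d ≡ - (t * - d)) ∋ solve-∀ ring) t (dot vs y (a e₀)) ⟩
        - (t * s)                  ≡⟨ cong -_ (*-inverseˡ s) ⟩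
        - 1ℚ                       ∎
        where open ≡-Reasoning
      0≤p : ∀ e → e ∈ es → 0ℚ ≤ p e
      0≤p e e∈ = subst₂ _≤_ (*-zeroʳ t) (sym (dot-scaleˡ t y (a e))) (*-monoˡ-≤-nonNeg t (0≤y·a e e∈))
      q<0 : q < 0ℚ
      q<0 = subst₂ _<_ (sym (dot-scaleˡ t y b)) (*-zeroʳ t) (*-monoʳ-<-pos t y·b<0)
      projected : Conic es a′ b′ ⊎ Separated es a′ b′ → Conic (e₀ ∷ es) a b ⊎ Separated (e₀ ∷ es) a b
      projected (inj₁ (φ , 0≤φ , φa′≡b′)) = inj₁ (extend-conic _≟ₑ_ e₀∉es μ φ 0≤μ 0≤φ comb)
        where
        P = Σℚ (λ e → φ e * p e) es
        -- Undoing the projection in ∑ φ(a + p a₀) = b + q a₀ leaves P - q as the coefficient of a₀;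
        -- it is nonnegative because P ≥ 0 > q.
        μ = P - q
        0≤φp : ∀ e → e ∈ es → 0ℚ ≤ φ e * p e
        0≤φp e e∈ = subst (_≤ φ e * p e) (*-zeroʳ (φ e)) (*-monoˡ-≤-nonNeg (φ e) {{nonNegative (0≤φ e)}} (0≤p e e∈))
        0≤μ : 0ℚ ≤ μ
        0≤μ = +-mono-≤ (Σℚ-nonneg es 0≤φp) (neg-antimono-≤ (<⇒≤ q<0))
        comb : ∀ v → v ∈ vs → μ * a e₀ v + Σℚ (λ e → φ e * a e v) es ≡ b v
        comb v v∈ = begin
          (P - q) * c + A              ≡⟨ ((∀ P q c A → (P - q) * c + A ≡ (A + c * P) - q * c) ∋ solve-∀ ring) P q c A ⟩
          (A + c * P) - q * c          ≡⟨ cong (_- q * c) A+cP ⟩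
          (b v + q * c) - q * c        ≡⟨ ((∀ b x → (b + x) - x ≡ b) ∋ solve-∀ ring) (b v) (q * c) ⟩
          b v                          ∎
          where
          open ≡-Reasoning
          c = a e₀ v
          A = Σℚ (λ e → φ e * a e v) es
          A+cP : A + c * P ≡ b v + q * c
          A+cP = begin
            A + c * P                                       ≡⟨ cong (A +_) (*-distribˡ-Σℚ c _ es) ⟩
            A + Σℚ (λ e → c * (φ e * p e)) es               ≡⟨ sym (Σℚ-distrib-+ (λ e → φ e * a e v) (λ e → c * (φ e * p e)) es) ⟩
            Σℚ (λ e → φ e * a e v + c * (φ e * p e)) es
              ≡⟨ Σℚ-cong (λ e → ((∀ f x c p → f * x + c * (f * p) ≡ f * (x + p * c)) ∋ solve-∀ ring) (φ e) (a e v) c (p e)) es ⟩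
            Σℚ (λ e → φ e * a′ e v) es                      ≡⟨ φa′≡b′ v v∈ ⟩
            b v + q * c                                     ∎
      projected (inj₂ (z , 0≤z·a′ , z·b′<0)) = inj₂ (z′ , 0≤z′·a , subst (_< 0ℚ) (sym (z′· b)) z·b′<0)
        where
        k = dot vs z (a e₀)
        -- The adjoint of the projection applied to z: z′·x is z paired with the projection of x,
        -- and z′·a₀ = k - k = 0 because ŷ·a₀ = -1.
        z′ : V → ℚ
        z′ v = z v + k * ŷ v
        z′· : ∀ x → dot vs z′ x ≡ dot vs z (λ v → x v + dot vs ŷ x * a e₀ v)
        z′· x = trans (dot-linearˡ z k ŷ x) (trans (cong (dot vs z x +_) (*-comm k _)) (sym (dot-linearʳ z x (dot vs ŷ x) (a e₀))))
        z′·a₀≡0 : dot vs z′ (a e₀) ≡ 0ℚ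
        z′·a₀≡0 = trans (dot-linearˡ z k ŷ (a e₀)) (trans (cong (λ u → k + k * u) p₀≡-1)
          (((∀ k → k + k * - 1ℚ ≡ 0ℚ) ∋ solve-∀ ring) k))
        0≤z′·a : ∀ e → e ∈ e₀ ∷ es → 0ℚ ≤ dot vs z′ (a e)
        0≤z′·a e (here refl) = ≤-reflexive (sym z′·a₀≡0)
        0≤z′·a e (there e∈)  = subst (0ℚ ≤_) (sym (z′· (a e))) (0≤z·a′ e e∈)

-- Expansion and weights in ℕ: thresholds and layers.

module Covers where
  open Sums
  open import Data.Bool.Base using (Bool; true; false; not; T)
  open import Data.Bool.Properties using (T-≡)
  open import Data.Empty using (⊥; ⊥-elim)
  open import Data.Fin.Base using (Fin; zero; suc)
  open import Data.Fin.Properties using (any?; nonZeroIndex) renaming (_≟_ to _≟ᶠ_)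
  open import Data.List.Base using (allFin; length)
  open import Data.List.Membership.Propositional.Properties using (∈-allFin)
  open import Data.Nat.Base
  open import Data.Nat.Properties
  open import Data.Nat.Tactic.RingSolver using (solve-∀)
  open import Data.Product.Base using (Σ; _×_; _,_; proj₁; proj₂)
  open import Data.Sum.Base using (inj₁; inj₂)
  open import Data.Vec.Base using (lookup)
  open import Function.Base using (_∘_; _∋_)
  open import Function.Bundles using (Equivalence)
  open import Relation.Binary.PropositionalEquality
  open import Relation.Nullary using (Dec; ¬_; yes; no)

  -- Up to c|X| vertices per block cannot separate X from the rest of H, provided they leave more than m
  -- vertices of the block uncovered; m will be ⌊n/(c+1)⌋.
  capacity : ℕ → ℕ → ℕ → ℕ → ℕ
  capacity c m n x = (c * x) ⊓ (n ∸ suc m)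

  Expansive : ∀ {r n} → ℕ → ℕ → (Edge r n → Set) → Set
  Expansive {r} {n} c m H = ∀ i (X : Fin n → Bool) (Z : Fin r → Fin n → Bool) →
    1 ≤ count X (allFin n) → (∀ j → count (Z j) (allFin n) ≤ capacity c m n (count X (allFin n))) →
    Σ (Edge r n) λ e → H e × X (lookup e i) ≡ true × (∀ j → j ≢ i → Z j (lookup e j) ≡ false)

  private
    <ᵇ-true⇒< : ∀ {m n} → (m <ᵇ n) ≡ true → m < n
    <ᵇ-true⇒< {m} {n} eq = <ᵇ⇒< m n (Equivalence.from T-≡ eq)

    <⇒<ᵇ-true : ∀ {m n} → m < n → (m <ᵇ n) ≡ true
    <⇒<ᵇ-true m<n = Equivalence.to T-≡ (<⇒<ᵇ m<n)

    <ᵇ-false⇒≥ : ∀ {m n} → (m <ᵇ n) ≡ false → n ≤ m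
    <ᵇ-false⇒≥ {m} {n} eq = ≮⇒≥ λ m<n → case (trans (sym eq) (<⇒<ᵇ-true m<n))
      where
      case : false ≡ true → ⊥
      case ()

  crossing : (F : ℕ → ℕ) → ∀ m s → F 0 ≤ m → m < F s → Σ ℕ λ t → F t ≤ m × m < F (suc t)
  crossing F m zero    F0≤m m<F0 = ⊥-elim (<-irrefl refl (<-≤-trans m<F0 F0≤m))
  crossing F m (suc s) F0≤m m<Fs with m <? F s
  ... | yes m<F = crossing F m s F0≤m m<F
  ... | no  m≮F = s , ≮⇒≥ m≮F , m<Fs

  -- The balance between surplus and deficit needs thresholds with sum exactly T. Leading entries
  -- drop to 0 while the later ones suffice; then one entry takes up the difference.
  lower-to : ∀ {r} (t : Fin r → ℕ) T → T ≤ ∑ t (allFin r) →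
             Σ (Fin r → ℕ) λ t′ → (∀ i → t′ i ≤ t i) × ∑ t′ (allFin r) ≡ T
  lower-to {zero}  t zero T≤ = t , (λ ()) , refl
  lower-to {suc r} t T T≤ with T ≤? ∑ (t ∘ suc) (allFin r)
  ... | yes T≤′ with lower-to (t ∘ suc) T T≤′
  ...   | t′ , t′≤t , eq = t″ , (λ { zero → z≤n ; (suc i) → t′≤t i }) , trans (∑-allFin-suc t″) eq
    where
    t″ : Fin (suc r) → ℕ
    t″ zero    = 0
    t″ (suc i) = t′ i
  lower-to {suc r} t T T≤ | no T≰ = t″
                                  , (λ { zero → m≤n+o⇒m∸n≤o T rest (subst (T ≤_) (trans (∑-allFin-suc t) (+-comm (t zero) rest)) T≤)
                                       ; (suc i) → ≤-refl })
                                  , trans (∑-allFin-suc t″) (m∸n+n≡m (≰⇒≥ T≰))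
    where
    rest = ∑ (t ∘ suc) (allFin r)
    t″ : Fin (suc r) → ℕ
    t″ zero    = T ∸ rest
    t″ (suc i) = t (suc i)

  -- Both sides are the maximum of m and n. With m a weight and n its threshold this reads: weight
  -- plus deficit equals threshold plus surplus.
  m+[n∸m]≡n+[m∸n] : ∀ m n → m + (n ∸ m) ≡ n + (m ∸ n)
  m+[n∸m]≡n+[m∸n] zero    zero    = refl
  m+[n∸m]≡n+[m∸n] zero    (suc n) = cong suc (sym (+-identityʳ n))
  m+[n∸m]≡n+[m∸n] (suc m) zero    = cong suc (+-identityʳ m)
  m+[n∸m]≡n+[m∸n] (suc m) (suc n) = cong suc (m+[n∸m]≡n+[m∸n] m n)

  -- One layer of the layer-cake formula: raising the cap from B to B + 1 adds a unit exactly where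
  -- x exceeds B.
  ⊓-suc : ∀ x B → x ⊓ suc B ≡ x ⊓ B + 𝟙 (B <ᵇ x)
  ⊓-suc zero    B       = refl
  ⊓-suc (suc x) zero    = cong suc (⊓-zeroʳ x)
  ⊓-suc (suc x) (suc B) = cong suc (⊓-suc x B)

  ∑₂ : ∀ {r n} → (Fin r → Fin n → ℕ) → ℕ
  ∑₂ {r} {n} h = ∑ (λ i → ∑ (h i) (allFin n)) (allFin r)

  module _ {r n : ℕ} where
    ∑₂-cong : {h k : Fin r → Fin n → ℕ} → (∀ i a → h i a ≡ k i a) → ∑₂ h ≡ ∑₂ k
    ∑₂-cong h≗k = ∑-cong (λ i → ∑-cong (h≗k i) (allFin n)) (allFin r)

    ∑₂-mono : {h k : Fin r → Fin n → ℕ} → (∀ i a → h i a ≤ k i a) → ∑₂ h ≤ ∑₂ k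
    ∑₂-mono h≤k = ∑-mono (λ i → ∑-mono (h≤k i) (allFin n)) (allFin r)

    ∑₂-distrib-+ : (h k : Fin r → Fin n → ℕ) → ∑₂ (λ i a → h i a + k i a) ≡ ∑₂ h + ∑₂ k
    ∑₂-distrib-+ h k = trans (∑-cong (λ i → ∑-distrib-+ (h i) (k i) (allFin n)) (allFin r))
      (∑-distrib-+ (λ i → ∑ (h i) (allFin n)) (λ i → ∑ (k i) (allFin n)) (allFin r))

    *-distribˡ-∑₂ : ∀ c (h : Fin r → Fin n → ℕ) → c * ∑₂ h ≡ ∑₂ (λ i a → c * h i a)
    *-distribˡ-∑₂ c h = trans (*-distribˡ-∑ c _ (allFin r)) (∑-cong (λ i → *-distribˡ-∑ c (h i) (allFin n)) (allFin r))

    ∑₂-const : (t : Fin r → ℕ) → ∑₂ {r} {n} (λ i _ → t i) ≡ n * ∑ t (allFin r)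
    ∑₂-const t = trans (∑-cong (λ i → trans (∑-const (t i) (allFin n)) (cong (_* t i) (length-allFin n))) (allFin r))
      (sym (*-distribˡ-∑ n t (allFin r)))

    ∑₂-≥ : (h : Fin r → Fin n → ℕ) → ∀ i a → h i a ≤ ∑₂ h
    ∑₂-≥ h i a = ≤-trans (∑-≥-∈ (h i) (∈-allFin a)) (∑-≥-∈ (λ i → ∑ (h i) (allFin n)) (∈-allFin i))

  -- With t_i the (m+1)-st smallest weight in V_i, some edge consists of vertices with w ≤ t_i, so ∑ t_i ≥ T;
  -- lowering the t_i does no harm.
  thresholds : ∀ {r n c m} → Fin r → m < n → n ≤ suc m + c * suc m →
    (H : Edge r n → Set) → Expansive c m H →
    ∀ (W : Fin r → Fin n → ℕ) T → (∀ e → H e → T ≤ ∑ (λ i → W i (lookup e i)) (allFin r)) →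
    Σ (Fin r → ℕ) λ t → (∀ i → count (λ a → W i a <ᵇ t i) (allFin n) ≤ m) × ∑ t (allFin r) ≡ T
  thresholds {r} {n} {c} {m} i₀ m<n n≤[c+1][m+1] H expansive W T cover = lowered (lower-to t₀ T T≤∑t₀)
    where
    open ≤-Reasoning
    vs = allFin n
    is = allFin r

    F : Fin r → ℕ → ℕ
    F i s = count (λ a → W i a <ᵇ s) vs

    -- No weight is below 0, and every weight of the block is below `suc` of their sum; in between,
    -- the number of weights below s passes from at most m to more than m.
    quantile : ∀ i → Σ ℕ λ t → F i t ≤ m × m < F i (suc t)
    quantile i = crossing (F i) m (suc (∑ (W i) vs)) (≤-trans (≤-reflexive none) z≤n) (begin-strict
      m                          <⟨ m<n ⟩
      n                          ≡⟨ trans (sym (length-allFin n)) (sym (count-true vs)) ⟩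
      count (λ _ → true) vs      ≤⟨ count-mono (λ a _ → <⇒<ᵇ-true (s≤s (∑-≥-∈ (W i) (∈-allFin a)))) vs ⟩
      F i (suc (∑ (W i) vs))     ∎)
      where
      none : F i 0 ≡ 0
      none = trans (∑-const 0 vs) (*-zeroʳ (length vs))

    t₀ : Fin r → ℕ
    t₀ i = proj₁ (quantile i)

    B : Fin r → Fin n → Bool
    B i a = W i a <ᵇ suc (t₀ i)

    B-large : ∀ i → m < count (B i) vs
    B-large i = proj₂ (proj₂ (quantile i))

    not-B-small : ∀ j → count (not ∘ B j) vs ≤ n ∸ suc m
    not-B-small j = m+n≤o⇒m≤o∸n _ (begin
      count (not ∘ B j) vs + suc m                ≤⟨ +-monoʳ-≤ _ (B-large j) ⟩
      count (not ∘ B j) vs + count (B j) vs       ≡⟨ +-comm (count (not ∘ B j) vs) _ ⟩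
      count (B j) vs + count (not ∘ B j) vs       ≡⟨ trans (count-not (B j) vs) (length-allFin n) ⟩
      n                                           ∎)

    -- More than m vertices lie in `B i₀`, and n ≤ (c+1)(m+1); hence the capacity belonging to
    -- `B i₀` is the full cap n - (m+1).
    complement-small : n ∸ suc m ≤ c * count (B i₀) vs
    complement-small = ≤-trans (m≤n+o⇒m∸n≤o n (suc m) n≤[c+1][m+1]) (*-monoʳ-≤ c (B-large i₀))

    T≤∑t₀ : T ≤ ∑ t₀ is
    T≤∑t₀ with expansive i₀ (B i₀) (λ j → not ∘ B j) (≤-trans (s≤s z≤n) (B-large i₀))
                         (λ j → ⊓-glb (≤-trans (not-B-small j) complement-small) (not-B-small j))
    ... | e , e∈H , Xe , Ze = ≤-trans (cover e e∈H) (∑-mono light is)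
      where
      light : ∀ j → W j (lookup e j) ≤ t₀ j
      light j with j ≟ᶠ i₀
      ... | yes refl = s≤s⁻¹ (<ᵇ-true⇒< Xe)
      ... | no  j≢i₀ = s≤s⁻¹ (<ᵇ-true⇒< (not-false (Ze j j≢i₀)))
        where
        not-false : ∀ {b} → not b ≡ false → b ≡ true
        not-false {true} _ = refl

    lowered : (Σ (Fin r → ℕ) λ t → (∀ i → t i ≤ t₀ i) × ∑ t is ≡ T) →
              Σ (Fin r → ℕ) λ t → (∀ i → F i (t i) ≤ m) × ∑ t is ≡ T
    lowered (t , t≤t₀ , ∑t≡T) = t , (λ i → ≤-trans (F-mono i) (proj₁ (proj₂ (quantile i)))) , ∑t≡T
      where
      F-mono : ∀ i → F i (t i) ≤ F i (t₀ i)
      F-mono i = count-mono (λ a W<t → <⇒<ᵇ-true (<-≤-trans (<ᵇ-true⇒< W<t) (t≤t₀ i))) vs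

  -- Every edge carries at least as much surplus g = (w − t)⁺ as deficit f = (t − w)⁺. The vertices of V_i with
  -- deficit ≥ θ form a small set, which the vertices with surplus ≥ θ/r separate from the rest of H; by expansion
  -- the latter are c times as many. Summed over θ, the total surplus exceeds the total deficit unless both vanish.
  surplus-bound : ∀ {r n c m} → Fin r → r * r < c → m * suc c ≤ n →
    (H : Edge r n → Set) → Expansive c m H →
    ∀ (W : Fin r → Fin n → ℕ) T → (∀ e → H e → T ≤ ∑ (λ i → W i (lookup e i)) (allFin r)) →
    ∀ t → (∀ i → count (λ a → W i a <ᵇ t i) (allFin n) ≤ m) → ∑ t (allFin r) ≡ T →
    n * T ≤ ∑₂ W × (∑₂ W ≤ n * T → ∀ i a → W i a ≡ t i)
  surplus-bound {r} {n} {c} {m} i₀ r²<c m[c+1]≤n H expansive W T cover t few-light ∑t≡T = nT≤W , constant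
    where
    open ≤-Reasoning
    instance
      r≢0 : NonZero r
      r≢0 = nonZeroIndex i₀
    vs = allFin n
    is = allFin r

    f g : Fin r → Fin n → ℕ
    f i a = t i ∸ W i a
    g i a = W i a ∸ t i

    edge-balance : ∀ e → H e → ∑ (λ i → f i (lookup e i)) is ≤ ∑ (λ i → g i (lookup e i)) is
    edge-balance e e∈H = +-cancelˡ-≤ T _ _ (begin
      T + ∑ (λ i → f i (lookup e i)) is
        ≤⟨ +-monoˡ-≤ (∑ (λ i → f i (lookup e i)) is) (cover e e∈H) ⟩
      ∑ (λ i → W i (lookup e i)) is + ∑ (λ i → f i (lookup e i)) is
        ≡⟨ sym (∑-distrib-+ (λ i → W i (lookup e i)) (λ i → f i (lookup e i)) is) ⟩
      ∑ (λ i → W i (lookup e i) + f i (lookup e i)) is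
        ≡⟨ ∑-cong (λ i → m+[n∸m]≡n+[m∸n] (W i (lookup e i)) (t i)) is ⟩
      ∑ (λ i → t i + g i (lookup e i)) is
        ≡⟨ ∑-distrib-+ t (λ i → g i (lookup e i)) is ⟩
      ∑ t is + ∑ (λ i → g i (lookup e i)) is
        ≡⟨ cong (_+ ∑ (λ i → g i (lookup e i)) is) ∑t≡T ⟩
      T + ∑ (λ i → g i (lookup e i)) is ∎)

    level : ∀ B i → c * count (λ a → B <ᵇ f i a) vs ≤ ∑ (λ j → count (λ a → B <ᵇ r * g j a) vs) is
    level B i = by-cases (any? λ j → c * count X vs ≤? count (Z j) vs) (1 ≤? count X vs)
      where
      X : Fin n → Bool
      X a = B <ᵇ f i a
      Z : Fin r → Fin n → Bool
      Z j a = B <ᵇ r * g j a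
      X-small : count X vs ≤ m
      X-small = ≤-trans (count-mono (λ a Xa → <⇒<ᵇ-true (below a (<ᵇ-true⇒< Xa))) vs) (few-light i)
        where
        below : ∀ a → B < f i a → W i a < t i
        below a B<f = ≰⇒> λ t≤W → n≮0 (subst (B <_) (m≤n⇒m∸n≡0 t≤W) B<f)
      -- As |X| ≤ m, the number c|X| + m is at most m(c+1) ≤ n; the strict inequality z < c|X|
      -- supplies the missing unit in z + (m+1) ≤ n.
      within-capacity : ∀ z → z < c * count X vs → z ≤ capacity c m n (count X vs)
      within-capacity z z<cX = ⊓-glb (<⇒≤ z<cX) (m+n≤o⇒m≤o∸n z (begin
        z + suc m                 ≡⟨ +-suc z m ⟩
        suc z + m                 ≤⟨ +-monoˡ-≤ m z<cX ⟩
        c * count X vs + m        ≤⟨ +-monoˡ-≤ m (*-monoʳ-≤ c X-small) ⟩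
        c * m + m                 ≡⟨ ((∀ c m → c * m + m ≡ m * (1 + c)) ∋ solve-∀) c m ⟩
        m * suc c                 ≤⟨ m[c+1]≤n ⟩
        n                         ∎))
      separated : ¬ (Σ (Edge r n) λ e → H e × X (lookup e i) ≡ true × (∀ j → j ≢ i → Z j (lookup e j) ≡ false))
      separated (e , e∈H , Xe , Ze) = <-irrefl refl (begin-strict
        B                                   <⟨ <ᵇ-true⇒< Xe ⟩
        f i (lookup e i)                    ≤⟨ ∑-≥-∈ (λ i → f i (lookup e i)) (∈-allFin i) ⟩
        ∑ (λ j → f j (lookup e j)) is       ≤⟨ edge-balance e e∈H ⟩
        ∑ (λ j → g j (lookup e j)) is       ≤⟨ *-cancelˡ-≤ r light-edge ⟩
        B                                   ∎)
        where
        light-vertex : ∀ j → r * g j (lookup e j) ≤ B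
        light-vertex j with j ≟ᶠ i
        ... | no  j≢i  = <ᵇ-false⇒≥ (Ze j j≢i)
        ... | yes refl = ≤-trans (≤-reflexive (trans (cong (r *_) no-surplus) (*-zeroʳ r))) z≤n
          where
          -- Expansion says nothing about `Z` at the block of X itself, but the vertex there has a
          -- positive deficit and therefore no surplus.
          no-surplus : g j (lookup e j) ≡ 0
          no-surplus = m≤n⇒m∸n≡0 {W j (lookup e j)} {t j} (<⇒≤ (m∸n≢0⇒n<m {t j} {W j (lookup e j)} λ f≡0 → n≮0 (subst (B <_) f≡0 (<ᵇ-true⇒< Xe))))
        light-edge : r * ∑ (λ j → g j (lookup e j)) is ≤ r * B
        light-edge = begin
          r * ∑ (λ j → g j (lookup e j)) is       ≡⟨ *-distribˡ-∑ r (λ j → g j (lookup e j)) is ⟩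
          ∑ (λ j → r * g j (lookup e j)) is       ≤⟨ ∑-mono light-vertex is ⟩
          ∑ (λ _ → B) is                          ≡⟨ ∑-const B is ⟩
          length is * B            ≡⟨ cong (_* B) (length-allFin r) ⟩
          r * B                                   ∎
      by-cases : Dec (Σ (Fin r) λ j → c * count X vs ≤ count (Z j) vs) → Dec (1 ≤ count X vs) →
                 c * count X vs ≤ ∑ (λ j → count (Z j) vs) is
      by-cases (yes (j , large)) _ = ≤-trans large (∑-≥-∈ (λ j → count (Z j) vs) (∈-allFin j))
      by-cases (no none-large) (yes 1≤X) = ⊥-elim (separated (expansive i X Z 1≤X λ j →
        within-capacity (count (Z j) vs) (≰⇒> λ large → none-large (j , large))))
      by-cases (no _) (no X≡0) = ≤-trans (≤-reflexive (trans (cong (c *_) (n<1⇒n≡0 (≰⇒> X≡0))) (*-zeroʳ c))) z≤n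

    -- Adding `level` over the caps below B reconstructs the truncated sums. The outer factor r
    -- arises because `level` has the same right side for each of the r blocks.
    layer-cake : ∀ B → c * ∑₂ (λ i a → f i a ⊓ B) ≤ r * ∑₂ (λ i a → r * g i a ⊓ B)
    layer-cake zero    = begin
      c * ∑₂ (λ i a → f i a ⊓ 0)     ≡⟨ cong (c *_) (∑₂-cong {k = λ _ _ → 0} λ i a → ⊓-zeroʳ (f i a)) ⟩
      c * ∑₂ {r} {n} (λ _ _ → 0)     ≡⟨ cong (c *_) (trans (∑₂-const {r} {n} (λ _ → 0)) (cong (n *_) (trans (∑-const 0 is) (*-zeroʳ (length is))))) ⟩
      c * (n * 0)                    ≡⟨ trans (cong (c *_) (*-zeroʳ n)) (*-zeroʳ c) ⟩
      0                              ≤⟨ z≤n ⟩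
      r * ∑₂ (λ i a → r * g i a ⊓ 0) ∎
    layer-cake (suc B) = begin
      c * ∑₂ (λ i a → f i a ⊓ suc B)
        ≡⟨ cong (c *_) (trans (∑₂-cong {h = λ i a → f i a ⊓ suc B} {k = λ i a → (f i a ⊓ B) + 𝟙 (B <ᵇ f i a)} λ i a → ⊓-suc (f i a) B)
                       (∑₂-distrib-+ (λ i a → f i a ⊓ B) (λ i a → 𝟙 (B <ᵇ f i a)))) ⟩
      c * (∑₂ (λ i a → f i a ⊓ B) + ∑₂ (λ i a → 𝟙 (B <ᵇ f i a)))
        ≡⟨ *-distribˡ-+ c (∑₂ (λ i a → f i a ⊓ B)) _ ⟩
      c * ∑₂ (λ i a → f i a ⊓ B) + c * ∑ (λ i → count (λ a → B <ᵇ f i a) vs) is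
        ≤⟨ +-mono-≤ (layer-cake B) top ⟩
      r * ∑₂ (λ i a → r * g i a ⊓ B) + r * ∑₂ (λ i a → 𝟙 (B <ᵇ r * g i a))
        ≡⟨ sym (*-distribˡ-+ r (∑₂ (λ i a → r * g i a ⊓ B)) _) ⟩
      r * (∑₂ (λ i a → r * g i a ⊓ B) + ∑₂ (λ i a → 𝟙 (B <ᵇ r * g i a)))
        ≡⟨ cong (r *_) (trans (sym (∑₂-distrib-+ (λ i a → r * g i a ⊓ B) (λ i a → 𝟙 (B <ᵇ r * g i a))))
                       (sym (∑₂-cong {h = λ i a → r * g i a ⊓ suc B} {k = λ i a → (r * g i a ⊓ B) + 𝟙 (B <ᵇ r * g i a)} λ i a → ⊓-suc (r * g i a) B))) ⟩
      r * ∑₂ (λ i a → r * g i a ⊓ suc B) ∎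
      where
      top : c * ∑ (λ i → count (λ a → B <ᵇ f i a) vs) is ≤ r * ∑₂ (λ i a → 𝟙 (B <ᵇ r * g i a))
      top = begin
        c * ∑ (λ i → count (λ a → B <ᵇ f i a) vs) is         ≡⟨ *-distribˡ-∑ c (λ i → count (λ a → B <ᵇ f i a) vs) is ⟩
        ∑ (λ i → c * count (λ a → B <ᵇ f i a) vs) is         ≤⟨ ∑-mono (level B) is ⟩
        ∑ (λ _ → ∑₂ (λ i a → 𝟙 (B <ᵇ r * g i a))) is         ≡⟨ ∑-const (∑₂ (λ i a → 𝟙 (B <ᵇ r * g i a))) is ⟩
        length is * ∑₂ (λ i a → 𝟙 (B <ᵇ r * g i a))      ≡⟨ cong (_* ∑₂ (λ i a → 𝟙 (B <ᵇ r * g i a))) (length-allFin r) ⟩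
        r * ∑₂ (λ i a → 𝟙 (B <ᵇ r * g i a))                  ∎

    c*∑f≤r²*∑g : c * ∑₂ f ≤ r * r * ∑₂ g
    c*∑f≤r²*∑g = begin
      c * ∑₂ f                            ≡⟨ cong (c *_) (∑₂-cong λ i a → sym (m≤n⇒m⊓n≡m (f≤T i a))) ⟩
      c * ∑₂ (λ i a → f i a ⊓ T)          ≤⟨ layer-cake T ⟩
      r * ∑₂ (λ i a → r * g i a ⊓ T)      ≤⟨ *-monoʳ-≤ r (∑₂-mono λ i a → m⊓n≤m (r * g i a) T) ⟩
      r * ∑₂ (λ i a → r * g i a)          ≡⟨ cong (r *_) (sym (*-distribˡ-∑₂ r g)) ⟩
      r * (r * ∑₂ g)                      ≡⟨ sym (*-assoc r r _) ⟩
      r * r * ∑₂ g                        ∎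
      where
      f≤T : ∀ i a → f i a ≤ T
      f≤T i a = ≤-trans (m∸n≤m (t i) (W i a)) (subst (t i ≤_) ∑t≡T (∑-≥-∈ t (∈-allFin i)))

    balance : ∑₂ W + ∑₂ f ≡ n * T + ∑₂ g
    balance = begin-equality
      ∑₂ W + ∑₂ f                       ≡⟨ sym (∑₂-distrib-+ W f) ⟩
      ∑₂ (λ i a → W i a + f i a)        ≡⟨ ∑₂-cong (λ i a → m+[n∸m]≡n+[m∸n] (W i a) (t i)) ⟩
      ∑₂ (λ i a → t i + g i a)          ≡⟨ ∑₂-distrib-+ (λ i _ → t i) g ⟩
      ∑₂ {r} {n} (λ i _ → t i) + ∑₂ g   ≡⟨ cong (_+ ∑₂ g) (trans (∑₂-const {r} {n} t) (cong (n *_) ∑t≡T)) ⟩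
      n * T + ∑₂ g                      ∎

    -- Here c > r² enters: (r² + 1) ∑ f ≤ c ∑ f ≤ r² ∑ g ≤ r² ∑ f.
    g≤f⇒f≡0 : ∑₂ g ≤ ∑₂ f → ∑₂ f ≡ 0
    g≤f⇒f≡0 g≤f = n≤0⇒n≡0 (+-cancelʳ-≤ (r * r * ∑₂ f) _ _
      (≤-trans (*-monoˡ-≤ (∑₂ f) r²<c) (≤-trans c*∑f≤r²*∑g (*-monoʳ-≤ (r * r) g≤f))))

    nT≤W : n * T ≤ ∑₂ W
    nT≤W = +-cancelʳ-≤ (∑₂ f) _ _ (≤-trans (+-monoʳ-≤ (n * T) f≤g) (≤-reflexive (sym balance)))
      where
      f≤g : ∑₂ f ≤ ∑₂ g
      f≤g with ≤-total (∑₂ f) (∑₂ g)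
      ... | inj₁ f≤g = f≤g
      ... | inj₂ g≤f = ≤-trans (≤-reflexive (g≤f⇒f≡0 g≤f)) z≤n

    constant : ∑₂ W ≤ n * T → ∀ i a → W i a ≡ t i
    constant W≤nT i a = begin-equality
      W i a                  ≡⟨ sym (+-identityʳ _) ⟩
      W i a + 0              ≡⟨ cong (W i a +_) (sym f≡0) ⟩
      W i a + f i a          ≡⟨ m+[n∸m]≡n+[m∸n] (W i a) (t i) ⟩
      t i + g i a            ≡⟨ cong (t i +_) g≡0 ⟩
      t i + 0                ≡⟨ +-identityʳ _ ⟩
      t i                    ∎
      where
      g≤f : ∑₂ g ≤ ∑₂ f
      g≤f = +-cancelˡ-≤ (n * T) _ _ (≤-trans (≤-reflexive (sym balance)) (+-monoˡ-≤ (∑₂ f) W≤nT))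
      f≡0 : f i a ≡ 0
      f≡0 = n≤0⇒n≡0 (≤-trans (∑₂-≥ f i a) (≤-reflexive (g≤f⇒f≡0 g≤f)))
      g≡0 : g i a ≡ 0
      g≡0 = n≤0⇒n≡0 (≤-trans (∑₂-≥ g i a) (≤-trans g≤f (≤-reflexive (g≤f⇒f≡0 g≤f))))

-- Enumeration of vertices and edges.

module HostGraph where
  open import Data.List.Base using (List; []; _∷_; _++_; map; concatMap; concat; allFin; cartesianProductWith)
  open import Data.List.Membership.Propositional using (_∈_)
  import Data.List.Membership.DecPropositional as DecMembership
  open import Data.List.Membership.Propositional.Properties
    using (∈-allFin; ∈-cartesianProductWith⁺; ∈-filter⁺)
  import Data.List.Relation.Unary.AllPairs as AllPairs
  import Data.List.Relation.Unary.All as All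
  open import Data.List.Relation.Unary.Any using (here)
  open import Data.List.Relation.Unary.Unique.Propositional using (Unique)
  open import Data.List.Relation.Unary.Unique.Propositional.Properties using (cartesianProductWith⁺; allFin⁺; filter⁺)
  open import Data.Nat.Base using (zero; suc)
  open import Data.Product.Base using (_,_)
  open import Data.Vec.Base using ([]; _∷_)
  open import Data.Vec.Properties using (∷-injective)
  open import Relation.Binary.PropositionalEquality

  concatMap-map : {A B C : Set} (f : A → B → C) → ∀ xs ys →
                  concatMap (λ x → map (f x) ys) xs ≡ cartesianProductWith f xs ys
  concatMap-map f []       ys = refl
  concatMap-map f (x ∷ xs) ys = cong (map (f x) ys ++_) (concatMap-map f xs ys)

  ∈-allVertices : ∀ {r n} (v : Vertex r n) → v ∈ allVertices r n
  ∈-allVertices {r} {n} (i , a) = subst ((i , a) ∈_) (sym (concatMap-map _,_ (allFin r) (allFin n)))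
    (∈-cartesianProductWith⁺ _,_ (∈-allFin i) (∈-allFin a))

  ∈-allEdges : ∀ {r n} (e : Edge r n) → e ∈ allEdges r n
  ∈-allEdges []      = here refl
  ∈-allEdges (_∷_ {n = r} x e) = subst ((x ∷ e) ∈_) (sym (concatMap-map _∷_ (allFin _) (allEdges r _)))
    (∈-cartesianProductWith⁺ _∷_ (∈-allFin x) (∈-allEdges e))

  allEdges-unique : ∀ r n → Unique (allEdges r n)
  allEdges-unique zero    n = All.[] AllPairs.∷ AllPairs.[]
  allEdges-unique (suc r) n = subst Unique (sym (concatMap-map _∷_ (allFin n) (allEdges r n)))
    (cartesianProductWith⁺ _∷_ ∷-injective (allFin⁺ n) (allEdges-unique r n))

  edgesOf-unique : ∀ {r n} (ω : Outcome r n) → Unique (edgesOf ω)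
  edgesOf-unique {r} {n} ω = filter⁺ (λ e → DecMembership._∈?_ edge-≟ e (concat ω)) (allEdges-unique r n)

  ∈-edgesOf : ∀ {r n} (ω : Outcome r n) {e} → e ∈ concat ω → e ∈ edgesOf ω
  ∈-edgesOf ω {e} = ∈-filter⁺ (λ e → DecMembership._∈?_ edge-≟ e (concat ω)) (∈-allEdges e)

-- Clearing denominators: from rational to natural weights.

module Embedding where
  open import Data.Integer.Base as ℤ using (+_; -[1+_])
  import Data.Integer.Properties as ℤ
  open import Data.List.Base using (List; []; _∷_; length)
  open import Data.List.Membership.Propositional using (_∈_)
  open import Data.List.Relation.Unary.Any using (here; there)
  open import Data.Nat.Base as ℕ using (ℕ; suc)
  import Data.Nat.Properties as ℕ
  open import Data.Product.Base using (Σ; _×_; _,_)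
  open import Data.Rational.Base
  open import Data.Rational.Properties
  open import Data.Rational.Unnormalised.Base as ℚᵘ using (ℚᵘ; mkℚᵘ; *≡*)
  import Data.Rational.Unnormalised.Properties as ℚᵘ
  open import Function.Base using (_∋_)
  open import Relation.Binary.PropositionalEquality
  open import Tactic.RingSolver using (solve-∀)
  open RationalSums
  open Sums

  private
    toℚᵘ-ℕtoℚ : ∀ m → toℚᵘ (ℕtoℚ m) ℚᵘ.≃ mkℚᵘ (+ m) 0
    toℚᵘ-ℕtoℚ m = toℚᵘ-fromℚᵘ (mkℚᵘ (+ m) 0)

  ℕtoℚ-+ : ∀ a b → ℕtoℚ (a ℕ.+ b) ≡ ℕtoℚ a + ℕtoℚ b
  ℕtoℚ-+ a b = toℚᵘ-injective (begin-equality
    toℚᵘ (ℕtoℚ (a ℕ.+ b))                  ≃⟨ toℚᵘ-ℕtoℚ (a ℕ.+ b) ⟩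
    mkℚᵘ (+ (a ℕ.+ b)) 0                   ≃⟨ *≡* (cong (ℤ._* + 1) (trans (ℤ.pos-+ a b) (sym (cong₂ ℤ._+_ (ℤ.*-identityʳ (+ a)) (ℤ.*-identityʳ (+ b)))))) ⟩
    mkℚᵘ (+ a) 0 ℚᵘ.+ mkℚᵘ (+ b) 0         ≃⟨ ℚᵘ.≃-sym (ℚᵘ.+-cong (toℚᵘ-ℕtoℚ a) (toℚᵘ-ℕtoℚ b)) ⟩
    toℚᵘ (ℕtoℚ a) ℚᵘ.+ toℚᵘ (ℕtoℚ b)       ≃⟨ ℚᵘ.≃-sym (toℚᵘ-homo-+ (ℕtoℚ a) (ℕtoℚ b)) ⟩
    toℚᵘ (ℕtoℚ a + ℕtoℚ b)                 ∎)
    where open ℚᵘ.≤-Reasoning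

  ℕtoℚ-* : ∀ a b → ℕtoℚ (a ℕ.* b) ≡ ℕtoℚ a * ℕtoℚ b
  ℕtoℚ-* a b = toℚᵘ-injective (begin-equality
    toℚᵘ (ℕtoℚ (a ℕ.* b))                  ≃⟨ toℚᵘ-ℕtoℚ (a ℕ.* b) ⟩
    mkℚᵘ (+ (a ℕ.* b)) 0                   ≃⟨ *≡* (cong (ℤ._* + 1) (ℤ.pos-* a b)) ⟩
    mkℚᵘ (+ a) 0 ℚᵘ.* mkℚᵘ (+ b) 0         ≃⟨ ℚᵘ.≃-sym (ℚᵘ.*-cong (toℚᵘ-ℕtoℚ a) (toℚᵘ-ℕtoℚ b)) ⟩
    toℚᵘ (ℕtoℚ a) ℚᵘ.* toℚᵘ (ℕtoℚ b)       ≃⟨ ℚᵘ.≃-sym (toℚᵘ-homo-* (ℕtoℚ a) (ℕtoℚ b)) ⟩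
    toℚᵘ (ℕtoℚ a * ℕtoℚ b)                 ∎)
    where open ℚᵘ.≤-Reasoning

  ℕtoℚ-mono-≤ : ∀ {a b} → a ℕ.≤ b → ℕtoℚ a ≤ ℕtoℚ b
  ℕtoℚ-mono-≤ {a} {b} a≤b = toℚᵘ-cancel-≤ (begin
    toℚᵘ (ℕtoℚ a)     ≃⟨ toℚᵘ-ℕtoℚ a ⟩
    mkℚᵘ (+ a) 0      ≤⟨ ℚᵘ.*≤* (ℤ.*-monoʳ-≤-nonNeg (+ 1) (ℤ.+≤+ a≤b)) ⟩
    mkℚᵘ (+ b) 0      ≃⟨ ℚᵘ.≃-sym (toℚᵘ-ℕtoℚ b) ⟩
    toℚᵘ (ℕtoℚ b)     ∎)
    where open ℚᵘ.≤-Reasoning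

  ℕtoℚ-cancel-≤ : ∀ {a b} → ℕtoℚ a ≤ ℕtoℚ b → a ℕ.≤ b
  ℕtoℚ-cancel-≤ {a} {b} a≤b = ℕ.≮⇒≥ λ b<a → <-irrefl refl (<-≤-trans (strict b<a) a≤b)
    where
    strict : b ℕ.< a → ℕtoℚ b < ℕtoℚ a
    strict b<a = <-≤-trans (subst (_< ℕtoℚ (suc b)) (+-identityˡ (ℕtoℚ b))
      (subst (0ℚ + ℕtoℚ b <_) (sym (ℕtoℚ-+ 1 b)) (+-monoˡ-< (ℕtoℚ b) (positive⁻¹ 1ℚ)))) (ℕtoℚ-mono-≤ b<a)

  0≤ℕtoℚ : ∀ a → 0ℚ ≤ ℕtoℚ a
  0≤ℕtoℚ a = ℕtoℚ-mono-≤ {0} {a} ℕ.z≤n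

  ℕtoℚ-positive : ∀ {a} → 1 ℕ.≤ a → Positive (ℕtoℚ a)
  ℕtoℚ-positive 1≤a = positive (<-≤-trans (positive⁻¹ 1ℚ) (ℕtoℚ-mono-≤ 1≤a))

  ↧-scale : ∀ (p : ℚ) → ℕtoℚ (↧ₙ p) * p ≡ ↥ p / 1
  ↧-scale p@(mkℚ num d-1 _) = toℚᵘ-injective (begin-equality
    toℚᵘ (ℕtoℚ (suc d-1) * p)                  ≃⟨ toℚᵘ-homo-* (ℕtoℚ (suc d-1)) p ⟩
    toℚᵘ (ℕtoℚ (suc d-1)) ℚᵘ.* mkℚᵘ num d-1    ≃⟨ ℚᵘ.*-cong (toℚᵘ-ℕtoℚ (suc d-1)) (ℚᵘ.≃-refl {mkℚᵘ num d-1}) ⟩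
    mkℚᵘ (+ suc d-1) 0 ℚᵘ.* mkℚᵘ num d-1       ≃⟨ *≡* cross ⟩
    mkℚᵘ num 0                                 ≃⟨ ℚᵘ.≃-sym (toℚᵘ-fromℚᵘ (mkℚᵘ num 0)) ⟩
    toℚᵘ (num / 1)                             ∎)
    where
    open ℚᵘ.≤-Reasoning
    cross : (+ suc d-1 ℤ.* num) ℤ.* + 1 ≡ num ℤ.* + suc (d-1 ℕ.+ 0)
    cross = trans (ℤ.*-identityʳ _) (trans (ℤ.*-comm (+ suc d-1) num) (cong (λ t → num ℤ.* + suc t) (sym (ℕ.+-identityʳ d-1))))

  -- One scale q and one shift B serve all elements, so that sums of equally many values remain
  -- comparable after the change to natural numbers.
  Integral : {A : Set} → List A → (A → ℚ) → Set
  Integral xs y = Σ ℕ λ q → Σ ℕ λ B → 1 ℕ.≤ q × (∀ x → x ∈ xs → Σ ℕ λ w → ℕtoℚ w ≡ ℕtoℚ q * y x + ℕtoℚ B)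

  private
    integral₁ : (p : ℚ) → Σ ℕ λ B → Σ ℕ λ w → ℕtoℚ w ≡ ℕtoℚ (↧ₙ p) * p + ℕtoℚ B
    integral₁ p@(mkℚ (+ a)    _ _) = 0 , a , trans (sym (↧-scale p)) (sym (+-identityʳ _))
    integral₁ p@(mkℚ -[1+ a ] _ _) = suc a , 0 ,
      trans (sym (+-inverseˡ (ℕtoℚ (suc a)))) (cong (_+ ℕtoℚ (suc a)) (sym (↧-scale p)))

    -- Scaling by q₂ turns the shift B₁ into B₁q₂; the further shift by B₂q₁ makes the result
    -- symmetric in the two pairs, so that old and new elements end up with the same scale and
    -- shift.
    combine : ∀ q₁ B₁ w₁ q₂ B₂ y → ℕtoℚ w₁ ≡ ℕtoℚ q₁ * y + ℕtoℚ B₁ →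
              ℕtoℚ (w₁ ℕ.* q₂ ℕ.+ B₂ ℕ.* q₁) ≡ ℕtoℚ (q₁ ℕ.* q₂) * y + ℕtoℚ (B₁ ℕ.* q₂ ℕ.+ B₂ ℕ.* q₁)
    combine q₁ B₁ w₁ q₂ B₂ y eq = begin
      ℕtoℚ (w₁ ℕ.* q₂ ℕ.+ B₂ ℕ.* q₁)
        ≡⟨ hom w₁ ⟩
      ℕtoℚ w₁ * ℕtoℚ q₂ + ℕtoℚ B₂ * ℕtoℚ q₁
        ≡⟨ cong (λ t → t * ℕtoℚ q₂ + ℕtoℚ B₂ * ℕtoℚ q₁) eq ⟩
      (ℕtoℚ q₁ * y + ℕtoℚ B₁) * ℕtoℚ q₂ + ℕtoℚ B₂ * ℕtoℚ q₁
        ≡⟨ ((∀ q₁ y B₁ q₂ B₂ → (q₁ * y + B₁) * q₂ + B₂ * q₁ ≡ (q₁ * q₂) * y + (B₁ * q₂ + B₂ * q₁)) ∋ solve-∀ ring)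
             (ℕtoℚ q₁) y (ℕtoℚ B₁) (ℕtoℚ q₂) (ℕtoℚ B₂) ⟩
      (ℕtoℚ q₁ * ℕtoℚ q₂) * y + (ℕtoℚ B₁ * ℕtoℚ q₂ + ℕtoℚ B₂ * ℕtoℚ q₁)
        ≡⟨ sym (cong₂ (λ s t → s * y + t) (ℕtoℚ-* q₁ q₂) (hom B₁)) ⟩
      ℕtoℚ (q₁ ℕ.* q₂) * y + ℕtoℚ (B₁ ℕ.* q₂ ℕ.+ B₂ ℕ.* q₁) ∎
      where
      open ≡-Reasoning
      hom : ∀ w → ℕtoℚ (w ℕ.* q₂ ℕ.+ B₂ ℕ.* q₁) ≡ ℕtoℚ w * ℕtoℚ q₂ + ℕtoℚ B₂ * ℕtoℚ q₁
      hom w = trans (ℕtoℚ-+ (w ℕ.* q₂) _) (cong₂ _+_ (ℕtoℚ-* w q₂) (ℕtoℚ-* B₂ q₁))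

  integral : {A : Set} (xs : List A) (y : A → ℚ) → Integral xs y
  integral []       y = 1 , 0 , ℕ.≤-refl , λ _ ()
  integral (x ∷ xs) y with integral xs y | integral₁ (y x)
  ... | q₁ , B₁ , 1≤q₁ , rest | B₂ , w₂ , eq₂ =
    q₁ ℕ.* q₂ , B₁ ℕ.* q₂ ℕ.+ B₂ ℕ.* q₁ , ℕ.*-mono-≤ 1≤q₁ (ℕ.s≤s ℕ.z≤n) , λ where
      x′ (here refl) → w₂ ℕ.* q₁ ℕ.+ B₁ ℕ.* q₂ ,
        subst₂ (λ Q B → ℕtoℚ (w₂ ℕ.* q₁ ℕ.+ B₁ ℕ.* q₂) ≡ ℕtoℚ Q * y x + ℕtoℚ B)
          (ℕ.*-comm q₂ q₁) (ℕ.+-comm (B₂ ℕ.* q₁) _) (combine q₂ B₂ w₂ q₁ B₁ (y x) eq₂)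
      x′ (there x′∈) → let w , eq = rest x′ x′∈ in w ℕ.* q₂ ℕ.+ B₂ ℕ.* q₁ , combine q₁ B₁ w q₂ B₂ (y x′) eq
    where q₂ = ↧ₙ (y x)

  ∑-affine : {A : Set} (q B : ℕ) (w : A → ℕ) (y : A → ℚ) → (∀ x → ℕtoℚ (w x) ≡ ℕtoℚ q * y x + ℕtoℚ B) →
             ∀ xs → ℕtoℚ (∑ w xs) ≡ ℕtoℚ q * Σℚ y xs + ℕtoℚ (length xs ℕ.* B)
  ∑-affine q B w y eq []       = sym (trans (+-identityʳ _) (*-zeroʳ (ℕtoℚ q)))
  ∑-affine q B w y eq (x ∷ xs) = begin
    ℕtoℚ (w x ℕ.+ ∑ w xs)
      ≡⟨ ℕtoℚ-+ (w x) _ ⟩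
    ℕtoℚ (w x) + ℕtoℚ (∑ w xs)
      ≡⟨ cong₂ _+_ (eq x) (∑-affine q B w y eq xs) ⟩
    (ℕtoℚ q * y x + ℕtoℚ B) + (ℕtoℚ q * Σℚ y xs + ℕtoℚ (length xs ℕ.* B))
      ≡⟨ ((∀ q y B s t → (q * y + B) + (q * s + t) ≡ q * (y + s) + (B + t)) ∋ solve-∀ ring) (ℕtoℚ q) (y x) (ℕtoℚ B) (Σℚ y xs) _ ⟩
    ℕtoℚ q * (y x + Σℚ y xs) + (ℕtoℚ B + ℕtoℚ (length xs ℕ.* B))
      ≡⟨ cong (λ t → ℕtoℚ q * (y x + Σℚ y xs) + t) (sym (ℕtoℚ-+ B _)) ⟩
    ℕtoℚ q * (y x + Σℚ y xs) + ℕtoℚ (B ℕ.+ length xs ℕ.* B) ∎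
    where open ≡-Reasoning

-- Linear programming duality: perfect matchings and minimum covers.

module Duality where
  open import Data.Bool.Base using (if_then_else_)
  open import Data.Empty using (⊥-elim)
  open import Data.Fin.Base using (Fin; zero; suc)
  open import Data.Fin.Properties using () renaming (_≟_ to _≟ᶠ_)
  open import Data.List.Base using (List; allFin; length)
  open import Data.List.Membership.Propositional using (_∈_)
  open import Data.List.Membership.Propositional.Properties using (∈-filter⁺)
  open import Data.Nat.Base as ℕ using (ℕ; suc)
  import Data.Nat.Properties as ℕ
  open import Data.Product.Base using (Σ; _×_; _,_; proj₁; proj₂)
  open import Data.Rational.Base
  open import Data.Rational.Properties
  open import Data.Sum.Base using (inj₁; inj₂)
  open import Data.Vec.Base using (lookup)
  open import Function.Base using (_∋_; _∘_)
  open import Relation.Binary.PropositionalEquality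
  open import Relation.Nullary using (does)
  open import Tactic.RingSolver using (solve-∀)
  open RationalSums
  open Sums
  open Covers
  open Embedding
  open Farkas
  open HostGraph

  -- One dual statement for both conclusions: the inequality refutes the Farkas alternative to a
  -- perfect matching, and its equality case yields the constancy of minimum covers.
  TotalBound : ∀ {r n} → Outcome r n → Set
  TotalBound {r} {n} ω = ∀ (y : Vertex r n → ℚ) → (∀ e → e ∈ edgesOf ω → 0ℚ ≤ edgeWeight y e) →
    0ℚ ≤ Σℚ y (allVertices r n) × (Σℚ y (allVertices r n) ≤ 0ℚ → ConstantOnBlocks y)

  -- For w = qy + B every edge weighs at least T = rB, and the total of w is q ∑ y + nT. Comparing
  -- it with nT therefore decides the sign of ∑ y, and equality makes w, hence y, constant on each
  -- block.
  expansive⇒totalBound : ∀ {r n c m} → Fin r → r ℕ.* r ℕ.< c → m ℕ.< n → m ℕ.* suc c ℕ.≤ n → n ℕ.≤ suc m ℕ.+ c ℕ.* suc m →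
    (ω : Outcome r n) → Expansive c m (_∈ edgesOf ω) → TotalBound ω
  expansive⇒totalBound {r} {n} {c} {m} i₀ r²<c m<n m[c+1]≤n n≤[c+1][m+1] ω expansive y 0≤y = from-integral (integral (allVertices r n) y)
    where
    from-integral : Integral (allVertices r n) y → 0ℚ ≤ Σℚ y (allVertices r n) × (Σℚ y (allVertices r n) ≤ 0ℚ → ConstantOnBlocks y)
    from-integral (q , B , 1≤q , scaled) = 0≤∑y , constant
      where
      instance
        q-positive : Positive (ℕtoℚ q)
        q-positive = ℕtoℚ-positive 1≤q
        q-nonNeg : NonNegative (ℕtoℚ q)
        q-nonNeg = pos⇒nonNeg (ℕtoℚ q)
      w : Vertex r n → ℕ
      w v = proj₁ (scaled v (∈-allVertices v))
      w-eq : ∀ v → ℕtoℚ (w v) ≡ ℕtoℚ q * y v + ℕtoℚ B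
      w-eq v = proj₂ (scaled v (∈-allVertices v))
      W : Fin r → Fin n → ℕ
      W i a = w (i , a)
      T = r ℕ.* B
      cover : ∀ e → e ∈ edgesOf ω → T ℕ.≤ ∑ (λ i → W i (lookup e i)) (allFin r)
      cover e e∈ = ℕtoℚ-cancel-≤ (begin
        ℕtoℚ T                                             ≡⟨ sym (+-identityˡ _) ⟩
        0ℚ + ℕtoℚ T                                        ≤⟨ +-monoˡ-≤ (ℕtoℚ T) 0≤qy ⟩
        ℕtoℚ q * edgeWeight y e + ℕtoℚ T                   ≡⟨ cong (λ l → ℕtoℚ q * edgeWeight y e + ℕtoℚ (l ℕ.* B)) (sym (length-allFin r)) ⟩
        ℕtoℚ q * edgeWeight y e + ℕtoℚ (length (allFin r) ℕ.* B)
          ≡⟨ sym (∑-affine q B (λ i → W i (lookup e i)) (λ i → y (i , lookup e i)) (λ i → w-eq (i , lookup e i)) (allFin r)) ⟩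
        ℕtoℚ (∑ (λ i → W i (lookup e i)) (allFin r))       ∎)
        where
        open ≤-Reasoning
        0≤qy : 0ℚ ≤ ℕtoℚ q * edgeWeight y e
        0≤qy = subst (_≤ ℕtoℚ q * edgeWeight y e) (*-zeroʳ (ℕtoℚ q)) (*-monoˡ-≤-nonNeg (ℕtoℚ q) (0≤y e e∈))
      threshold = thresholds {c = c} i₀ m<n n≤[c+1][m+1] (_∈ edgesOf ω) expansive W T cover
      t : Fin r → ℕ
      t = proj₁ threshold
      bound : n ℕ.* T ℕ.≤ ∑₂ W × (∑₂ W ℕ.≤ n ℕ.* T → ∀ i a → W i a ≡ t i)
      bound = surplus-bound {c = c} i₀ r²<c m[c+1]≤n (_∈ edgesOf ω) expansive W T cover t (proj₁ (proj₂ threshold)) (proj₂ (proj₂ threshold))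
      total : ℕtoℚ (∑₂ W) ≡ ℕtoℚ q * Σℚ y (allVertices r n) + ℕtoℚ (n ℕ.* T)
      total = begin
        ℕtoℚ (∑₂ W)                    ≡⟨ cong ℕtoℚ (sym (∑-allVertices {r} {n} w)) ⟩
        ℕtoℚ (∑ w (allVertices r n))   ≡⟨ ∑-affine q B w y w-eq (allVertices r n) ⟩
        ℕtoℚ q * Σℚ y (allVertices r n) + ℕtoℚ (length (allVertices r n) ℕ.* B)
          ≡⟨ cong (λ l → ℕtoℚ q * Σℚ y (allVertices r n) + ℕtoℚ l) size ⟩
        ℕtoℚ q * Σℚ y (allVertices r n) + ℕtoℚ (n ℕ.* T) ∎
        where
        open ≡-Reasoning
        size : length (allVertices r n) ℕ.* B ≡ n ℕ.* T
        size = begin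
          length (allVertices r n) ℕ.* B                 ≡⟨ sym (∑-const B (allVertices r n)) ⟩
          ∑ (λ _ → B) (allVertices r n)                  ≡⟨ ∑-allVertices {r} {n} (λ _ → B) ⟩
          ∑₂ {r} {n} (λ _ _ → B)                         ≡⟨ ∑₂-const {r} {n} (λ _ → B) ⟩
          n ℕ.* ∑ (λ _ → B) (allFin r)                   ≡⟨ cong (n ℕ.*_) (trans (∑-const B (allFin r)) (cong (ℕ._* B) (length-allFin r))) ⟩
          n ℕ.* T                                        ∎
      0≤∑y : 0ℚ ≤ Σℚ y (allVertices r n)
      0≤∑y = *-cancelˡ-≤-pos (ℕtoℚ q) (subst (_≤ ℕtoℚ q * Σℚ y (allVertices r n)) (sym (*-zeroʳ (ℕtoℚ q)))
        (+-cancelʳ (ℕtoℚ (n ℕ.* T)) (subst₂ _≤_ (sym (+-identityˡ _)) total (ℕtoℚ-mono-≤ (proj₁ bound)))))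
        where
        +-cancelʳ : ∀ t {a b} → a + t ≤ b + t → a ≤ b
        +-cancelʳ t {a} {b} a+t≤b+t = subst₂ _≤_ (cancel a t) (cancel b t) (+-monoˡ-≤ (- t) a+t≤b+t)
          where
          cancel : ∀ a t → (a + t) + - t ≡ a
          cancel = solve-∀ ring
      constant : Σℚ y (allVertices r n) ≤ 0ℚ → ConstantOnBlocks y
      constant ∑y≤0 i a a′ = ≤-antisym (le a a′) (le a′ a)
        where
        light : ∑₂ W ℕ.≤ n ℕ.* T
        light = ℕtoℚ-cancel-≤ (begin
          ℕtoℚ (∑₂ W)                                          ≡⟨ total ⟩
          ℕtoℚ q * Σℚ y (allVertices r n) + ℕtoℚ (n ℕ.* T)     ≤⟨ +-monoˡ-≤ _ (*-monoˡ-≤-nonNeg (ℕtoℚ q) ∑y≤0) ⟩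
          ℕtoℚ q * 0ℚ + ℕtoℚ (n ℕ.* T)                         ≡⟨ cong (_+ ℕtoℚ (n ℕ.* T)) (*-zeroʳ (ℕtoℚ q)) ⟩
          0ℚ + ℕtoℚ (n ℕ.* T)                                  ≡⟨ +-identityˡ _ ⟩
          ℕtoℚ (n ℕ.* T)                                       ∎)
          where open ≤-Reasoning
        scaled-y : ∀ a → ℕtoℚ q * y (i , a) ≡ ℕtoℚ (t i) - ℕtoℚ B
        scaled-y a = trans (((∀ x b → x ≡ (x + b) - b) ∋ solve-∀ ring) (ℕtoℚ q * y (i , a)) (ℕtoℚ B))
          (cong (_- ℕtoℚ B) (trans (sym (w-eq (i , a))) (cong ℕtoℚ (proj₂ bound light i a))))
        le : ∀ a a′ → y (i , a) ≤ y (i , a′)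
        le a a′ = *-cancelˡ-≤-pos (ℕtoℚ q) (≤-reflexive (trans (scaled-y a) (sym (scaled-y a′))))

  private
    incidence : ∀ {r n} → Edge r n → Vertex r n → ℚ
    incidence e v = if does (v ∈ₑ? e) then 1ℚ else 0ℚ

    Σℚ-point : ∀ {n} (f : Fin n → ℚ) b → Σℚ (λ a → f a * (if does (b ≟ᶠ a) then 1ℚ else 0ℚ)) (allFin n) ≡ f b
    Σℚ-point {suc n} f zero = begin
      Σℚ (λ a → f a * (if does (zero ≟ᶠ a) then 1ℚ else 0ℚ)) (allFin (suc n))
        ≡⟨ Σℚ-allFin-suc {n} (λ a → f a * (if does (zero ≟ᶠ a) then 1ℚ else 0ℚ)) ⟩
      f zero * 1ℚ + Σℚ (λ a → f (suc a) * 0ℚ) (allFin n)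
        ≡⟨ cong₂ _+_ (*-identityʳ (f zero)) (trans (Σℚ-cong (λ a → *-zeroʳ (f (suc a))) (allFin n)) (Σℚ-0 (allFin n))) ⟩
      f zero + 0ℚ
        ≡⟨ +-identityʳ _ ⟩
      f zero ∎
      where open ≡-Reasoning
    Σℚ-point {suc n} f (suc b) = begin
      Σℚ (λ a → f a * (if does (suc b ≟ᶠ a) then 1ℚ else 0ℚ)) (allFin (suc n))
        ≡⟨ Σℚ-allFin-suc {n} (λ a → f a * (if does (suc b ≟ᶠ a) then 1ℚ else 0ℚ)) ⟩
      f zero * 0ℚ + Σℚ (λ a → f (suc a) * (if does (b ≟ᶠ a) then 1ℚ else 0ℚ)) (allFin n)
        ≡⟨ cong₂ _+_ (*-zeroʳ (f zero)) (Σℚ-point (f ∘ suc) b) ⟩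
      0ℚ + f (suc b)
        ≡⟨ +-identityˡ _ ⟩
      f (suc b) ∎
      where open ≡-Reasoning

    dot-incidence : ∀ {r n} (y : Vertex r n → ℚ) e → dot (allVertices r n) y (incidence e) ≡ edgeWeight y e
    dot-incidence {r} {n} y e = trans (Σℚ-allVertices (λ v → y v * incidence e v))
      (Σℚ-cong (λ i → Σℚ-point (λ a → y (i , a)) (lookup e i)) (allFin r))

  -- A perfect fractional matching writes the all-ones vector as a conic combination of incidence
  -- vectors. A separating y would have nonnegative edge sums and a negative total.
  perfect-matching : ∀ {r n} (ω : Outcome (suc r) n) → TotalBound ω →
                     Σ (Edge (suc r) n → ℚ) (IsPerfectFractionalMatching ω)
  perfect-matching {r} {n} ω bound with farkas (allVertices (suc r) n) edge-≟ (edgesOf-unique ω) incidence (λ _ → 1ℚ)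
  ... | inj₂ (y , 0≤y , y<0) = ⊥-elim (<-irrefl refl (<-≤-trans y<0 (subst (0ℚ ≤_) (sym total)
          (proj₁ (bound y λ e e∈ → subst (0ℚ ≤_) (dot-incidence y e) (0≤y e e∈))))))
    where
    total : dot (allVertices (suc r) n) y (λ _ → 1ℚ) ≡ Σℚ y (allVertices (suc r) n)
    total = Σℚ-cong (λ v → *-identityʳ (y v)) (allVertices (suc r) n)
  ... | inj₁ (φ , 0≤φ , φ-comb) = φ , ((λ e e∈ → 0≤φ e , φ≤1 e e∈) , (λ v → ≤-reflexive (star-sum v))) , star-sum
    where
    star-sum : ∀ v → Σℚ φ (star ω v) ≡ 1ℚ
    star-sum v = trans (Σℚ-filter φ (v ∈ₑ?_) (edgesOf ω)) (φ-comb v (∈-allVertices v))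
    -- Each edge belongs to the star of its vertex in the first block, where nonnegative values add
    -- up to 1.
    φ≤1 : ∀ e → e ∈ edgesOf ω → φ e ≤ 1ℚ
    φ≤1 e e∈ = subst (φ e ≤_) (star-sum (zero , lookup e zero)) (Σℚ-≥-∈ 0≤φ (∈-filter⁺ ((zero , lookup e zero) ∈ₑ?_) e∈ refl))

  -- Any minimum cover w is compared with the indicator of the first block, a cover in which every edge has weight 1.
  min-cover-constant : ∀ {r n} (ω : Outcome (suc r) n) → TotalBound ω →
                       ∀ w → IsMinFractionalCover ω w → ConstantOnBlocks w
  min-cover-constant {r} {n} ω bound w ((_ , w-covers) , w-min) i a a′ =
    transfer (proj₂ (bound y 0≤y) ∑y≤0 i a a′)
    where
    b : Vertex (suc r) n → ℚ
    b (zero  , _) = 1ℚ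
    b (suc _ , _) = 0ℚ
    b-edge : ∀ e → edgeWeight b e ≡ 1ℚ
    b-edge e = trans (Σℚ-allFin-suc {r} (λ i → b (i , lookup e i))) (trans (cong (1ℚ +_) (Σℚ-0 (allFin r))) (+-identityʳ 1ℚ))
    b-bounds : ∀ v → 0ℚ ≤ b v × b v ≤ 1ℚ
    b-bounds (zero  , _) = <⇒≤ (positive⁻¹ 1ℚ) , ≤-refl
    b-bounds (suc _ , _) = ≤-refl , <⇒≤ (positive⁻¹ 1ℚ)
    b-cover : IsFractionalCover ω b
    b-cover = b-bounds , λ e _ → ≤-reflexive (sym (b-edge e))
    y : Vertex (suc r) n → ℚ
    y v = w v + - 1ℚ * b v
    Σℚ-y : ∀ {A : Set} (v : A → Vertex (suc r) n) xs → Σℚ (λ x → y (v x)) xs ≡ Σℚ (λ x → w (v x)) xs - Σℚ (λ x → b (v x)) xs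
    Σℚ-y v xs = begin
      Σℚ (λ x → w (v x) + - 1ℚ * b (v x)) xs                      ≡⟨ Σℚ-distrib-+ (w ∘ v) (λ x → - 1ℚ * b (v x)) xs ⟩
      Σℚ (w ∘ v) xs + Σℚ (λ x → - 1ℚ * b (v x)) xs                ≡⟨ cong (λ t → Σℚ (w ∘ v) xs + t) (sym (*-distribˡ-Σℚ (- 1ℚ) (b ∘ v) xs)) ⟩
      Σℚ (w ∘ v) xs + - 1ℚ * Σℚ (b ∘ v) xs                        ≡⟨ ((∀ s t → s + - 1ℚ * t ≡ s - t) ∋ solve-∀ ring) (Σℚ (w ∘ v) xs) (Σℚ (b ∘ v) xs) ⟩
      Σℚ (w ∘ v) xs - Σℚ (b ∘ v) xs                               ∎
      where open ≡-Reasoning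
    difference : ∀ {s t} → s ≤ t → s - t ≤ 0ℚ
    difference {s} {t} s≤t = subst (s - t ≤_) (+-inverseʳ t) (+-monoˡ-≤ (- t) s≤t)
    0≤y : ∀ e → e ∈ edgesOf ω → 0ℚ ≤ edgeWeight y e
    0≤y e e∈ = subst₂ _≤_ (+-inverseʳ 1ℚ)
      (trans (cong (λ t → edgeWeight w e - t) (sym (b-edge e))) (sym (Σℚ-y (λ i → i , lookup e i) (allFin (suc r)))))
      (+-monoˡ-≤ (- 1ℚ) (w-covers e e∈))
    ∑y≤0 : Σℚ y (allVertices (suc r) n) ≤ 0ℚ
    ∑y≤0 = subst (_≤ 0ℚ) (sym (Σℚ-y (λ v → v) (allVertices (suc r) n))) (difference (w-min b b-cover))
    b-constant : ∀ i → b (i , a) ≡ b (i , a′)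
    b-constant zero    = refl
    b-constant (suc _) = refl
    transfer : y (i , a) ≡ y (i , a′) → w (i , a) ≡ w (i , a′)
    transfer eq = begin
      w (i , a)                               ≡⟨ restore (w (i , a)) (b (i , a)) ⟩
      y (i , a) + b (i , a)                   ≡⟨ cong₂ _+_ eq (b-constant i) ⟩
      y (i , a′) + b (i , a′)                 ≡⟨ sym (restore (w (i , a′)) (b (i , a′))) ⟩
      w (i , a′)                              ∎
      where
      open ≡-Reasoning
      restore : ∀ s t → s ≡ (s + - 1ℚ * t) + t
      restore = solve-∀ ring

-- Counting random choices, and enumeration of k-subsets.

module Counting where
  open import Data.Bool.Base using (Bool; true; false; _∧_)
  open import Data.Bool.ListAction using (all)
  open import Data.Empty using (⊥-elim)
  open import Data.Fin.Base using (Fin; zero; suc)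
  open import Data.Fin.Properties using () renaming (_≟_ to _≟ᶠ_)
  open import Data.List.Base using (List; []; _∷_; [_]; _++_; map; allFin; length; cartesianProductWith)
  open import Data.List.Properties using (length-++; length-map)
  open import Data.List.Membership.Propositional using (_∈_)
  open import Data.List.Membership.Propositional.Properties
    using (∈-allFin; ∈-map⁺; ∈-map⁻; ∈-++⁺ˡ; ∈-++⁺ʳ; ∈-++⁻; ∈-cartesianProductWith⁺; ∈-cartesianProductWith⁻; ∈-filter⁺)
  open import Data.List.Relation.Unary.Any using (here)
  open import Data.Nat.Base
  open import Data.Nat.Properties
  open import Data.Nat.Combinatorics using (_C_; nCk+nC[k+1]≡[n+1]C[k+1])
  open import Data.Product.Base using (Σ; _×_; _,_)
  open import Data.Sum.Base using (inj₁; inj₂)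
  open import Data.Vec.Base as Vec using (Vec; []; _∷_; lookup; tabulate)
  open import Function.Base using (_∘_; const)
  open import Relation.Binary.PropositionalEquality hiding ([_])
  open import Relation.Nullary using (yes; no)
  open Sums
  open Estimates

  -- Pascal's rule at each head: subsets through a head that fails `p` contribute nothing, and a
  -- head that satisfies it joins the pool.
  count-all-subsets : {A : Set} (p : A → Bool) → ∀ k xs → count (all p) (subsets k xs) ≡ count p xs C k
  count-all-subsets p zero    xs       = refl
  count-all-subsets p (suc k) []       = refl
  count-all-subsets p (suc k) (x ∷ xs) = begin
    count (all p) (map (x ∷_) (subsets k xs) ++ subsets (suc k) xs)
      ≡⟨ ∑-++ (𝟙 ∘ all p) (map (x ∷_) (subsets k xs)) _ ⟩
    count (all p) (map (x ∷_) (subsets k xs)) + count (all p) (subsets (suc k) xs)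
      ≡⟨ cong₂ _+_ (∑-map (𝟙 ∘ all p) (x ∷_) (subsets k xs)) (count-all-subsets p (suc k) xs) ⟩
    count (λ l → p x ∧ all p l) (subsets k xs) + (count p xs C suc k)
      ≡⟨ by-head (p x) ⟩
    (𝟙 (p x) + count p xs) C suc k ∎
    where
    open ≡-Reasoning
    by-head : ∀ b → count (λ l → b ∧ all p l) (subsets k xs) + (count p xs C suc k) ≡ (𝟙 b + count p xs) C suc k
    by-head true  = trans (cong (_+ (count p xs C suc k)) (count-all-subsets p k xs)) (nCk+nC[k+1]≡[n+1]C[k+1] (count p xs) k)
    by-head false = cong (_+ (count p xs C suc k)) (trans (∑-const 0 (subsets k xs)) (*-zeroʳ (length (subsets k xs))))

  all-true : {A : Set} (xs : List A) → all (const true) xs ≡ true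
  all-true []       = refl
  all-true (x ∷ xs) = all-true xs

  length-subsets : {A : Set} → ∀ k (xs : List A) → length (subsets k xs) ≡ length xs C k
  length-subsets k xs = begin
    length (subsets k xs)                         ≡⟨ sym (count-true (subsets k xs)) ⟩
    count (const true) (subsets k xs)             ≡⟨ count-cong (λ l → sym (all-true l)) (subsets k xs) ⟩
    count (all (const true)) (subsets k xs)       ≡⟨ count-all-subsets (const true) k xs ⟩
    count (const true) xs C k                     ≡⟨ cong (_C k) (count-true xs) ⟩
    length xs C k                                 ∎
    where open ≡-Reasoning

  all⇒count : {A : Set} (p : A → Bool) → ∀ xs → all p xs ≡ true → count p xs ≡ length xs
  all⇒count p []       _  = refl
  all⇒count p (x ∷ xs) eq with p x
  ... | true = cong suc (all⇒count p xs eq)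

  -- Drawing k edges with replacement would satisfy `p` throughout with the k-th power of its
  -- proportion in the star; drawing without replacement does so at most as often.
  choices-bound : ∀ {r n} k (v : Vertex r n) (p : Edge r n → Bool) →
    count (all p) (choices k v) * length (hostStar v) ^ k ≤ count p (hostStar v) ^ k * length (choices k v)
  choices-bound k v p with length (hostStar v) <? k
  ... | no  _ = begin
    count (all p) (subsets k Hᵥ) * length Hᵥ ^ k    ≡⟨ cong (_* length Hᵥ ^ k) (count-all-subsets p k Hᵥ) ⟩
    (count p Hᵥ C k) * length Hᵥ ^ k                ≤⟨ mCk*N^k≤m^k*NCk (count≤length p Hᵥ) k ⟩
    count p Hᵥ ^ k * (length Hᵥ C k)                ≡⟨ cong (count p Hᵥ ^ k *_) (sym (length-subsets k Hᵥ)) ⟩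
    count p Hᵥ ^ k * length (subsets k Hᵥ)          ∎
    where
    open ≤-Reasoning
    Hᵥ = hostStar v
  -- A star with fewer than k edges is taken whole: the count is 0 if some edge fails `p`, and
  -- otherwise both sides agree.
  ... | yes _ with all p (hostStar v) in eq
  ...   | false = z≤n
  ...   | true  = ≤-reflexive (trans (cong (λ t → 1 * t ^ k) (sym (all⇒count p (hostStar v) eq))) (*-comm 1 _))

  -- Independence of the choices at different vertices.
  count-cartesian : {A : Set} (Q : A → Bool) → ∀ xss → count (all Q) (cartesian xss) ≡ ∏ (count Q) xss
  count-cartesian Q []         = refl
  count-cartesian Q (xs ∷ xss) = begin
    count (all Q) (cartesian (xs ∷ xss))
      ≡⟨ ∑-concatMap (𝟙 ∘ all Q) (λ x → map (x ∷_) (cartesian xss)) xs ⟩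
    ∑ (λ x → count (all Q) (map (x ∷_) (cartesian xss))) xs
      ≡⟨ ∑-cong (λ x → ∑-map (𝟙 ∘ all Q) (x ∷_) (cartesian xss)) xs ⟩
    ∑ (λ x → count (λ ω → Q x ∧ all Q ω) (cartesian xss)) xs
      ≡⟨ ∑-cong (λ x → by-head (Q x)) xs ⟩
    ∑ (λ x → 𝟙 (Q x) * count (all Q) (cartesian xss)) xs
      ≡⟨ sym (*-distribʳ-∑ _ (𝟙 ∘ Q) xs) ⟩
    count Q xs * count (all Q) (cartesian xss)
      ≡⟨ cong (count Q xs *_) (count-cartesian Q xss) ⟩
    count Q xs * ∏ (count Q) xss ∎
    where
    open ≡-Reasoning
    by-head : ∀ b → count (λ ω → b ∧ all Q ω) (cartesian xss) ≡ 𝟙 b * count (all Q) (cartesian xss)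
    by-head true  = sym (*-identityˡ _)
    by-head false = trans (∑-const 0 (cartesian xss)) (*-zeroʳ (length (cartesian xss)))

  length-cartesian : {A : Set} (xss : List (List A)) → length (cartesian xss) ≡ ∏ length xss
  length-cartesian xss = begin
    length (cartesian xss)                       ≡⟨ sym (count-true (cartesian xss)) ⟩
    count (const true) (cartesian xss)           ≡⟨ count-cong (λ ω → sym (all-true ω)) (cartesian xss) ⟩
    count (all (const true)) (cartesian xss)     ≡⟨ count-cartesian (const true) xss ⟩
    ∏ (count (const true)) xss                   ≡⟨ ∏-cong count-true xss ⟩
    ∏ length xss                                 ∎
    where open ≡-Reasoning

  vecs : {A : Set} → ∀ r → List A → List (Vec A r)
  vecs zero    xs = [ [] ]
  vecs (suc r) xs = cartesianProductWith _∷_ xs (vecs r xs)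

  length-vecs : {A : Set} → ∀ r (xs : List A) → length (vecs r xs) ≡ length xs ^ r
  length-vecs zero    xs = refl
  length-vecs (suc r) xs = trans (length-product xs (vecs r xs)) (cong (length xs *_) (length-vecs r xs))
    where
    length-product : ∀ {A B C : Set} {f : A → B → C} xs ys → length (cartesianProductWith f xs ys) ≡ length xs * length ys
    length-product         []       ys = refl
    length-product {f = f} (x ∷ xs) ys =
      trans (length-++ (map (f x) ys)) (cong₂ _+_ (length-map (f x) ys) (length-product xs ys))

  ∈-vecs⁺ : {A : Set} → ∀ {r} {xs : List A} (v : Vec A r) → (∀ j → lookup v j ∈ xs) → v ∈ vecs r xs
  ∈-vecs⁺ []      _   = here refl
  ∈-vecs⁺ (x ∷ v) mem = ∈-cartesianProductWith⁺ _∷_ (mem zero) (∈-vecs⁺ v (mem ∘ suc))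

  ∈-vecs⁻ : {A : Set} → ∀ {r} {xs : List A} {v : Vec A r} → v ∈ vecs r xs → ∀ j → lookup v j ∈ xs
  ∈-vecs⁻ {r = suc r} {xs} v∈ j with ∈-cartesianProductWith⁻ _∷_ xs (vecs r xs) v∈ | j
  ... | _ , _ , x∈ , _ , refl  | zero  = x∈
  ... | _ , _ , _ , v′∈ , refl | suc j = ∈-vecs⁻ v′∈ j

  -- Sets as characteristic vectors, so that an arbitrary predicate is located in the list through
  -- `tabulate`.
  kSubsets : ∀ n → ℕ → List (Vec Bool n)
  kSubsets zero    zero    = [ [] ]
  kSubsets zero    (suc k) = []
  kSubsets (suc n) zero    = map (false ∷_) (kSubsets n zero)
  kSubsets (suc n) (suc k) = map (true ∷_) (kSubsets n k) ++ map (false ∷_) (kSubsets n (suc k))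

  length-kSubsets : ∀ n k → length (kSubsets n k) ≡ n C k
  length-kSubsets zero    zero    = refl
  length-kSubsets zero    (suc k) = refl
  length-kSubsets (suc n) zero    = trans (length-map (false ∷_) (kSubsets n zero)) (length-kSubsets n zero)
  length-kSubsets (suc n) (suc k) = begin
    length (map (true ∷_) (kSubsets n k) ++ map (false ∷_) (kSubsets n (suc k)))
      ≡⟨ length-++ (map (true ∷_) (kSubsets n k)) ⟩
    length (map (true ∷_) (kSubsets n k)) + length (map (false ∷_) (kSubsets n (suc k)))
      ≡⟨ cong₂ _+_ (trans (length-map (true ∷_) (kSubsets n k)) (length-kSubsets n k))
                   (trans (length-map (false ∷_) (kSubsets n (suc k))) (length-kSubsets n (suc k))) ⟩
    (n C k) + (n C suc k)
      ≡⟨ nCk+nC[k+1]≡[n+1]C[k+1] n k ⟩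
    suc n C suc k ∎
    where open ≡-Reasoning

  count-kSubset : ∀ n k {p} → p ∈ kSubsets n k → count (lookup p) (allFin n) ≡ k
  count-kSubset zero    zero    _  = refl
  count-kSubset (suc n) zero    p∈ with ∈-map⁻ (false ∷_) p∈
  ... | p , p∈′ , refl = trans (∑-allFin-suc {n} (𝟙 ∘ lookup (false ∷ p))) (count-kSubset n zero p∈′)
  count-kSubset (suc n) (suc k) p∈ with ∈-++⁻ (map (true ∷_) (kSubsets n k)) p∈
  ... | inj₁ p∈ˡ with ∈-map⁻ (true ∷_) p∈ˡ
  ...   | p , p∈′ , refl = trans (∑-allFin-suc {n} (𝟙 ∘ lookup (true ∷ p))) (cong suc (count-kSubset n k p∈′))
  count-kSubset (suc n) (suc k) p∈ | inj₂ p∈ʳ with ∈-map⁻ (false ∷_) p∈ʳ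
  ...   | p , p∈′ , refl = trans (∑-allFin-suc {n} (𝟙 ∘ lookup (false ∷ p))) (count-kSubset n (suc k) p∈′)

  private
    false∷-∈ : ∀ n k {p} → p ∈ kSubsets n k → (false ∷ p) ∈ kSubsets (suc n) k
    false∷-∈ n zero    p∈ = ∈-map⁺ (false ∷_) p∈
    false∷-∈ n (suc k) p∈ = ∈-++⁺ʳ (map (true ∷_) (kSubsets n k)) (∈-map⁺ (false ∷_) p∈)

  tabulate-∈-kSubsets : ∀ {n} (X : Fin n → Bool) → tabulate X ∈ kSubsets n (count X (allFin n))
  tabulate-∈-kSubsets {zero}  X = here refl
  tabulate-∈-kSubsets {suc n} X = subst (λ k → tabulate X ∈ kSubsets (suc n) k) (sym (∑-allFin-suc {n} (𝟙 ∘ X)))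
    (by-head (X zero) (tabulate-∈-kSubsets (X ∘ suc)))
    where
    by-head : ∀ b {p k} → p ∈ kSubsets n k → (b ∷ p) ∈ kSubsets (suc n) (𝟙 b + k)
    by-head true  p∈ = ∈-++⁺ˡ (∈-map⁺ (true ∷_) p∈)
    by-head false p∈ = false∷-∈ n _ p∈

  -- Padding lets the union bound range over sets of one exact size. A head outside Z is left out as
  -- long as the tail has room for z elements.
  superset : ∀ {n} z (Z : Fin n → Bool) → count Z (allFin n) ≤ z → z ≤ n →
             Σ (Vec Bool n) λ p → p ∈ kSubsets n z × (∀ a → Z a ≡ true → lookup p a ≡ true)
  superset {zero}  zero    Z _  _   = [] , here refl , λ ()
  superset {suc n} z       Z Z≤z le with Z zero in Z₀ | ≤-trans (≤-reflexive (sym (∑-allFin-suc {n} (𝟙 ∘ Z)))) Z≤z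
  superset {suc n} (suc z) Z Z≤z (s≤s le) | true | s≤s rest≤z with superset z (Z ∘ suc) rest≤z le
  ... | p , p∈ , Z⊆p = true ∷ p , ∈-++⁺ˡ (∈-map⁺ (true ∷_) p∈) , λ { zero _ → refl ; (suc a) → Z⊆p a }
  superset {suc n} z       Z Z≤z le | false | rest≤z with z ≤? n
  ... | yes le′ with superset z (Z ∘ suc) rest≤z le′
  ...   | p , p∈ , Z⊆p = false ∷ p , false∷-∈ n z p∈ , λ { zero Z₀′ → trans (sym Z₀) Z₀′ ; (suc a) → Z⊆p a }
  superset {suc n} zero    Z Z≤z le | false | rest≤z | no z≰n = ⊥-elim (z≰n z≤n)
  -- The size exceeds the n elements of the tail, so the head serves as padding and the whole tail
  -- follows.
  superset {suc n} (suc z) Z Z≤z (s≤s le) | false | rest≤z | no z≰n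
    with superset z (Z ∘ suc) (≤-trans (≤-trans (count≤length (Z ∘ suc) (allFin n)) (≤-reflexive (length-allFin n))) (s≤s⁻¹ (≰⇒> z≰n))) le
  ...   | p , p∈ , Z⊆p = true ∷ p , ∈-++⁺ˡ (∈-map⁺ (true ∷_) p∈) , λ { zero _ → refl ; (suc a) → Z⊆p a }

-- The probability that a random outcome misses a box.

module Boxes where
  open import Data.Bool.Base using (Bool; true; false; not; _∧_; if_then_else_)
  open import Data.Bool.ListAction using (all)
  open import Data.Fin.Base using (Fin; zero; suc)
  open import Data.Fin.Properties using () renaming (_≟_ to _≟ᶠ_)
  open import Data.List.Base using (List; []; _∷_; map; allFin; length)
  open import Data.List.Membership.Propositional using (_∈_)
  open import Data.List.Membership.Propositional.Properties using (∈-filter⁺)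
  open import Data.List.Relation.Unary.Any using (here; there)
  open import Data.Nat.Base
  open import Data.Nat.Properties
  open import Data.Nat.Tactic.RingSolver using (solve-∀)
  open import Data.Product.Base using (_,_)
  open import Data.Vec.Base using (Vec; []; _∷_; lookup; replicate)
  open import Data.Vec.Properties using (lookup-replicate)
  open import Function.Base using (_∘_; _∋_; const)
  open import Relation.Binary.PropositionalEquality
  open import Relation.Nullary using (does; yes; no)
  open Sums
  open Estimates
  open HostGraph
  open Counting

  inside : ∀ {r n} → (Fin r → Fin n → Bool) → Edge r n → Bool
  inside P []      = true
  inside P (a ∷ e) = P zero a ∧ inside (P ∘ suc) e

  inside⇒ : ∀ {r n} (P : Fin r → Fin n → Bool) e → inside P e ≡ true → ∀ j → P j (lookup e j) ≡ true
  inside⇒ P (a ∷ e) eq j with P zero a in eq₀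
  inside⇒ P (a ∷ e) eq zero    | true = eq₀
  inside⇒ P (a ∷ e) eq (suc j) | true = inside⇒ (P ∘ suc) e eq j

  inside-true : ∀ {r n} (e : Edge r n) → inside (λ _ _ → true) e ≡ true
  inside-true []      = refl
  inside-true (a ∷ e) = inside-true e

  inside-∧ : ∀ {r n} (P Q : Fin r → Fin n → Bool) e → inside P e ∧ inside Q e ≡ inside (λ j a → P j a ∧ Q j a) e
  inside-∧ P Q []      = refl
  inside-∧ P Q (a ∷ e) with P zero a | Q zero a
  ... | true  | true  = inside-∧ (P ∘ suc) (Q ∘ suc) e
  ... | true  | false = ∧-false (inside (P ∘ suc) e)
    where
    ∧-false : ∀ b → b ∧ false ≡ false
    ∧-false true  = refl
    ∧-false false = refl
  ... | false | _     = refl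

  count-inside : ∀ {r n} (P : Fin r → Fin n → Bool) →
                 count (inside P) (allEdges r n) ≡ ∏ (λ j → count (P j) (allFin n)) (allFin r)
  count-inside {zero}      P = refl
  count-inside {suc r} {n} P = begin
    count (inside P) (allEdges (suc r) n)
      ≡⟨ ∑-concatMap (𝟙 ∘ inside P) (λ a → map (a ∷_) (allEdges r n)) (allFin n) ⟩
    ∑ (λ a → count (inside P) (map (a ∷_) (allEdges r n))) (allFin n)
      ≡⟨ ∑-cong (λ a → trans (∑-map (𝟙 ∘ inside P) (a ∷_) (allEdges r n)) (by-head (P zero a))) (allFin n) ⟩
    ∑ (λ a → 𝟙 (P zero a) * count (inside (P ∘ suc)) (allEdges r n)) (allFin n)
      ≡⟨ sym (*-distribʳ-∑ (count (inside (P ∘ suc)) (allEdges r n)) (𝟙 ∘ P zero) (allFin n)) ⟩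
    count (P zero) (allFin n) * count (inside (P ∘ suc)) (allEdges r n)
      ≡⟨ cong (count (P zero) (allFin n) *_) (count-inside (P ∘ suc)) ⟩
    count (P zero) (allFin n) * ∏ (λ j → count (P (suc j)) (allFin n)) (allFin r)
      ≡⟨ sym (∏-allFin-suc {r} (λ j → count (P j) (allFin n))) ⟩
    ∏ (λ j → count (P j) (allFin n)) (allFin (suc r)) ∎
    where
    open ≡-Reasoning
    by-head : ∀ b → count (λ e → b ∧ inside (P ∘ suc) e) (allEdges r n) ≡ 𝟙 b * count (inside (P ∘ suc)) (allEdges r n)
    by-head true  = sym (*-identityˡ _)
    by-head false = trans (∑-const 0 (allEdges r n)) (*-zeroʳ (length (allEdges r n)))

  side : ∀ {r n} → Fin r → Vec Bool n → Vec (Vec Bool n) r → Fin r → Fin n → Bool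
  side i X Zs j a = if does (j ≟ᶠ i) then lookup X a else not (lookup (lookup Zs j) a)

  -- The i-th entry of Zs is ignored.
  inBox : ∀ {r n} → Fin r → Vec Bool n → Vec (Vec Bool n) r → Edge r n → Bool
  inBox i X Zs = inside (side i X Zs)

  private
    -- The star of a vertex is itself a box; its intersection with another box is again one, and
    -- `count-inside` factors its size.
    pin : ∀ {r n} → Fin r → Fin n → Fin r → Fin n → Bool
    pin i a j b = if does (j ≟ᶠ i) then does (b ≟ᶠ a) else true

    ∈ₑ-inside : ∀ {r n} i (a : Fin n) (e : Edge r n) → does ((i , a) ∈ₑ? e) ≡ inside (pin i a) e
    ∈ₑ-inside zero    a (b ∷ e) with does (b ≟ᶠ a)
    ... | true  = sym (inside-true e)
    ... | false = refl
    ∈ₑ-inside (suc i) a (b ∷ e) = ∈ₑ-inside i a e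

    count-hostStar : ∀ {r n} i (a : Fin n) (P : Fin r → Fin n → Bool) →
      count (inside P) (hostStar (i , a)) ≡ ∏ (λ j → count (λ b → pin i a j b ∧ P j b) (allFin n)) (allFin r)
    count-hostStar {r} {n} i a P = begin
      count (inside P) (hostStar (i , a))
        ≡⟨ count-filter (inside P) ((i , a) ∈ₑ?_) (allEdges r n) ⟩
      count (λ e → does ((i , a) ∈ₑ? e) ∧ inside P e) (allEdges r n)
        ≡⟨ count-cong (λ e → trans (cong (_∧ inside P e) (∈ₑ-inside i a e)) (inside-∧ (pin i a) P e)) (allEdges r n) ⟩
      count (inside (λ j b → pin i a j b ∧ P j b)) (allEdges r n)
        ≡⟨ count-inside (λ j b → pin i a j b ∧ P j b) ⟩
      ∏ (λ j → count (λ b → pin i a j b ∧ P j b) (allFin n)) (allFin r) ∎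
      where open ≡-Reasoning

  -- Star and box are compared coordinate by coordinate: outside block i a proportion (n-z)/n of the
  -- vertices avoids Z_j.
  box-fraction : ∀ {r n} i X (Zs : Vec (Vec Bool n) r) z → (∀ j → count (lookup (lookup Zs j)) (allFin n) ≡ z) →
    ∀ a → lookup X a ≡ true →
    length (hostStar (i , a)) * (n ∸ z) ^ r ≤ count (inBox i X Zs) (hostStar (i , a)) * n ^ r
  box-fraction {r} {n} i X Zs z ∣Z∣≡z a a∈X = begin
    length (hostStar (i , a)) * (n ∸ z) ^ r
      ≡⟨ cong₂ _*_ size (powers (n ∸ z)) ⟩
    ∏ (λ j → count (λ b → pin i a j b ∧ true) vs) is * ∏ (const (n ∸ z)) is
      ≡⟨ sym (∏-distrib-* (λ j → count (λ b → pin i a j b ∧ true) vs) (const (n ∸ z)) is) ⟩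
    ∏ (λ j → count (λ b → pin i a j b ∧ true) vs * (n ∸ z)) is
      ≤⟨ ∏-mono factor is ⟩
    ∏ (λ j → count (λ b → pin i a j b ∧ side i X Zs j b) vs * n) is
      ≡⟨ ∏-distrib-* (λ j → count (λ b → pin i a j b ∧ side i X Zs j b) vs) (const n) is ⟩
    ∏ (λ j → count (λ b → pin i a j b ∧ side i X Zs j b) vs) is * ∏ (const n) is
      ≡⟨ sym (cong₂ _*_ (count-hostStar i a (side i X Zs)) (powers n)) ⟩
    count (inBox i X Zs) (hostStar (i , a)) * n ^ r ∎
    where
    open ≤-Reasoning
    vs = allFin n
    is = allFin r
    powers : ∀ b → b ^ r ≡ ∏ (const b) is
    powers b = trans (cong (b ^_) (sym (length-allFin r))) (sym (∏-const b is))
    size : length (hostStar (i , a)) ≡ ∏ (λ j → count (λ b → pin i a j b ∧ true) vs) is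
    size = trans (sym (count-true (hostStar (i , a))))
      (trans (count-cong (λ e → sym (inside-true e)) (hostStar (i , a))) (count-hostStar i a (λ _ _ → true)))
    factor : ∀ j → count (λ b → pin i a j b ∧ true) vs * (n ∸ z) ≤ count (λ b → pin i a j b ∧ side i X Zs j b) vs * n
    factor j with does (j ≟ᶠ i)
    -- In block i only a is possible, and it lies in X. The factor (n-z)/n is given away here to
    -- keep the exponent r.
    ... | true  = *-mono-≤ (count-mono at-a vs) (m∸n≤m n z)
      where
      at-a : ∀ b → does (b ≟ᶠ a) ∧ true ≡ true → does (b ≟ᶠ a) ∧ lookup X b ≡ true
      at-a b _ with b ≟ᶠ a
      ... | yes refl = a∈X
    ... | false = begin
      count (const true) vs * (n ∸ z)                     ≡⟨ cong (_* (n ∸ z)) (trans (count-true vs) (length-allFin n)) ⟩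
      n * (n ∸ z)                                         ≡⟨ *-comm n _ ⟩
      (n ∸ z) * n                                         ≡⟨ cong (_* n) (sym outside) ⟩
      count (λ b → not (lookup (lookup Zs j) b)) vs * n   ∎
      where
      outside : count (not ∘ lookup (lookup Zs j)) vs ≡ n ∸ z
      outside = begin-equality
        count (not ∘ lookup (lookup Zs j)) vs
          ≡⟨ sym (m+n∸m≡n z _) ⟩
        z + count (not ∘ lookup (lookup Zs j)) vs ∸ z
          ≡⟨ cong (λ t → t + count (not ∘ lookup (lookup Zs j)) vs ∸ z) (sym (∣Z∣≡z j)) ⟩
        count (lookup (lookup Zs j)) vs + count (not ∘ lookup (lookup Zs j)) vs ∸ z
          ≡⟨ cong (_∸ z) (trans (count-not (lookup (lookup Zs j)) vs) (length-allFin n)) ⟩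
        n ∸ z ∎

  hostStar-nonempty : ∀ {r n} i (a : Fin n) → NonZero (length (hostStar {r} (i , a)))
  hostStar-nonempty {r} i a = nonempty (∈-filter⁺ ((i , a) ∈ₑ?_) (∈-allEdges (replicate r a)) (lookup-replicate i a))
    where
    nonempty : ∀ {A : Set} {x : A} {xs} → x ∈ xs → NonZero (length xs)
    nonempty (here _)  = _
    nonempty (there _) = _

  -- The k = (M+1)(K+1) choices form K + 1 groups: M + 1 choices bring the probability of missing
  -- below z/n, and the groups multiply.
  choice-miss : ∀ {r n} M K z → z ≤ n → 1 ≤ n → (n ^ r ∸ (n ∸ z) ^ r) ^ suc M * n ≤ z * (n ^ r) ^ suc M →
    ∀ i X (Zs : Vec (Vec Bool n) r) → (∀ j → count (lookup (lookup Zs j)) (allFin n) ≡ z) → ∀ a → lookup X a ≡ true →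
    count (all (not ∘ inBox i X Zs)) (choices (suc M * suc K) (i , a)) * n ^ suc K
      ≤ length (choices (suc M * suc K) (i , a)) * z ^ suc K
  choice-miss {r} {n} M K z z≤n′ 1≤n miss i X Zs ∣Z∣≡z a a∈X = *-cancelʳ-≤ _ _ (N ^ k) {{m^n≢0 N k {{N≢0}}}} (begin
    cnt * n ^ suc K * N ^ k           ≡⟨ ((∀ c p q → c * p * q ≡ c * q * p) ∋ solve-∀) cnt (n ^ suc K) (N ^ k) ⟩
    cnt * N ^ k * n ^ suc K           ≤⟨ *-monoˡ-≤ (n ^ suc K) (choices-bound k (i , a) notInBox) ⟩
    u ^ k * len * n ^ suc K           ≡⟨ ((∀ c p q → c * p * q ≡ p * (c * q)) ∋ solve-∀) (u ^ k) len (n ^ suc K) ⟩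
    len * (u ^ k * n ^ suc K)         ≤⟨ *-monoʳ-≤ len k-fold ⟩
    len * (z ^ suc K * N ^ k)         ≡⟨ sym (*-assoc len _ _) ⟩
    len * z ^ suc K * N ^ k           ∎)
    where
    open ≤-Reasoning
    k = suc M * suc K
    notInBox = not ∘ inBox i X Zs
    Hᵥ = hostStar (i , a)
    N = length Hᵥ
    N≢0 : NonZero N
    N≢0 = hostStar-nonempty i a
    n≢0 : NonZero n
    n≢0 = >-nonZero 1≤n
    u = count notInBox Hᵥ
    cnt = count (all notInBox) (choices k (i , a))
    len = length (choices k (i , a))
    U = n ^ r ∸ (n ∸ z) ^ r
    b = count (inBox i X Zs) Hᵥ
    u*n^r≤N*U : u * n ^ r ≤ N * U
    u*n^r≤N*U = begin
      u * n ^ r                          ≡⟨ cong (_* n ^ r) (sym (m+n∸m≡n b u)) ⟩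
      (b + u ∸ b) * n ^ r                ≡⟨ cong (λ t → (t ∸ b) * n ^ r) (count-not (inBox i X Zs) Hᵥ) ⟩
      (N ∸ b) * n ^ r                    ≡⟨ *-distribʳ-∸ (n ^ r) N b ⟩
      N * n ^ r ∸ b * n ^ r              ≤⟨ ∸-monoʳ-≤ (N * n ^ r) (box-fraction i X Zs z ∣Z∣≡z a a∈X) ⟩
      N * n ^ r ∸ N * (n ∸ z) ^ r        ≡⟨ sym (*-distribˡ-∸ N (n ^ r) _) ⟩
      N * U                              ∎
    one-fold : u ^ suc M * n ≤ z * N ^ suc M
    one-fold = *-cancelʳ-≤ _ _ ((n ^ r) ^ suc M) {{m^n≢0 (n ^ r) (suc M) {{m^n≢0 n r {{n≢0}}}}}} (begin
      u ^ suc M * n * (n ^ r) ^ suc M        ≡⟨ ((∀ c p q → c * p * q ≡ c * q * p) ∋ solve-∀) (u ^ suc M) n ((n ^ r) ^ suc M) ⟩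
      u ^ suc M * (n ^ r) ^ suc M * n        ≡⟨ cong (_* n) (sym (*-^-distrib u (n ^ r) (suc M))) ⟩
      (u * n ^ r) ^ suc M * n                ≤⟨ *-monoˡ-≤ n (^-monoˡ-≤ (suc M) u*n^r≤N*U) ⟩
      (N * U) ^ suc M * n                    ≡⟨ cong (_* n) (*-^-distrib N U (suc M)) ⟩
      N ^ suc M * U ^ suc M * n              ≡⟨ *-assoc (N ^ suc M) _ n ⟩
      N ^ suc M * (U ^ suc M * n)            ≤⟨ *-monoʳ-≤ (N ^ suc M) miss ⟩
      N ^ suc M * (z * (n ^ r) ^ suc M)      ≡⟨ ((∀ p z q → p * (z * q) ≡ z * p * q) ∋ solve-∀) (N ^ suc M) z ((n ^ r) ^ suc M) ⟩
      z * N ^ suc M * (n ^ r) ^ suc M        ∎)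
    k-fold : u ^ k * n ^ suc K ≤ z ^ suc K * N ^ k
    k-fold = begin
      u ^ k * n ^ suc K                      ≡⟨ cong (_* n ^ suc K) (sym (^-*-assoc u (suc M) (suc K))) ⟩
      (u ^ suc M) ^ suc K * n ^ suc K        ≡⟨ sym (*-^-distrib (u ^ suc M) n (suc K)) ⟩
      (u ^ suc M * n) ^ suc K                ≤⟨ ^-monoˡ-≤ (suc K) one-fold ⟩
      (z * N ^ suc M) ^ suc K                ≡⟨ *-^-distrib z _ (suc K) ⟩
      z ^ suc K * (N ^ suc M) ^ suc K        ≡⟨ cong (z ^ suc K *_) (^-*-assoc N (suc M) (suc K)) ⟩
      z ^ suc K * N ^ k                      ∎

  private
    count-block : ∀ {r n} (i : Fin r) (X : Vec Bool n) →
      count (λ (j , a) → does (j ≟ᶠ i) ∧ lookup X a) (allVertices r n) ≡ count (lookup X) (allFin n)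
    count-block {r} {n} i X = trans (∑-allVertices {r} {n} (λ (j , a) → 𝟙 (does (j ≟ᶠ i) ∧ lookup X a)))
      (trans (∑-cong (λ j → inner (does (j ≟ᶠ i))) (allFin r)) (point i))
      where
      x = count (lookup X) (allFin n)
      inner : ∀ b → count (λ a → b ∧ lookup X a) (allFin n) ≡ 𝟙 b * x
      inner true  = sym (*-identityˡ _)
      inner false = trans (∑-const 0 (allFin n)) (*-zeroʳ (length (allFin n)))
      point : ∀ {r} (i : Fin r) → ∑ (λ j → 𝟙 (does (j ≟ᶠ i)) * x) (allFin r) ≡ x
      point {suc r} zero    = trans (∑-allFin-suc {r} (λ j → 𝟙 (does (j ≟ᶠ zero)) * x))
        (trans (cong₂ _+_ (*-identityˡ x) (trans (∑-const 0 (allFin r)) (*-zeroʳ (length (allFin r))))) (+-identityʳ x))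
      point {suc r} (suc i) = trans (∑-allFin-suc {r} (λ j → 𝟙 (does (j ≟ᶠ suc i)) * x)) (point i)

  misses : ∀ {r n} → Fin r → Vec Bool n → Vec (Vec Bool n) r → Outcome r n → Bool
  misses i X Zs = all (all (not ∘ inBox i X Zs))

  -- The count is a product over all vertices. Those of X in block i contribute (z/n)^(K+1), the
  -- others at most 1; the exponent `𝟙 (R v)` expresses both in one product.
  miss-bound : ∀ {r n} M K z → z ≤ n → 1 ≤ n → (n ^ r ∸ (n ∸ z) ^ r) ^ suc M * n ≤ z * (n ^ r) ^ suc M →
    ∀ i x X (Zs : Vec (Vec Bool n) r) → count (lookup X) (allFin n) ≡ x → (∀ j → count (lookup (lookup Zs j)) (allFin n) ≡ z) →
    count (misses i X Zs) (sampleSpace r n (suc M * suc K)) * n ^ (suc K * x)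
      ≤ length (sampleSpace r n (suc M * suc K)) * z ^ (suc K * x)
  miss-bound {r} {n} M K z z≤n′ 1≤n miss i x X Zs ∣X∣≡x ∣Z∣≡z = begin
    count (misses i X Zs) (sampleSpace r n k) * n ^ (suc K * x)
      ≡⟨ cong₂ _*_ (trans (count-cartesian Q (map (choices k) V)) (∏-map (count Q) (choices k) V)) (powers n) ⟩
    ∏ (λ v → count Q (choices k v)) V * ∏ (λ v → (n ^ suc K) ^ 𝟙 (R v)) V
      ≡⟨ sym (∏-distrib-* (λ v → count Q (choices k v)) (λ v → (n ^ suc K) ^ 𝟙 (R v)) V) ⟩
    ∏ (λ v → count Q (choices k v) * (n ^ suc K) ^ 𝟙 (R v)) V
      ≤⟨ ∏-mono factor V ⟩
    ∏ (λ v → length (choices k v) * (z ^ suc K) ^ 𝟙 (R v)) V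
      ≡⟨ ∏-distrib-* (λ v → length (choices k v)) (λ v → (z ^ suc K) ^ 𝟙 (R v)) V ⟩
    ∏ (λ v → length (choices k v)) V * ∏ (λ v → (z ^ suc K) ^ 𝟙 (R v)) V
      ≡⟨ sym (cong₂ _*_ (trans (length-cartesian (map (choices k) V)) (∏-map length (choices k) V)) (powers z)) ⟩
    length (sampleSpace r n k) * z ^ (suc K * x) ∎
    where
    open ≤-Reasoning
    k = suc M * suc K
    V = allVertices r n
    Q = all (not ∘ inBox i X Zs)
    R : Vertex r n → Bool
    R (j , a) = does (j ≟ᶠ i) ∧ lookup X a
    powers : ∀ b → b ^ (suc K * x) ≡ ∏ (λ v → (b ^ suc K) ^ 𝟙 (R v)) V
    powers b = begin-equality
      b ^ (suc K * x)                          ≡⟨ sym (^-*-assoc b (suc K) x) ⟩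
      (b ^ suc K) ^ x                          ≡⟨ cong ((b ^ suc K) ^_) (sym (trans (count-block i X) ∣X∣≡x)) ⟩
      (b ^ suc K) ^ count R V                  ≡⟨ sym (∏-^𝟙 (b ^ suc K) R V) ⟩
      ∏ (λ v → (b ^ suc K) ^ 𝟙 (R v)) V        ∎
    factor : ∀ v → count Q (choices k v) * (n ^ suc K) ^ 𝟙 (R v) ≤ length (choices k v) * (z ^ suc K) ^ 𝟙 (R v)
    factor (j , a) = at-vertex j a
      where
      ^1 : ∀ b → b ^ 1 ≡ b
      ^1 b = *-identityʳ b
      at-vertex : ∀ j a → count Q (choices k (j , a)) * (n ^ suc K) ^ 𝟙 (R (j , a))
                          ≤ length (choices k (j , a)) * (z ^ suc K) ^ 𝟙 (R (j , a))
      at-vertex j a with j ≟ᶠ i | lookup X a in a∈X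
      ... | no _     | _     = *-monoˡ-≤ 1 (count≤length Q (choices k (j , a)))
      ... | yes refl | false = *-monoˡ-≤ 1 (count≤length Q (choices k (j , a)))
      ... | yes refl | true  = subst₂ (λ s t → count Q (choices k (i , a)) * s ≤ length (choices k (i , a)) * t)
              (sym (^1 (n ^ suc K))) (sym (^1 (z ^ suc K))) (choice-miss M K z z≤n′ 1≤n miss i X Zs ∣Z∣≡z a a∈X)

-- The union bound over all boxes.

module Sampling where
  open import Data.Bool.Base using (Bool; true; false; not)
  open import Data.Bool.ListAction using (all; any)
  open import Data.Empty using (⊥-elim)
  open import Data.Fin.Base using (Fin; suc; toℕ; fromℕ<)
  open import Data.Fin.Properties using (toℕ-fromℕ<) renaming (_≟_ to _≟ᶠ_)
  open import Data.List.Base using (allFin; length)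
  open import Data.List.Membership.Propositional using (_∈_)
  open import Data.List.Membership.Propositional.Properties using (∈-allFin; ∈-concat⁺′)
  open import Data.Nat.Base
  open import Data.Nat.Properties
  open import Data.Nat.Combinatorics using (_C_)
  open import Data.Nat.Tactic.RingSolver using (solve-∀)
  open import Data.Product.Base using (Σ; _×_; _,_; proj₁; proj₂)
  open import Data.Vec.Base using (Vec; lookup; tabulate)
  open import Data.Vec.Properties using (lookup∘tabulate)
  open import Function.Base using (_∘_; _∋_)
  open import Relation.Binary.PropositionalEquality
  open import Relation.Nullary using (yes; no)
  open Sums
  open Estimates
  open HostGraph
  open Covers
  open Counting
  open Boxes

  module _ {r n : ℕ} (z : ℕ → ℕ) where
    missesSome : Fin r → ℕ → Outcome r n → Bool
    missesSome i x ω = any (λ X → any (λ Zs → misses i X Zs ω) (vecs r (kSubsets n (z x)))) (kSubsets n x)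

    -- A Boolean, so that it can be counted and filtered by. As `toℕ x` runs from 0 to n - 1, its
    -- successor runs over the sizes of the nonempty sets X.
    bad : Outcome r n → Bool
    bad ω = any (λ i → any (λ x → missesSome i (suc (toℕ x)) ω) (allFin n)) (allFin r)

    hits : ∀ ω → bad ω ≡ false → ∀ i x X Zs → 1 ≤ x → x ≤ n → X ∈ kSubsets n x → (∀ j → lookup Zs j ∈ kSubsets n (z x)) →
           misses i X Zs ω ≡ false
    hits ω good i (suc x) X Zs _ x<n X∈ Zs∈ = any-false (vecs r (kSubsets n (z (suc x)))) (any-false (kSubsets n (suc x))
      (subst (λ y → missesSome i (suc y) ω ≡ false) (toℕ-fromℕ< x<n)
        (any-false (allFin n) (any-false (allFin r) good (∈-allFin i)) (∈-allFin (fromℕ< x<n)))) X∈) (∈-vecs⁺ Zs Zs∈)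

  good⇒expansive : ∀ {r n} c m (ω : Outcome r n) → bad (capacity c m n) ω ≡ false → Expansive c m (_∈ edgesOf ω)
  good⇒expansive {r} {n} c m ω good i X Z 1≤∣X∣ small =
    let E , E∈ω , hit = all-false (all (not ∘ inBox i (tabulate X) Zs)) ω missed
        e , e∈E , in-box = all-false (not ∘ inBox i (tabulate X) Zs) E hit
        sides = inside⇒ (side i (tabulate X) Zs) e (not-false in-box)
    in e , ∈-edgesOf ω (∈-concat⁺′ e∈E E∈ω) , in-X e (sides i) , λ j j≢i → avoids-Z e j j≢i (sides j)
    where
    z = capacity c m n (count X (allFin n))
    -- Avoiding a larger set implies avoiding `Z j`, and the enlarged set has the exact size that
    -- `bad` inspects.
    padded : ∀ j → Σ (Vec Bool n) λ p → p ∈ kSubsets n z × (∀ a → Z j a ≡ true → lookup p a ≡ true)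
    padded j = superset z (Z j) (small j) (≤-trans (m⊓n≤n (c * count X (allFin n)) _) (m∸n≤m n (suc m)))
    Zs : Vec (Vec Bool n) r
    Zs = tabulate (proj₁ ∘ padded)
    missed : misses i (tabulate X) Zs ω ≡ false
    missed = hits (capacity c m n) ω good i (count X (allFin n)) (tabulate X) Zs 1≤∣X∣
      (≤-trans (count≤length X (allFin n)) (≤-reflexive (length-allFin n))) (tabulate-∈-kSubsets X)
      (λ j → subst (_∈ kSubsets n z) (sym (lookup∘tabulate (proj₁ ∘ padded) j)) (proj₁ (proj₂ (padded j))))
    not-false : ∀ {b} → not b ≡ false → b ≡ true
    not-false {true} _ = refl
    in-X : ∀ e → side i (tabulate X) Zs i (lookup e i) ≡ true → X (lookup e i) ≡ true
    in-X e eq with i ≟ᶠ i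
    ... | yes _   = trans (sym (lookup∘tabulate X (lookup e i))) eq
    ... | no  i≢i = ⊥-elim (i≢i refl)
    avoids-Z : ∀ e j → j ≢ i → side i (tabulate X) Zs j (lookup e j) ≡ true → Z j (lookup e j) ≡ false
    avoids-Z e j j≢i eq with j ≟ᶠ i
    ... | yes j≡i = ⊥-elim (j≢i j≡i)
    ... | no  _ with Z j (lookup e j) in Zj
    ...   | false = refl
    ...   | true  = ⊥-elim (contradictory (trans (sym eq) (cong not (trans
              (cong (λ p → lookup p (lookup e j)) (lookup∘tabulate (proj₁ ∘ padded) j)) (proj₂ (proj₂ (padded j)) (lookup e j) Zj)))))
      where
      open import Data.Empty using (⊥)
      contradictory : true ≡ false → ⊥
      contradictory ()

  -- Some box over an x-set of a given block is missed with probability at most c/(n 2^x). The sum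
  -- over x ≥ 1 gives c/n for each block, hence rc/n in all.
  bad-outcomes : ∀ c r → Σ ℕ λ k → 1 ≤ k × (∀ n m → 1 ≤ n → n ≤ suc m + c * suc m →
    count (bad (capacity c m n)) (sampleSpace r n k) * n ≤ r * c * length (sampleSpace r n k))
  bad-outcomes c r = k , s≤s z≤n , bound
    where
    open ≤-Reasoning
    M = proj₁ (miss-probability c r)
    K = proj₁ (union-bound c r)
    k = suc M * suc K
    bound : ∀ n m → 1 ≤ n → n ≤ suc m + c * suc m →
      count (bad (capacity c m n)) (sampleSpace r n k) * n ≤ r * c * length (sampleSpace r n k)
    bound n m 1≤n n≤[c+1][m+1] = begin
      count (bad z) Ω * n
        ≤⟨ *-monoˡ-≤ n (≤-trans (count-any (λ i ω → any (λ x → missesSome z i (suc (toℕ x)) ω) (allFin n)) (allFin r) Ω)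
             (∑-mono (λ i → count-any (λ x ω → missesSome z i (suc (toℕ x)) ω) (allFin n) Ω) (allFin r))) ⟩
      ∑ (λ i → ∑ (λ x → count (missesSome z i (suc (toℕ x))) Ω) (allFin n)) (allFin r) * n
        ≡⟨ *-distribʳ-∑ n (λ i → ∑ (λ x → count (missesSome z i (suc (toℕ x))) Ω) (allFin n)) (allFin r) ⟩
      ∑ (λ i → ∑ (λ x → count (missesSome z i (suc (toℕ x))) Ω) (allFin n) * n) (allFin r)
        ≤⟨ ∑-mono block (allFin r) ⟩
      ∑ (λ _ → c * total) (allFin r)
        ≡⟨ trans (∑-const (c * total) (allFin r)) (cong (_* (c * total)) (length-allFin r)) ⟩
      r * (c * total)
        ≡⟨ sym (*-assoc r c total) ⟩
      r * c * total ∎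
      where
      z = capacity c m n
      Ω = sampleSpace r n k
      total = length Ω
      n≢0 : NonZero n
      n≢0 = >-nonZero 1≤n
      z≤cx : ∀ x → z x ≤ c * x
      z≤cx x = m⊓n≤m (c * x) _
      z≤n′ : ∀ x → z x ≤ n
      z≤n′ x = ≤-trans (m⊓n≤n (c * x) _) (m∸n≤m n (suc m))
      -- The cap in `capacity` yields z/n ≤ c/(c+1), which both probability estimates require.
      [c+1]z≤cn : ∀ x → suc c * z x ≤ c * n
      [c+1]z≤cn x = begin
        suc c * z x                      ≤⟨ *-monoʳ-≤ (suc c) (m⊓n≤n (c * x) _) ⟩
        suc c * (n ∸ suc m)              ≡⟨ *-distribˡ-∸ (suc c) n (suc m) ⟩
        suc c * n ∸ suc c * suc m        ≤⟨ ∸-monoʳ-≤ (suc c * n) n≤[c+1][m+1] ⟩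
        suc c * n ∸ n                    ≡⟨ m+n∸m≡n n (c * n) ⟩
        c * n                            ∎

      size : ∀ i x → 1 ≤ x → count (missesSome z i x) Ω * n * 2 ^ x ≤ c * total
      size i x 1≤x = *-cancelʳ-≤ _ _ (n ^ (suc K * x)) {{m^n≢0 n (suc K * x) {{n≢0}}}} (begin
        count (missesSome z i x) Ω * n * 2 ^ x * n ^ (suc K * x)
          ≡⟨ ((∀ b n t p → b * n * t * p ≡ b * p * (n * t)) ∋ solve-∀) (count (missesSome z i x) Ω) n (2 ^ x) (n ^ (suc K * x)) ⟩
        count (missesSome z i x) Ω * n ^ (suc K * x) * (n * 2 ^ x)
          ≤⟨ *-monoˡ-≤ (n * 2 ^ x) unioned ⟩
        (n C x) * (n C z x) ^ r * (total * z x ^ (suc K * x)) * (n * 2 ^ x)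
          ≡⟨ ((∀ a b o p n t → a * b * (o * p) * (n * t) ≡ a * b * p * n * t * o) ∋ solve-∀)
               (n C x) ((n C z x) ^ r) total (z x ^ (suc K * x)) n (2 ^ x) ⟩
        (n C x) * (n C z x) ^ r * z x ^ (suc K * x) * n * 2 ^ x * total
          ≤⟨ *-monoˡ-≤ total (proj₂ (union-bound c r) n x (z x) 1≤x (z≤cx x) (z≤n′ x) ([c+1]z≤cn x)) ⟩
        c * n ^ (suc K * x) * total
          ≡⟨ ((∀ c p o → c * p * o ≡ c * o * p) ∋ solve-∀) c (n ^ (suc K * x)) total ⟩
        c * total * n ^ (suc K * x) ∎)
        where
        ZS = vecs r (kSubsets n (z x))
        unioned : count (missesSome z i x) Ω * n ^ (suc K * x) ≤ (n C x) * (n C z x) ^ r * (total * z x ^ (suc K * x))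
        unioned = begin
          count (missesSome z i x) Ω * n ^ (suc K * x)
            ≤⟨ *-monoˡ-≤ (n ^ (suc K * x)) (≤-trans (count-any (λ X ω → any (λ Zs → misses i X Zs ω) ZS) (kSubsets n x) Ω)
                 (∑-mono (λ X → count-any (λ Zs → misses i X Zs) ZS Ω) (kSubsets n x))) ⟩
          ∑ (λ X → ∑ (λ Zs → count (misses i X Zs) Ω) ZS) (kSubsets n x) * n ^ (suc K * x)
            ≡⟨ trans (*-distribʳ-∑ _ (λ X → ∑ (λ Zs → count (misses i X Zs) Ω) ZS) (kSubsets n x))
                     (∑-cong (λ X → *-distribʳ-∑ _ (λ Zs → count (misses i X Zs) Ω) ZS) (kSubsets n x)) ⟩
          ∑ (λ X → ∑ (λ Zs → count (misses i X Zs) Ω * n ^ (suc K * x)) ZS) (kSubsets n x)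
            ≤⟨ ∑-mono-∈ (kSubsets n x) (λ X X∈ → ∑-mono-∈ ZS λ Zs Zs∈ → miss-bound M K (z x) (z≤n′ x) 1≤n
                 (proj₂ (miss-probability c r) n (z x) (z≤n′ x) ([c+1]z≤cn x)) i x X Zs
                 (count-kSubset n x X∈) (λ j → count-kSubset n (z x) (∈-vecs⁻ Zs∈ j))) ⟩
          ∑ (λ X → ∑ (λ Zs → total * z x ^ (suc K * x)) ZS) (kSubsets n x)
            ≡⟨ trans (∑-const (∑ (λ Zs → total * z x ^ (suc K * x)) ZS) (kSubsets n x))
                     (cong₂ _*_ (length-kSubsets n x) (trans (∑-const (total * z x ^ (suc K * x)) ZS)
                       (cong (_* (total * z x ^ (suc K * x))) (trans (length-vecs r (kSubsets n (z x))) (cong (_^ r) (length-kSubsets n (z x))))))) ⟩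
          (n C x) * ((n C z x) ^ r * (total * z x ^ (suc K * x)))
            ≡⟨ sym (*-assoc (n C x) _ _) ⟩
          (n C x) * (n C z x) ^ r * (total * z x ^ (suc K * x)) ∎

      block : ∀ i → ∑ (λ x → count (missesSome z i (suc (toℕ x))) Ω) (allFin n) * n ≤ c * total
      block i = begin
        ∑ (λ x → count (missesSome z i (suc (toℕ x))) Ω) (allFin n) * n
          ≡⟨ *-distribʳ-∑ n (λ x → count (missesSome z i (suc (toℕ x))) Ω) (allFin n) ⟩
        ∑ (λ x → count (missesSome z i (suc (toℕ x))) Ω * n) (allFin n)
          ≤⟨ ∑-geometric (c * total) n (λ x → count (missesSome z i (suc x)) Ω * n) (λ x _ → size i (suc x) (s≤s z≤n)) ⟩
        c * total ∎

-- Choice of the block parameter and passage to ε.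

module Conclusion where
  open import Data.Bool.Base using (Bool; false; not; T)
  open import Data.Fin.Base using (zero)
  open import Data.Integer.Base as ℤ using (+_; -[1+_])
  open import Data.List.Base using (List; length; filterᵇ)
  open import Data.List.Membership.Propositional using (_∈_)
  open import Data.List.Membership.Propositional.Properties using (∈-filter⁻)
  open import Data.List.Relation.Binary.Sublist.Propositional using (_⊆_)
  open import Data.List.Relation.Binary.Sublist.Propositional.Properties using (filter-⊆)
  open import Data.List.Relation.Unary.All as All using (All)
  open import Data.Nat.Base as ℕ using (ℕ; suc)
  open import Data.Nat.DivMod using (_/_; _%_; m/n*n≤m; m≡m%n+[m/n]*n; m%n<n; m/n<m)
  import Data.Nat.Properties as ℕ
  open import Data.Nat.Tactic.RingSolver using () renaming (solve-∀ to solve-∀ₙ)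
  open import Data.Product.Base using (Σ; _×_; _,_; proj₁; proj₂)
  open import Data.Rational.Base using (ℚ; 0ℚ; 1ℚ; mkℚ; ↧ₙ_; _+_; _*_; _-_; -_; _≤_; _<_; *<*; nonNegative; NonNegative; Positive)
  open import Data.Rational.Properties
  open import Function.Base using (_∘_; _∋_)
  open import Relation.Binary.PropositionalEquality
  open import Relation.Nullary.Decidable using (T?)
  open import Tactic.RingSolver using (solve-∀)
  open RationalSums
  open Sums
  open Covers
  open Embedding
  open Duality
  open Sampling

  -- The expansion constant is `suc c` here, so m is the quotient of n by a divisor of at least 2
  -- and hence smaller than n.
  block-size : ∀ c n → 1 ℕ.≤ n → Σ ℕ λ m → m ℕ.< n × m ℕ.* suc (suc c) ℕ.≤ n × n ℕ.≤ suc m ℕ.+ suc c ℕ.* suc m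
  block-size c n@(suc _) _ = m , m/n<m n d (ℕ.s≤s (ℕ.s≤s ℕ.z≤n)) , m/n*n≤m n d , (begin
    n                        ≡⟨ m≡m%n+[m/n]*n n d ⟩
    n % d ℕ.+ m ℕ.* d        ≤⟨ ℕ.+-monoˡ-≤ (m ℕ.* d) (ℕ.<⇒≤ (m%n<n n d)) ⟩
    d ℕ.+ m ℕ.* d            ≡⟨ ℕ.*-comm (suc m) d ⟩
    d ℕ.* suc m              ∎)
    where
    open ℕ.≤-Reasoning
    d = suc (suc c)
    m = n / d

  -- With q the denominator of ε, the number qε is a positive integer, so ε ≥ 1/q; and n ≥ Cq pushes
  -- the bad proportion C/n down to 1/q.
  few-bad⇒many-good : ∀ ε → 0ℚ < ε → ∀ b g t n C → 1 ℕ.≤ C → b ℕ.+ g ≡ t → b ℕ.* n ℕ.≤ C ℕ.* t → C ℕ.* ↧ₙ ε ℕ.≤ n →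
                      (1ℚ - ε) * ℕtoℚ t ≤ ℕtoℚ g
  few-bad⇒many-good ε 0<ε b g t n C 1≤C b+g≡t few n-large = begin
    (1ℚ - ε) * ℕtoℚ t                      ≡⟨ ((∀ e t → (1ℚ - e) * t ≡ t - e * t) ∋ solve-∀ ring) ε (ℕtoℚ t) ⟩
    ℕtoℚ t - ε * ℕtoℚ t                    ≤⟨ +-monoʳ-≤ (ℕtoℚ t) (neg-antimono-≤ b≤εt) ⟩
    ℕtoℚ t - ℕtoℚ b                        ≡⟨ cong (_- ℕtoℚ b) (trans (cong ℕtoℚ (sym b+g≡t)) (ℕtoℚ-+ b g)) ⟩
    (ℕtoℚ b + ℕtoℚ g) - ℕtoℚ b             ≡⟨ ((∀ b g → (b + g) - b ≡ g) ∋ solve-∀ ring) (ℕtoℚ b) (ℕtoℚ g) ⟩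
    ℕtoℚ g                                 ∎
    where
    open ≤-Reasoning
    q = ↧ₙ ε
    instance
      q-positive : Positive (ℕtoℚ q)
      q-positive = ℕtoℚ-positive {q} (ℕ.s≤s ℕ.z≤n)
      t-nonNeg : NonNegative (ℕtoℚ t)
      t-nonNeg = nonNegative (0≤ℕtoℚ t)
    qb≤t : q ℕ.* b ℕ.≤ t
    qb≤t = ℕ.*-cancelˡ-≤ C {{ℕ.>-nonZero 1≤C}} (ℕ.≤-trans (ℕ.≤-reflexive (rearrange C q b))
      (ℕ.≤-trans (ℕ.*-monoʳ-≤ b n-large) few))
      where
      rearrange : ∀ C q b → C ℕ.* (q ℕ.* b) ≡ b ℕ.* (C ℕ.* q)
      rearrange = solve-∀ₙ
    1≤qε : ∀ ε → 0ℚ < ε → 1ℚ ≤ ℕtoℚ (↧ₙ ε) * ε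
    1≤qε ε@(mkℚ (+ suc a)  _ _) _ = subst (1ℚ ≤_) (sym (↧-scale ε)) (ℕtoℚ-mono-≤ {1} {suc a} (ℕ.s≤s ℕ.z≤n))
    1≤qε (mkℚ (+ 0)      _ _) (*<* (ℤ.+<+ ()))
    1≤qε (mkℚ -[1+ a ]   _ _) (*<* ())
    b≤εt : ℕtoℚ b ≤ ε * ℕtoℚ t
    b≤εt = *-cancelˡ-≤-pos (ℕtoℚ q) (begin
      ℕtoℚ q * ℕtoℚ b              ≡⟨ sym (ℕtoℚ-* q b) ⟩
      ℕtoℚ (q ℕ.* b)               ≤⟨ ℕtoℚ-mono-≤ qb≤t ⟩
      ℕtoℚ t                       ≡⟨ sym (*-identityˡ _) ⟩
      1ℚ * ℕtoℚ t                  ≤⟨ *-monoʳ-≤-nonNeg (ℕtoℚ t) (1≤qε ε 0<ε) ⟩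
      (ℕtoℚ q * ε) * ℕtoℚ t        ≡⟨ *-assoc (ℕtoℚ q) ε _ ⟩
      ℕtoℚ q * (ε * ℕtoℚ t)        ∎)

  -- `Good` quantifies over rational weight functions; the sublist is cut out by the decidable
  -- condition of not being `bad`, which implies it.
  good-outcomes : ∀ r {c m n} k → suc r ℕ.* suc r ℕ.< c → m ℕ.< n → m ℕ.* suc c ℕ.≤ n → n ℕ.≤ suc m ℕ.+ c ℕ.* suc m →
    ∀ ε → 0ℚ < ε → suc r ℕ.* c ℕ.* ↧ₙ ε ℕ.≤ n →
    count (bad (capacity c m n)) (sampleSpace (suc r) n k) ℕ.* n ℕ.≤ suc r ℕ.* c ℕ.* length (sampleSpace (suc r) n k) →
    Σ (List (Outcome (suc r) n)) λ S → S ⊆ sampleSpace (suc r) n k × All Good S ×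
      (1ℚ - ε) * ℕtoℚ (length (sampleSpace (suc r) n k)) ≤ ℕtoℚ (length S)
  good-outcomes r {c} {m} {n} k r²<c m<n m[c+1]≤n n≤[c+1][m+1] ε 0<ε n-large few =
    filterᵇ good Ω , filter-⊆ (T? ∘ good) Ω , All.tabulate is-good ,
    few-bad⇒many-good ε 0<ε (count isBad Ω) (length (filterᵇ good Ω)) (length Ω) n (suc r ℕ.* c) (ℕ.*-mono-≤ {1} {suc r} (ℕ.s≤s ℕ.z≤n) (ℕ.≤-trans (ℕ.s≤s ℕ.z≤n) r²<c))
      (trans (cong (count isBad Ω ℕ.+_) (length-filterᵇ good Ω)) (count-not isBad Ω)) few n-large
    where
    Ω = sampleSpace (suc r) n k
    isBad : Outcome (suc r) n → Bool
    isBad = bad (capacity c m n)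
    good : Outcome (suc r) n → Bool
    good = not ∘ isBad
    is-good : ∀ {ω} → ω ∈ filterᵇ good Ω → Good ω
    is-good {ω} ω∈ = perfect-matching ω bound , min-cover-constant ω bound
      where
      ¬bad : ∀ b → T (not b) → b ≡ false
      ¬bad false _ = refl
      bound : TotalBound ω
      bound = expansive⇒totalBound {c = c} zero r²<c m<n m[c+1]≤n n≤[c+1][m+1] ω
        (good⇒expansive c m ω (¬bad (isBad ω) (proj₂ (∈-filter⁻ (T? ∘ good) {xs = Ω} ω∈))))

open import Data.Nat using (ℕ; _≥_)
open import Data.Product using (Σ; _×_)
open import Data.List using (List; length)
open import Data.List.Relation.Unary.All using (All)
open import Data.List.Relation.Binary.Sublist.Propositional using (_⊆_)
open import Data.Rational using (ℚ; 0ℚ; 1ℚ; _-_; _*_; _≤_; _<_)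

theorem2 : (r : ℕ) → r ≥ 1 →
    Σ ℕ (λ k → k ≥ 1 ×
    ((ε : ℚ) → 0ℚ < ε →
    Σ ℕ (λ N → (n : ℕ) → n ≥ N →
    Σ (List (Outcome r n)) (λ S →
    S ⊆ sampleSpace r n k ×
    All Good S ×
    (1ℚ - ε) * ℕtoℚ (length (sampleSpace r n k)) ≤ ℕtoℚ (length S)))))
theorem2 (ℕ.suc r) _ = k , proj₁ (proj₂ few-bad) , λ ε 0<ε → C ℕ.* ↧ₙ ε , λ n n-large →
  let 1≤n = ℕ.≤-trans (ℕ.*-mono-≤ {1} {C} (ℕ.s≤s ℕ.z≤n) (ℕ.s≤s ℕ.z≤n)) n-large
      m , m<n , m[c+1]≤n , n≤[c+1][m+1] = block-size (suc r ℕ.* suc r) n 1≤n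
  in good-outcomes r {c} {m} k (ℕ.n<1+n _) m<n m[c+1]≤n n≤[c+1][m+1] ε 0<ε n-large
       (proj₂ (proj₂ few-bad) n m 1≤n n≤[c+1][m+1])
  where
  open import Data.Nat.Base as ℕ using (suc)
  import Data.Nat.Properties as ℕ
  open import Data.Product.Base using (_,_; proj₁; proj₂)
  open import Data.Rational.Base using (↧ₙ_)
  open Conclusion
  -- The least integer above the square of the number of blocks.
  c = suc (suc r ℕ.* suc r)
  -- C/n bounds the proportion of bad outcomes, so C times the denominator of ε is a valid lower
  -- bound for n.
  C = suc r ℕ.* c
  few-bad = Sampling.bad-outcomes c (suc r)
  k = proj₁ few-bad
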